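{- The domino problem of the hyperbolic plane is undecidable: there is no algorithm which, given as input an arbitrary finite set $S$ of prototiles (regular heptagons with interior angles $2\pi/3$, each side carrying a colour), decides whether or not the hyperbolic plane admits a tiling by copies of the elements of $S$.
   Context: The heptagrid is the regular tessellation $\{7,3\}$ of the hyperbolic plane, whose tiles are regular heptagons with interior angles $2\pi/3$, three tiles meeting at each vertex. A prototile is such a heptagon whose sides carry colours (marks). A tiling by a finite set $S$ of prototiles is a placement, on every tile of the heptagrid, of a copy of an element of $S$ (an image of it under an isometry of the hyperbolic plane), such that whenever two tiles share a side, the colours they carry on that common side match. The domino (tiling) problem asks, for a given finite set $S$, whether such a tiling of the whole hyperbolic plane exists. -}

module Defs where

open import Data.Nat using (ℕ; zero; suc; _+_; _*_; _<_)
open import Data.Nat.DivMod using (_/_; _mod_)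
open import Data.Fin using (Fin; toℕ)
open import Data.Vec using (Vec; []; _∷_; lookup)
open import Data.List using (List; []; _∷_; _++_; replicate)
open import Data.List.Membership.Propositional using (_∈_)
open import Data.List.Relation.Unary.Any using (Any)
open import Data.Product using (Σ; _×_; ∃-syntax)
open import Data.Sum using (_⊎_)
open import Relation.Binary.PropositionalEquality using (_≡_)
open import Relation.Nullary using (¬_)

data Code : ℕ → Set where
  zeroF : ∀ {n} → Code n
  succF : Code 1
  proj  : ∀ {n} → Fin n → Code n
  comp  : ∀ {m n} → Code m → Vec (Code n) m → Code n
  prec  : ∀ {n} → Code n → Code (2 + n) → Code (1 + n)
  mu    : ∀ {n} → Code (1 + n) → Code n

mutual
  data _⟦_⟧⇓_ : ∀ {n} → Code n → Vec ℕ n → ℕ → Set where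
    ev-zero : ∀ {n} {xs : Vec ℕ n} → zeroF ⟦ xs ⟧⇓ 0
    ev-succ : ∀ {x} → succF ⟦ x ∷ [] ⟧⇓ suc x
    ev-proj : ∀ {n} {i : Fin n} {xs} → proj i ⟦ xs ⟧⇓ lookup xs i
    ev-comp : ∀ {m n} {f : Code m} {gs : Vec (Code n) m} {xs ys y} →
              gs ⟦ xs ⟧⇓* ys → f ⟦ ys ⟧⇓ y → comp f gs ⟦ xs ⟧⇓ y
    ev-prec-z : ∀ {n} {f : Code n} {g : Code (2 + n)} {xs y} →
                f ⟦ xs ⟧⇓ y → prec f g ⟦ 0 ∷ xs ⟧⇓ y
    ev-prec-s : ∀ {n} {f : Code n} {g : Code (2 + n)} {k xs r y} →
                prec f g ⟦ k ∷ xs ⟧⇓ r → g ⟦ k ∷ r ∷ xs ⟧⇓ y →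
                prec f g ⟦ suc k ∷ xs ⟧⇓ y
    ev-mu : ∀ {n} {f : Code (1 + n)} {xs k} →
            f ⟦ k ∷ xs ⟧⇓ 0 →
            (∀ j → j < k → Σ ℕ (λ v → f ⟦ j ∷ xs ⟧⇓ suc v)) →
            mu f ⟦ xs ⟧⇓ k

  data _⟦_⟧⇓*_ : ∀ {m n} → Vec (Code n) m → Vec ℕ n → Vec ℕ m → Set where
    ev-[] : ∀ {n} {xs : Vec ℕ n} → [] ⟦ xs ⟧⇓* []
    ev-∷  : ∀ {m n} {g : Code n} {gs : Vec (Code n) m} {xs y ys} →
            g ⟦ xs ⟧⇓ y → gs ⟦ xs ⟧⇓* ys → (g ∷ gs) ⟦ xs ⟧⇓* (y ∷ ys)

pair : ℕ → ℕ → ℕ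
pair x y = ((x + y) * suc (x + y)) / 2 + y

encVec : ∀ {n} → Vec ℕ n → ℕ
encVec []       = 0
encVec (x ∷ xs) = suc (pair x (encVec xs))

-- A prototile: a heptagon whose 7 sides, listed in cyclic order, carry
-- colours (natural numbers).
Prototile : Set
Prototile = Vec ℕ 7

encTiles : List Prototile → ℕ
encTiles []       = 0
encTiles (p ∷ ps) = suc (pair (encVec p) (encTiles ps))

-- The heptagrid {7,3}, combinatorially.
-- Its orientation-preserving symmetry group is the (2,3,7) triangle group
--   D = ⟨ a , c ∣ a⁷ , c² , (a c)³ ⟩,
-- where a is the rotation by 2π/7 about the centre of a tile and c the
-- half-turn about the midpoint of one of its sides.  D acts simply
-- transitively on the "darts" (pairs (tile, side of that tile)); fixing a
-- base dart, a word w denotes the dart w·d₀.  Right multiplication by a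
-- moves to the next side (in cyclic order) of the same tile, right
-- multiplication by c moves to the same side seen from the adjacent tile.

data Gen : Set where
  a c : Gen

Word : Set
Word = List Gen

relators : List Word
relators = replicate 7 a ∷ (c ∷ c ∷ []) ∷ (a ∷ c ∷ a ∷ c ∷ a ∷ c ∷ []) ∷ []

-- An assignment of a colour to each side of each tile: a function on
-- darts, i.e. a function on words that is invariant under the defining
-- relations of D.
WellDefined : (Word → ℕ) → Set
WellDefined col = ∀ (u v r : Word) → r ∈ relators → col (u ++ r ++ v) ≡ col (u ++ v)

Matching : (Word → ℕ) → Set
Matching col = ∀ (g : Word) → col (g ++ (c ∷ [])) ≡ col g

-- The tile containing dart g carries a copy of prototile p, i.e. an
-- image of p under an isometry: a rotation, or a reflection (which
-- reverses the cyclic order of the sides).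
IsCopy : (Word → ℕ) → Word → Prototile → Set
IsCopy col g p = Σ ℕ λ k →
    (∀ (i : Fin 7) → col (g ++ replicate (toℕ i) a) ≡ lookup p ((k + toℕ i) mod 7))
  ⊎ (∀ (i : Fin 7) → col (g ++ replicate (toℕ i) a) ≡ lookup p ((k + 6 * toℕ i) mod 7))

Tileable : List Prototile → Set
Tileable S = ∃[ col ] (WellDefined col × Matching col × (∀ (g : Word) → Any (IsCopy col g) S))

DecidesDomino : Code 1 → Set
DecidesDomino f = ∀ (S : List Prototile) →
  (Tileable S → f ⟦ encTiles S ∷ [] ⟧⇓ 1) × (¬ Tileable S → f ⟦ encTiles S ∷ [] ⟧⇓ 0)

{-# OPTIONS --safe #-}
module Submission where

-- The domino problem is reduced from the behaviour of counter machines by way of the immortality problem.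
--
-- A row of the tiling (tiles at a given combinatorial distance from a base line or tile) carries one transition of a
-- machine with finitely many states and several stacks.  Each tile has exactly one child that inherits its state, and
-- the number of tiles in a row grows, so there is always room for pushing a symbol: it is stored in all tiles whose
-- cell is free.  A cell remembers one bit, namely whether the cell to its left was on top when it was created; these
-- bits suffice to find the new top cells when a symbol is popped.  Nothing constrains the stacks below what was pushed
-- since a given row, so a tiling exists if and only if the machine has an infinite run on stacks of unknown contents.
--
-- As in Hooper's theorem, a counter machine is turned into a stack machine that runs it only in nested frames: a frame
-- restarts the computation from scratch, makes one step for each cell of the region that it sweeps, and calls at each
-- cell a frame that sweeps in the opposite direction.  If the computation is infinite, so are the frames; if it halts,
-- every run from every configuration eventually tries to extend a halting computation.
--
-- The input of the counter machine only enters through a counter in the states, so the colours of the tiles are affine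
-- in it.  A decision procedure f would then yield a program that expands its input into a set of prototiles and applies
-- f; the input chosen is a description of the tiles belonging to that very program.

-- Nothing obliges a tiling to contain a designated tile, so no row can be made to carry an initial
-- configuration: what a tiling shows from one of its tiles downwards is a run from an arbitrary
-- intermediate configuration. Hence it is not enough that the simulated computation halts; the
-- machine must then have no infinite run from any configuration. The danger is garbage on the
-- stacks, above all a stretch of cells without end, over which a frame could travel forever. The
-- call at each cell removes it. The called frame starts the counter machine afresh, and if that
-- machine halts after `i₀` steps, the called frame must meet a marker within `i₀` cells or get
-- stuck. So the cells behind a garbage frame are bounded in number too, and it can advance only
-- boundedly often before it turns back. The way back in loop B hands all stacks to the caller as
-- they were before the call, so that calls do not disturb the computations in progress.

-- Decoding of pairs, and programs that expand parametrised lists of prototiles.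

module TileCodes where
  open import Defs hiding (a; c)
  open import Data.Nat
  open import Data.Nat.Properties
  open import Data.Nat.DivMod using (_/_; +-distrib-/-∣ʳ; m*n/n≡m)
  open import Data.Nat.Divisibility using (divides-refl)
  open import Data.Nat.Tactic.RingSolver using (solve-∀)
  open import Data.Fin using (zero; suc)
  open import Data.Vec using (Vec; []; _∷_)
  open import Data.List using (List; []; _∷_; length; _ʳ++_)
  import Data.List as L
  import Data.Vec as V
  open import Data.Product
  open import Data.Empty using (⊥-elim)
  open import Relation.Binary.PropositionalEquality
  open import Relation.Binary.Definitions using (tri<; tri≈; tri>)

  tri : ℕ → ℕ
  tri zero = 0
  tri (suc s) = suc s + tri s

  tri-half : ∀ s → (s * suc s) / 2 ≡ tri s
  tri-half zero = refl
  tri-half (suc s) = begin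
    (suc s * suc (suc s)) / 2            ≡⟨ cong (_/ 2) (shuffle s) ⟩
    (s * suc s + suc s * 2) / 2          ≡⟨ +-distrib-/-∣ʳ (s * suc s) (divides-refl (suc s)) ⟩
    (s * suc s) / 2 + (suc s * 2) / 2    ≡⟨ cong₂ _+_ (tri-half s) (m*n/n≡m (suc s) 2) ⟩
    tri s + suc s                        ≡⟨ +-comm (tri s) (suc s) ⟩
    suc s + tri s                        ∎
    where
    open ≡-Reasoning
    shuffle : ∀ s → suc s * suc (suc s) ≡ s * suc s + suc s * 2
    shuffle = solve-∀

  pair-tri : ∀ x y → pair x y ≡ tri (x + y) + y
  pair-tri x y = cong (_+ y) (tri-half (x + y))

  tri-mono : ∀ {s t} → s ≤ t → tri s ≤ tri t
  tri-mono z≤n = z≤n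
  tri-mono (s≤s p) = +-mono-≤ (s≤s p) (tri-mono p)

  -- The codes on diagonal `s` are `tri s + y` with `y ≤ s`, so `tri (suc s)` exceeds all of them.
  -- Equal codes must therefore lie on the same diagonal.
  tri-gap : ∀ {s t y z} → s < t → y ≤ s → tri s + y < tri t + z
  tri-gap {s} {t} {y} {z} s<t y≤s = begin-strict
    tri s + y       ≡⟨ +-comm (tri s) y ⟩
    y + tri s       <⟨ +-monoˡ-< (tri s) (s≤s y≤s) ⟩
    tri (suc s)     ≤⟨ tri-mono s<t ⟩
    tri t           ≤⟨ m≤m+n (tri t) z ⟩
    tri t + z       ∎
    where open ≤-Reasoning

  pair-injective : ∀ {x y x′ y′} → pair x y ≡ pair x′ y′ → x ≡ x′ × y ≡ y′
  pair-injective {x} {y} {x′} {y′} eq with trans (sym (pair-tri x y)) (trans eq (pair-tri x′ y′))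
  ... | e with <-cmp (x + y) (x′ + y′)
  ... | tri< lt _ _ = ⊥-elim (<-irrefl e (tri-gap lt (m≤n+m y x)))
  ... | tri> _ _ gt = ⊥-elim (<-irrefl (sym e) (tri-gap gt (m≤n+m y′ x′)))
  ... | tri≈ _ s≡ _ = x≡ , y≡
    where
    y≡ : y ≡ y′
    y≡ = +-cancelˡ-≡ (tri (x + y)) y y′ (trans e (cong (λ s → tri s + y′) (sym s≡)))
    x≡ : x ≡ x′
    x≡ = +-cancelʳ-≡ y x x′ (trans s≡ (cong (x′ +_) (sym y≡)))

  value : ∀ {n} {f : Code n} {xs y z} → y ≡ z → f ⟦ xs ⟧⇓ y → f ⟦ xs ⟧⇓ z
  value refl p = p

  app₁ : ∀ {n} {f : Code 1} {g : Code n} {xs y z} →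
         g ⟦ xs ⟧⇓ y → f ⟦ y ∷ [] ⟧⇓ z → comp f (g ∷ []) ⟦ xs ⟧⇓ z
  app₁ p q = ev-comp (ev-∷ p ev-[]) q

  app₂ : ∀ {n} {f : Code 2} {g h : Code n} {xs y z w} →
         g ⟦ xs ⟧⇓ y → h ⟦ xs ⟧⇓ z → f ⟦ y ∷ z ∷ [] ⟧⇓ w → comp f (g ∷ h ∷ []) ⟦ xs ⟧⇓ w
  app₂ p q r = ev-comp (ev-∷ p (ev-∷ q ev-[])) r

  addC : Code 2
  addC = prec (proj zero) (comp succF (proj (suc zero) ∷ []))

  addC⇓ : ∀ x y → addC ⟦ x ∷ y ∷ [] ⟧⇓ (x + y)
  addC⇓ zero y = ev-prec-z ev-proj
  addC⇓ (suc x) y = ev-prec-s (addC⇓ x y) (app₁ ev-proj ev-succ)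

  triC : Code 1
  triC = prec zeroF (comp addC (comp succF (proj zero ∷ []) ∷ proj (suc zero) ∷ []))

  triC⇓ : ∀ x → triC ⟦ x ∷ [] ⟧⇓ tri x
  triC⇓ zero = ev-prec-z ev-zero
  triC⇓ (suc x) = ev-prec-s (triC⇓ x) (app₂ (app₁ ev-proj ev-succ) ev-proj (addC⇓ (suc x) (tri x)))

  pairC : Code 2
  pairC = comp addC (comp triC (addC ∷ []) ∷ proj (suc zero) ∷ [])

  pairC⇓ : ∀ x y → pairC ⟦ x ∷ y ∷ [] ⟧⇓ pair x y
  pairC⇓ x y rewrite pair-tri x y =
    app₂ (app₁ (addC⇓ x y) (triC⇓ (x + y))) ev-proj (addC⇓ (tri (x + y)) y)

  mulC : Code 2
  mulC = prec zeroF (comp addC (proj (suc (suc zero)) ∷ proj (suc zero) ∷ []))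

  mulC⇓ : ∀ x y → mulC ⟦ x ∷ y ∷ [] ⟧⇓ (x * y)
  mulC⇓ zero y = ev-prec-z ev-zero
  mulC⇓ (suc x) y = ev-prec-s (mulC⇓ x y) (app₂ ev-proj ev-proj (addC⇓ y (x * y)))

  predC : Code 1
  predC = prec zeroF (proj zero)

  predC⇓ : ∀ x → predC ⟦ x ∷ [] ⟧⇓ pred x
  predC⇓ zero = ev-prec-z ev-zero
  predC⇓ (suc x) = ev-prec-s (predC⇓ x) ev-proj

  monusC : Code 2
  monusC = prec (proj zero) (comp predC (proj (suc zero) ∷ []))

  monusC⇓ : ∀ y x → monusC ⟦ y ∷ x ∷ [] ⟧⇓ (x ∸ y)
  monusC⇓ zero x = ev-prec-z ev-proj
  monusC⇓ (suc y) x = ev-prec-s (monusC⇓ y x) (value (pred[m∸n]≡m∸[1+n] x y) (app₁ ev-proj (predC⇓ (x ∸ y))))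

  -- The truncated difference `suc z ∸ tri (suc j)` vanishes exactly when `z < tri (suc j)`, and for
  -- `z = pair x y` the least such `j` is the diagonal `x + y`.
  diagonalC : Code 1
  diagonalC = mu (comp monusC (comp triC (comp succF (proj zero ∷ []) ∷ []) ∷ comp succF (proj (suc zero) ∷ []) ∷ []))

  diagonalC⇓ : ∀ x y → diagonalC ⟦ pair x y ∷ [] ⟧⇓ (x + y)
  diagonalC⇓ x y rewrite pair-tri x y = ev-mu (value hit (test (x + y)))
      λ j j< → tri (x + y) + y ∸ tri (suc j) ,
        value (+-∸-assoc 1 (≤-trans (tri-mono j<) (m≤m+n (tri (x + y)) y))) (test j)
    where
    test : ∀ {z} j → comp monusC (comp triC (comp succF (proj zero ∷ []) ∷ []) ∷ comp succF (proj (suc zero) ∷ []) ∷ []) ⟦ j ∷ z ∷ [] ⟧⇓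
           (suc z ∸ tri (suc j))
    test j = app₂ (app₁ (app₁ ev-proj ev-succ) (triC⇓ (suc j))) (app₁ ev-proj ev-succ) (monusC⇓ (tri (suc j)) _)
    hit : suc (tri (x + y) + y) ∸ tri (suc (x + y)) ≡ 0
    hit = m≤n⇒m∸n≡0 (s≤s (≤-trans (≤-reflexive (+-comm (tri (x + y)) y)) (+-monoˡ-≤ (tri (x + y)) (m≤n+m y x))))

  leftC rightC : Code 1
  rightC = comp monusC (comp triC (diagonalC ∷ []) ∷ proj zero ∷ [])
  leftC = comp monusC (rightC ∷ diagonalC ∷ [])

  rightC⇓ : ∀ x y → rightC ⟦ pair x y ∷ [] ⟧⇓ y
  rightC⇓ x y = value (trans (cong (_∸ tri (x + y)) (pair-tri x y)) (m+n∸m≡n (tri (x + y)) y))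
                  (app₂ (app₁ (diagonalC⇓ x y) (triC⇓ (x + y))) ev-proj (monusC⇓ (tri (x + y)) (pair x y)))

  leftC⇓ : ∀ x y → leftC ⟦ pair x y ∷ [] ⟧⇓ x
  leftC⇓ x y = value (m+n∸n≡m x y) (app₂ (rightC⇓ x y) (diagonalC⇓ x y) (monusC⇓ y (x + y)))

  -- A colour depending on a parameter `i`: the first component is fixed, the second affine in `i`
  -- with slope `w`. This suffices because the input enters the machine only through a number
  -- counted in its states.
  Entry : Set
  Entry = ℕ × ℕ × ℕ

  ⟪_⟫ : Entry → ℕ → ℕ
  ⟪ u , v , w ⟫ i = pair u (v + w * i)

  Pattern : Set
  Pattern = List (Vec Entry 7)

  inst : ℕ → Pattern → List Prototile
  inst i = L.map (V.map (λ e → ⟪ e ⟫ i))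

  blocks : Pattern → ℕ → List Prototile
  blocks ps zero = []
  blocks ps (suc i) = inst i ps L.++ blocks ps i

  -- Among the rules behind `base` are those that fire when a count has reached the input; those
  -- behind `ps` count one step. Hence one instance at `n` against one for every `i < n`.
  family : Pattern → Pattern → ℕ → List Prototile
  family base ps n = inst n base L.++ blocks ps n

  encEntry : Entry → ℕ
  encEntry (u , v , w) = pair u (pair v w)

  encTile : ∀ {k} → Vec Entry k → ℕ
  encTile [] = 0
  encTile (e ∷ es) = pair (encEntry e) (encTile es)

  stream : Pattern → ℕ
  stream [] = 0
  stream (p ∷ ps) = pair (encTile p) (stream ps)

  -- The stream is reversed because `listC` builds its result by primitive recursion, from the last
  -- tile to the first: stage `k` conses entry `k` of the reversed stream, and the original order
  -- comes out.
  encPattern : Pattern → ℕ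
  encPattern ps = pair (length ps) (stream (ps ʳ++ []))

  encFamily : Pattern → Pattern → ℕ
  encFamily base ps = pair (encPattern base) (encPattern ps)

  entryC : Code 2
  entryC = comp pairC (comp leftC (proj zero ∷ []) ∷
    comp addC (comp leftC (comp rightC (proj zero ∷ []) ∷ []) ∷
      comp mulC (comp rightC (comp rightC (proj zero ∷ []) ∷ []) ∷ proj (suc zero) ∷ []) ∷ []) ∷ [])

  entryC⇓ : ∀ e i → entryC ⟦ encEntry e ∷ i ∷ [] ⟧⇓ ⟪ e ⟫ i
  entryC⇓ (u , v , w) i = app₂ (app₁ ev-proj (leftC⇓ u (pair v w)))
    (app₂ (app₁ (app₁ ev-proj (rightC⇓ u (pair v w))) (leftC⇓ v w))
      (app₂ (app₁ (app₁ ev-proj (rightC⇓ u (pair v w))) (rightC⇓ v w)) ev-proj (mulC⇓ w i)) (addC⇓ v (w * i))) (pairC⇓ _ _)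

  tileC : ℕ → Code 2
  tileC zero = zeroF
  tileC (suc k) = comp succF (comp pairC (comp entryC (comp leftC (proj zero ∷ []) ∷ proj (suc zero) ∷ []) ∷
    comp (tileC k) (comp rightC (proj zero ∷ []) ∷ proj (suc zero) ∷ []) ∷ []) ∷ [])

  tileC⇓ : ∀ {k} (es : Vec Entry k) i → tileC k ⟦ encTile es ∷ i ∷ [] ⟧⇓ encVec (V.map (λ e → ⟪ e ⟫ i) es)
  tileC⇓ [] i = ev-zero
  tileC⇓ (e ∷ es) i = app₁ (app₂
    (app₂ (app₁ ev-proj (leftC⇓ (encEntry e) (encTile es))) ev-proj (entryC⇓ e i))
    (app₂ (app₁ ev-proj (rightC⇓ (encEntry e) (encTile es))) ev-proj (tileC⇓ es i)) (pairC⇓ _ _)) ev-succ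

  dropC : Code 2
  dropC = prec (proj zero) (comp rightC (proj (suc zero) ∷ []))

  dropC⇓ : ∀ us vs → dropC ⟦ length us ∷ stream (us ʳ++ vs) ∷ [] ⟧⇓ stream vs
  dropC⇓ [] vs = ev-prec-z ev-proj
  dropC⇓ (u ∷ us) vs = ev-prec-s (dropC⇓ us (u ∷ vs)) (app₁ ev-proj (rightC⇓ (encTile u) (stream vs)))

  listC : Code 4
  listC = prec (proj (suc (suc zero)))
    (comp succF (comp pairC (
      comp (tileC 7) (comp leftC (comp dropC (proj zero ∷ proj (suc (suc zero)) ∷ []) ∷ []) ∷ proj (suc (suc (suc zero))) ∷ []) ∷
      proj (suc zero) ∷ []) ∷ []))

  listC⇓ : ∀ us vs i S → listC ⟦ length us ∷ stream (us ʳ++ vs) ∷ i ∷ encTiles S ∷ [] ⟧⇓ encTiles (inst i us L.++ S)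
  listC⇓ [] vs i S = ev-prec-z ev-proj
  listC⇓ (u ∷ us) vs i S = ev-prec-s (listC⇓ us (u ∷ vs) i S)
    (app₁ (app₂ (app₂ (app₁ (app₂ ev-proj ev-proj (dropC⇓ us (u ∷ vs))) (leftC⇓ (encTile u) (stream vs))) ev-proj (tileC⇓ u i))
      ev-proj (pairC⇓ _ _)) ev-succ)

  patternC : Code 3
  patternC = comp listC (comp leftC (proj zero ∷ []) ∷ comp rightC (proj zero ∷ []) ∷ proj (suc zero) ∷ proj (suc (suc zero)) ∷ [])

  patternC⇓ : ∀ ps i S → patternC ⟦ encPattern ps ∷ i ∷ encTiles S ∷ [] ⟧⇓ encTiles (inst i ps L.++ S)
  patternC⇓ ps i S = ev-comp
    (ev-∷ (app₁ ev-proj (leftC⇓ (length ps) (stream (ps ʳ++ []))))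
      (ev-∷ (app₁ ev-proj (rightC⇓ (length ps) (stream (ps ʳ++ [])))) (ev-∷ ev-proj (ev-∷ ev-proj ev-[]))))
    (listC⇓ ps [] i S)

  blocksC : Code 2
  blocksC = prec zeroF (comp patternC (proj (suc (suc zero)) ∷ proj zero ∷ proj (suc zero) ∷ []))

  blocksC⇓ : ∀ ps n → blocksC ⟦ n ∷ encPattern ps ∷ [] ⟧⇓ encTiles (blocks ps n)
  blocksC⇓ ps zero = ev-prec-z ev-zero
  blocksC⇓ ps (suc n) = ev-prec-s (blocksC⇓ ps n)
    (ev-comp (ev-∷ ev-proj (ev-∷ ev-proj (ev-∷ ev-proj ev-[]))) (patternC⇓ ps n (blocks ps n)))

  familyC : Code 2
  familyC = comp patternC (comp leftC (proj zero ∷ []) ∷ proj (suc zero) ∷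
    comp blocksC (proj (suc zero) ∷ comp rightC (proj zero ∷ []) ∷ []) ∷ [])

  familyC⇓ : ∀ base ps n → familyC ⟦ encFamily base ps ∷ n ∷ [] ⟧⇓ encTiles (family base ps n)
  familyC⇓ base ps n = ev-comp
    (ev-∷ (app₁ ev-proj (leftC⇓ (encPattern base) (encPattern ps))) (ev-∷ ev-proj (ev-∷
      (app₂ ev-proj (app₁ ev-proj (rightC⇓ (encPattern base) (encPattern ps))) (blocksC⇓ ps n)) ev-[])))
    (patternC⇓ base n (blocks ps n))

-- Structured register programs for partial recursive functions.

module CounterMachines where
  open import Defs hiding (a; c)
  open import Data.Nat
  open import Data.Nat.Properties
  open import Data.Fin using (Fin; zero; suc; _↑ˡ_; _↑ʳ_)
  open import Data.Vec using (Vec; []; _∷_; lookup; _[_]≔_; tabulate; replicate; _++_)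
  import Data.Vec as V
  open import Data.Vec.Properties
  open import Data.List using (List; []; _∷_; length)
  import Data.List as L
  open import Data.List.Membership.Propositional using (_∈_)
  open import Data.List.Membership.Propositional.Properties using (∈-++⁺ˡ; ∈-++⁺ʳ; ∈-lookup)
  open import Data.List.Relation.Unary.Any using (here; there; index)
  open import Data.List.Relation.Unary.Any.Properties using (lookup-index)
  open import Data.List.Relation.Unary.All using (All; []; _∷_)
  import Data.List.Relation.Unary.All as All
  import Data.List.Relation.Unary.All.Properties as All
  open import Data.List.Relation.Unary.AllPairs using (AllPairs; []; _∷_)
  import Data.List.Relation.Unary.AllPairs.Properties as AllPairs
  open import Data.Product
  open import Data.Sum using (_⊎_; inj₁; inj₂)
  open import Relation.Binary.PropositionalEquality

  infixr 5 _⨾_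
  data Stmt : ℕ → Set where
    inc clear : ∀ {m} → Fin m → Stmt m
    _⨾_   : ∀ {m} → Stmt m → Stmt m → Stmt m
    loop  : ∀ {m} → Fin m → Stmt m → Stmt m
    local : ∀ {m} → Stmt (suc m) → Stmt m

  -- A `local` register has to be zero again on exit: `flat` gives the same spare register to locals
  -- used one after the other, and each relies on finding zero in it.
  data Exec : ∀ {m} → Stmt m → Vec ℕ m → Vec ℕ m → Set where
    e-inc   : ∀ {m} {r : Fin m} {v} → Exec (inc r) v (v [ r ]≔ suc (lookup v r))
    e-clear : ∀ {m} {r : Fin m} {v} → Exec (clear r) v (v [ r ]≔ 0)
    e-seq   : ∀ {m} {s t : Stmt m} {u v w} → Exec s u v → Exec t v w → Exec (s ⨾ t) u w
    e-done  : ∀ {m} {r : Fin m} {s v} → lookup v r ≡ 0 → Exec (loop r s) v v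
    e-loop  : ∀ {m} {r : Fin m} {s v v′ v″ k} → lookup v r ≡ suc k →
              Exec s (v [ r ]≔ k) v′ → Exec (loop r s) v′ v″ → Exec (loop r s) v v″
    e-local : ∀ {m} {s : Stmt (suc m)} {v v′} → Exec s (0 ∷ v) (0 ∷ v′) → Exec (local s) v v′

  suc³ : ∀ {m} → Fin m → Fin (3 + m)
  suc³ i = suc (suc (suc i))

  suc⁴ : ∀ {m} → Fin m → Fin (4 + m)
  suc⁴ i = suc (suc³ i)

  past : ∀ {m} l → Fin m → Fin (suc l + m)
  past l i = suc (l ↑ʳ i)

  move : ∀ {m} → Fin m → Stmt (suc m)
  move r = loop zero (inc (suc r))

  move-exec : ∀ {m} (r : Fin m) k v → Exec (move r) (k ∷ v) (0 ∷ v [ r ]≔ (k + lookup v r))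
  move-exec r zero v = subst (λ w → Exec (move r) (0 ∷ v) (0 ∷ w)) (sym ([]≔-lookup v r)) (e-done refl)
  move-exec r (suc k) v =
    e-loop refl e-inc
      (subst (λ w → Exec (move r) (k ∷ v [ r ]≔ suc (lookup v r)) (0 ∷ w)) eq
             (move-exec r k (v [ r ]≔ suc (lookup v r))))
    where
    eq : (v [ r ]≔ suc (lookup v r)) [ r ]≔ (k + lookup (v [ r ]≔ suc (lookup v r)) r) ≡ v [ r ]≔ (suc k + lookup v r)
    eq = trans ([]≔-idempotent v r)
               (cong (v [ r ]≔_) (trans (cong (k +_) (lookup∘update r v _)) (+-suc k (lookup v r))))

  move₀ : ∀ {m} (r : Fin m) {k v} → lookup v r ≡ 0 → Exec (move r) (k ∷ v) (0 ∷ v [ r ]≔ k)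
  move₀ r {k} {v} eq = subst (λ x → Exec (move r) (k ∷ v) (0 ∷ v [ r ]≔ x))
                             (trans (cong (k +_) eq) (+-identityʳ k)) (move-exec r k v)

  copy : ∀ {m} → Fin m → Stmt (suc m)
  copy x = local (loop (suc (suc x)) (inc zero ⨾ inc (suc zero)) ⨾ loop zero (inc (suc (suc x))))

  drain : ∀ {m} (x : Fin m) k v t a → lookup v x ≡ k →
          Exec (loop (suc (suc x)) (inc zero ⨾ inc (suc zero))) (t ∷ a ∷ v) (k + t ∷ k + a ∷ v [ x ]≔ 0)
  drain x zero v t a eq = subst (λ w → Exec (loop (suc (suc x)) (inc zero ⨾ inc (suc zero))) (t ∷ a ∷ v) (t ∷ a ∷ w))
                                (trans (sym ([]≔-lookup v x)) (cong (v [ x ]≔_) eq)) (e-done eq)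
  drain x (suc k) v t a eq =
    e-loop eq (e-seq e-inc e-inc)
      (subst₂ (λ p q → Exec (loop (suc (suc x)) (inc zero ⨾ inc (suc zero))) (suc t ∷ suc a ∷ v [ x ]≔ k) (p ∷ q)) (+-suc k t)
              (cong₂ _∷_ (+-suc k a) ([]≔-idempotent v x))
              (drain x k (v [ x ]≔ k) (suc t) (suc a) (lookup∘update x v k)))

  copy-exec : ∀ {m} (x : Fin m) v → Exec (copy x) (0 ∷ v) (lookup v x ∷ v)
  copy-exec x v = e-local (e-seq (drain x (lookup v x) v 0 0 refl)
    (subst₂ (λ a w → Exec (move (suc x)) (lookup v x + 0 ∷ lookup v x + 0 ∷ v [ x ]≔ 0) (0 ∷ a ∷ w))
       (+-identityʳ _)
       (trans ([]≔-idempotent v x) (trans (cong (v [ x ]≔_) (+-identityʳ _)) ([]≔-lookup v x)))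
       (move₀ (suc x) (lookup∘update x v 0))))

  mutual
    -- The code finds `out` zero and changes no other register. The inputs have to survive because
    -- `prec` and `mu` evaluate again and again on the same parameters.
    compile : ∀ {n m} → Code n → Vec (Fin m) n → Fin m → Stmt m
    compile zeroF ins out = clear out
    compile succF (x ∷ []) out = local (copy x ⨾ inc zero ⨾ move out)
    compile (proj i) ins out = local (copy (lookup ins i) ⨾ move out)
    compile {m = m} (comp {l} f gs) ins out = args gs ins (compile f (tabulate (_↑ˡ m)) (l ↑ʳ out))
    compile (prec f g) (k ∷ xs) out =
      local (copy k ⨾ local (local
        ( compile f (V.map suc³ xs) zero
        ⨾ loop (suc (suc zero)) (iterate g xs)
        ⨾ move (suc (suc out))
        ⨾ clear (suc zero))))
    compile (mu f) xs out =
      local (local (inc zero ⨾ loop zero (search f xs) ⨾ loop (suc zero) (inc (suc (suc out)))))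

    iterate : ∀ {n m} → Code (2 + n) → Vec (Fin m) n → Stmt (3 + m)
    iterate g xs =
      local (compile g (suc (suc zero) ∷ suc zero ∷ V.map suc⁴ xs) zero
             ⨾ clear (suc zero) ⨾ move zero)
      ⨾ inc (suc zero)

    -- Register 0 outside the local is a flag driving the loop: entering a round clears it, and a
    -- nonzero value of `f` sets it again and moves on to the next candidate. The loop thus ends at
    -- the first zero, with the candidate kept.
    search : ∀ {n m} → Code (1 + n) → Vec (Fin m) n → Stmt (2 + m)
    search f xs =
      local (compile f (suc (suc zero) ∷ V.map suc³ xs) zero
             ⨾ loop zero (clear zero ⨾ inc (suc (suc zero)) ⨾ inc (suc zero)))

    -- The last argument is evaluated first, into the outermost local, so that `s` finds the values
    -- in their order in front of the old registers, as `ys ++ v`.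
    args : ∀ {n m l} → Vec (Code n) l → Vec (Fin m) n → Stmt (l + m) → Stmt m
    args [] ins s = s
    args {l = suc l} (g ∷ gs) ins s =
      args gs ins (local (compile g (V.map (past l) ins) zero ⨾ s ⨾ clear zero))

  map-cong-lookup : ∀ {m m′ n} (f : Fin m → Fin m′) (v : Vec ℕ m) (v′ : Vec ℕ m′) →
                    (∀ i → lookup v′ (f i) ≡ lookup v i) → (ins : Vec (Fin m) n) {xs : Vec ℕ n} →
                    V.map (lookup v) ins ≡ xs → V.map (lookup v′) (V.map f ins) ≡ xs
  map-cong-lookup f v v′ eq ins refl = trans (sym (map-∘ (lookup v′) f ins)) (map-cong eq ins)

  mutual
    compile-exec : ∀ {n m} {c : Code n} {xs y} → c ⟦ xs ⟧⇓ y → (ins : Vec (Fin m) n) (out : Fin m) (v : Vec ℕ m) →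
                   V.map (lookup v) ins ≡ xs → lookup v out ≡ 0 → Exec (compile c ins out) v (v [ out ]≔ y)
    compile-exec ev-zero ins out v _ _ = e-clear
    compile-exec ev-succ (x ∷ []) out v refl o =
      e-local (e-seq (copy-exec x v) (e-seq e-inc (move₀ out o)))
    compile-exec (ev-proj {i = i}) ins out v refl o =
      subst (λ y → Exec (compile (proj i) ins out) v (v [ out ]≔ y)) (sym (lookup-map i (lookup v) ins))
            (e-local (e-seq (copy-exec (lookup ins i) v) (move₀ out o)))
    compile-exec {m = m} (ev-comp {m = l} {f = f} {gs = gs} {ys = ys} {y = y} gs⇓ f⇓) ins out v eq o =
      args-exec gs⇓ ins v eq
        (subst (Exec _ (ys ++ v)) ([]≔-++-↑ʳ ys v out)
               (compile-exec f⇓ (tabulate (_↑ˡ m)) (l ↑ʳ out) (ys ++ v) front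
                             (trans (lookup-++ʳ ys v out) o)))
      where
      front : V.map (lookup (ys ++ v)) (tabulate (_↑ˡ m)) ≡ ys
      front = trans (sym (tabulate-∘ (lookup (ys ++ v)) (_↑ˡ m)))
                    (trans (tabulate-cong (lookup-++ˡ ys v)) (tabulate∘lookup ys))
    compile-exec {c = prec f g} {y = y} p (k ∷ xs) out v eq o =
      e-local (e-seq (copy-exec k v) (e-local (e-local (prec-exec (subst (prec f g ⟦_⟧⇓ y) (sym eq) p) refl))))
      where
      prec-exec : ∀ {n′ y} → prec f g ⟦ n′ ∷ V.map (lookup v) xs ⟧⇓ y → n′ ≡ lookup v k →
                  Exec (compile f (V.map suc³ xs) zero ⨾ loop (suc (suc zero)) (iterate g xs)
                        ⨾ move (suc (suc out)) ⨾ clear (suc zero))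
                       (0 ∷ 0 ∷ lookup v k ∷ v) (0 ∷ 0 ∷ 0 ∷ v [ out ]≔ y)
      prec-exec {n′} p eq with rounds p xs v refl 0 (e-done refl)
      ... | r₀ , f⇓ , run =
        e-seq (compile-exec f⇓ (V.map suc³ xs) zero (0 ∷ 0 ∷ lookup v k ∷ v)
                 (map-cong-lookup suc³ v (0 ∷ 0 ∷ lookup v k ∷ v) (λ _ → refl) xs refl) refl)
          (e-seq (subst (λ z → Exec (loop (suc (suc zero)) (iterate g xs)) (r₀ ∷ 0 ∷ z ∷ v) (_ ∷ n′ ∷ 0 ∷ v))
                        (trans (+-identityʳ _) eq) run)
            (e-seq (move₀ (suc (suc out)) {v = n′ ∷ 0 ∷ v} o) e-clear))
    compile-exec {c = mu f} (ev-mu {k = k} f⇓ pos) xs out v refl o =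
      e-local (e-local (e-seq e-inc
        (e-seq (subst (λ i → Exec (loop zero (search f xs)) (1 ∷ i ∷ v) (0 ∷ k ∷ v)) (n∸n≡0 k)
                      (tries xs v refl pos f⇓ k ≤-refl))
               (finish k v o))))
      where
      finish : ∀ k v → lookup v out ≡ 0 → Exec (loop (suc zero) (inc (suc (suc out)))) (0 ∷ k ∷ v) (0 ∷ 0 ∷ v [ out ]≔ k)
      finish k v o = subst (λ x → Exec (loop (suc zero) (inc (suc (suc out)))) (0 ∷ k ∷ v) (0 ∷ 0 ∷ v [ out ]≔ x))
                           (trans (cong (k +_) o) (+-identityʳ k)) (go k v)
        where
        go : ∀ k v → Exec (loop (suc zero) (inc (suc (suc out)))) (0 ∷ k ∷ v) (0 ∷ 0 ∷ v [ out ]≔ (k + lookup v out))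
        go zero v = subst (λ w → Exec (loop (suc zero) (inc (suc (suc out)))) (0 ∷ 0 ∷ v) (0 ∷ 0 ∷ w)) (sym ([]≔-lookup v out)) (e-done refl)
        go (suc k) v = e-loop refl e-inc
          (subst (λ w → Exec (loop (suc zero) (inc (suc (suc out)))) (0 ∷ k ∷ v [ out ]≔ suc (lookup v out)) (0 ∷ 0 ∷ w))
            (trans ([]≔-idempotent v out)
               (cong (v [ out ]≔_) (trans (cong (k +_) (lookup∘update out v _)) (+-suc k (lookup v out)))))
            (go k (v [ out ]≔ suc (lookup v out))))

    -- The loop is unrolled from its far end: a run started after k rounds extends to one started at round 0.
    rounds : ∀ {n m} {f : Code n} {g : Code (2 + n)} {k xs r} → prec f g ⟦ k ∷ xs ⟧⇓ r →
             (ins : Vec (Fin m) n) (v : Vec ℕ m) → V.map (lookup v) ins ≡ xs → ∀ d {w} →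
             Exec (loop (suc (suc zero)) (iterate g ins)) (r ∷ k ∷ d ∷ v) w →
             ∃[ r₀ ] (f ⟦ xs ⟧⇓ r₀ × Exec (loop (suc (suc zero)) (iterate g ins)) (r₀ ∷ 0 ∷ (k + d) ∷ v) w)
    rounds (ev-prec-z p) ins v eq d run = _ , p , run
    rounds {g = g} (ev-prec-s {k = k} {r = r} {y = y} p q) ins v eq d {w} run
      with rounds p ins v eq (suc d) (e-loop refl
             (e-seq (e-local (e-seq (compile-exec q (suc (suc zero) ∷ suc zero ∷ V.map suc⁴ ins) zero
                                       (0 ∷ r ∷ k ∷ d ∷ v)
                                       (cong (λ z → k ∷ r ∷ z) (map-cong-lookup suc⁴ v (0 ∷ r ∷ k ∷ d ∷ v) (λ _ → refl) ins eq))
                                       refl)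
                               (e-seq e-clear (move₀ zero {v = 0 ∷ k ∷ d ∷ v} refl))))
                    e-inc) run)
    ... | r₀ , f⇓ , run′ = r₀ , f⇓ , subst (λ z → Exec (loop (suc (suc zero)) (iterate g ins)) (r₀ ∷ 0 ∷ z ∷ v) w) (+-suc k d) run′

    -- Induction on the number `d` of failures still to come, so that the candidate is `k ∸ d` and
    -- the base case is the successful one.
    tries : ∀ {n m} {f : Code (1 + n)} {k xs} (ins : Vec (Fin m) n) (v : Vec ℕ m) → V.map (lookup v) ins ≡ xs →
            (∀ j → j < k → Σ ℕ (λ z → f ⟦ j ∷ xs ⟧⇓ suc z)) → f ⟦ k ∷ xs ⟧⇓ 0 →
            ∀ d → d ≤ k → Exec (loop zero (search f ins)) (1 ∷ k ∸ d ∷ v) (0 ∷ k ∷ v)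
    tries {k = k} ins v eq pos f⇓ zero _ = e-loop refl
      (e-local (e-seq (compile-exec f⇓ (suc (suc zero) ∷ V.map suc³ ins) zero (0 ∷ 0 ∷ k ∷ v)
                         (cong (k ∷_) (map-cong-lookup suc³ v (0 ∷ 0 ∷ k ∷ v) (λ _ → refl) ins eq)) refl)
                      (e-done refl)))
      (e-done refl)
    tries {f = f} {k = k} ins v eq pos f⇓ (suc d) d<k with pos (k ∸ suc d) (∸-monoʳ-< z<s d<k)
    ... | z , g⇓ = e-loop refl
      (e-local (e-seq (compile-exec g⇓ (suc (suc zero) ∷ V.map suc³ ins) zero (0 ∷ 0 ∷ k ∸ suc d ∷ v)
                         (cong ((k ∸ suc d) ∷_) (map-cong-lookup suc³ v (0 ∷ 0 ∷ k ∸ suc d ∷ v) (λ _ → refl) ins eq)) refl)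
                      (e-loop refl (e-seq e-clear (e-seq e-inc e-inc)) (e-done refl))))
      (subst (λ i → Exec (loop zero (search f ins)) (1 ∷ i ∷ v) (0 ∷ k ∷ v)) (+-∸-assoc 1 d<k)
             (tries ins v eq pos f⇓ d (<⇒≤ d<k)))

    args-exec : ∀ {n m l} {gs : Vec (Code n) l} {xs ys} → gs ⟦ xs ⟧⇓* ys → (ins : Vec (Fin m) n) (v : Vec ℕ m) {v′ : Vec ℕ m} →
                V.map (lookup v) ins ≡ xs → ∀ {s} → Exec s (ys ++ v) (ys ++ v′) → Exec (args gs ins s) v v′
    args-exec ev-[] ins v eq run = run
    args-exec {l = suc l} (ev-∷ {ys = ys} g⇓ gs⇓) ins v eq run =
      args-exec gs⇓ ins v eq
        (e-local (e-seq (compile-exec g⇓ (V.map (past l) ins) zero (0 ∷ ys ++ v)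
                           (map-cong-lookup (past l) v (0 ∷ ys ++ v) (lookup-++ʳ ys v) ins eq) refl)
                        (e-seq run e-clear)))

  -- Counter machines given by edges, and programs flattened into them.

  data Kind : Set where
    inc dec zero : Kind

  record Edge (K : ℕ) : Set where
    constructor edge
    field
      src  : ℕ
      kind : Kind
      reg  : Fin K
      tgt  : ℕ
  open Edge public

  data MStep {K} : Edge K → ℕ → Vec ℕ K → ℕ → Vec ℕ K → Set where
    m-inc  : ∀ {p r q v} → MStep (edge p inc r q) p v q (v [ r ]≔ suc (lookup v r))
    m-dec  : ∀ {p r q v k} → lookup v r ≡ suc k → MStep (edge p dec r q) p v q (v [ r ]≔ k)
    m-zero : ∀ {p r q v} → lookup v r ≡ 0 → MStep (edge p zero r q) p v q v

  module _ {K} (es : List (Edge K)) where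
    data Trace (v₀ : Vec ℕ K) : ℕ → List (Fin (length es)) → ℕ → Vec ℕ K → Set where
      start : Trace v₀ 0 [] 0 v₀
      more  : ∀ {i h p v q w} → Trace v₀ i h p v → (x : Fin (length es)) → MStep (L.lookup es x) p v q w →
              Trace v₀ (suc i) (x ∷ h) q w

    Reaches : Vec ℕ K → ℕ → Vec ℕ K → Set
    Reaches v₀ p v = ∃₂ λ i h → Trace v₀ i h p v

    step-reaches : ∀ {v₀ e p v q w} → e ∈ es → MStep e p v q w → Reaches v₀ p v → Reaches v₀ q w
    step-reaches {p = p} {v} {q} {w} e∈ st (i , h , t) =
      suc i , index e∈ ∷ h , more t (index e∈) (subst (λ e → MStep e p v q w) (lookup-index e∈) st)

  -- Determinism is demanded syntactically: edges with a common source are the decrement and the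
  -- zero test of one register, the decrement listed first. In the stack machine they become rules
  -- reading different symbols from one stack, which makes sense for arbitrary stack contents.
  Exclusive : ∀ {K} → Edge K → Edge K → Set
  Exclusive e e′ = src e ≢ src e′ ⊎ (reg e ≡ reg e′ × kind e ≡ dec × kind e′ ≡ zero)

  Det : ∀ {K} → List (Edge K) → Set
  Det = AllPairs Exclusive

  depth : ∀ {m} → Stmt m → ℕ
  depth (inc r) = 0
  depth (clear r) = 0
  depth (s ⨾ t) = depth s ⊔ depth t
  depth (loop r s) = depth s
  depth (local s) = suc (depth s)

  size : ∀ {m} → Stmt m → ℕ
  size (inc r) = 1
  size (clear r) = 1
  size (s ⨾ t) = size s + size t
  size (loop r s) = suc (size s)
  size (local s) = size s

  infixl 6 _+ʳ_
  -- Addition in accumulator form: `suc j +ʳ m` and `j +ʳ suc m` agree by definition, so entering a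
  -- local turns a spare register into a used one without any transport of types.
  _+ʳ_ : ℕ → ℕ → ℕ
  zero +ʳ m = m
  suc j +ʳ m = j +ʳ suc m

  raise : ∀ j {m} → Fin m → Fin (j +ʳ m)
  raise zero i = i
  raise (suc j) i = raise j (suc i)

  pad : ∀ j {m} → Vec ℕ m → Vec ℕ (j +ʳ m)
  pad zero v = v
  pad (suc j) v = pad j (0 ∷ v)

  lookup-pad : ∀ j {m} (v : Vec ℕ m) i → lookup (pad j v) (raise j i) ≡ lookup v i
  lookup-pad zero v i = refl
  lookup-pad (suc j) v i = lookup-pad j (0 ∷ v) (suc i)

  update-pad : ∀ j {m} (v : Vec ℕ m) i x → pad j v [ raise j i ]≔ x ≡ pad j (v [ i ]≔ x)
  update-pad zero v i x = refl
  update-pad (suc j) v i x = update-pad j (0 ∷ v) (suc i) x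

  pad-zeros : ∀ j m → pad j (replicate m 0) ≡ replicate (j +ʳ m) 0
  pad-zeros zero m = refl
  pad-zeros (suc j) m = pad-zeros j (suc m)

  -- The last argument but one is the entry address and the last one the exit address; locals become
  -- the j spare registers in front (a statement with more locals than that gets no code).
  flat : ∀ {m} → Stmt m → (j a e : ℕ) → List (Edge (j +ʳ m))
  flat (inc r) j a e = edge a inc (raise j r) e ∷ []
  flat (clear r) j a e = edge a dec (raise j r) a ∷ edge a zero (raise j r) e ∷ []
  flat (s ⨾ t) j a e = flat s j a (a + size s) L.++ flat t j (a + size s) e
  flat (loop r s) j a e = edge a dec (raise j r) (suc a) ∷ edge a zero (raise j r) e ∷ flat s j (suc a) a
  flat (local s) zero a e = []
  flat (local s) (suc j) a e = flat s j a e

  module _ {m} {r : Fin m} {v : Vec ℕ m} (j : ℕ) where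
    pad-inc : ∀ {p q} → MStep (edge p inc (raise j r) q) p (pad j v) q (pad j (v [ r ]≔ suc (lookup v r)))
    pad-inc {p} {q} = subst (MStep (edge p inc (raise j r) q) p (pad j v) q)
      (trans (cong (λ x → pad j v [ raise j r ]≔ suc x) (lookup-pad j v r)) (update-pad j v r _)) m-inc

    pad-dec : ∀ {p q k} → lookup v r ≡ suc k → MStep (edge p dec (raise j r) q) p (pad j v) q (pad j (v [ r ]≔ k))
    pad-dec {p} {q} {k} eq = subst (MStep (edge p dec (raise j r) q) p (pad j v) q)
      (update-pad j v r k) (m-dec (trans (lookup-pad j v r) eq))

    pad-zero : ∀ {p q} → lookup v r ≡ 0 → MStep (edge p zero (raise j r) q) p (pad j v) q (pad j v)
    pad-zero eq = m-zero (trans (lookup-pad j v r) eq)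

  flat-reaches : ∀ {m} {s : Stmt m} {v v′} → Exec s v v′ → ∀ j {a e} (es : List (Edge (j +ʳ m))) {v₀} → depth s ≤ j →
                 (∀ {x} → x ∈ flat s j a e → x ∈ es) → Reaches es v₀ a (pad j v) → Reaches es v₀ e (pad j v′)
  flat-reaches e-inc j es _ ⊆es r = step-reaches es (⊆es (here refl)) (pad-inc j) r
  flat-reaches {s = clear r} {v = v} e-clear j {a} {e} es {v₀} _ ⊆es = go v refl
    where
    go : ∀ u {k} → lookup u r ≡ k → Reaches es v₀ a (pad j u) → Reaches es v₀ e (pad j (u [ r ]≔ 0))
    go u {zero} eq t = subst (λ w → Reaches es v₀ e (pad j w)) (trans (sym ([]≔-lookup u r)) (cong (u [ r ]≔_) eq))
                             (step-reaches es (⊆es (there (here refl))) (pad-zero j eq) t)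
    go u {suc k} eq t = subst (λ w → Reaches es v₀ e (pad j w)) ([]≔-idempotent u r)
                              (go (u [ r ]≔ k) (lookup∘update r u k) (step-reaches es (⊆es (here refl)) (pad-dec j eq) t))
  flat-reaches (e-seq {s = s} {t} x y) j es d ⊆es r =
    flat-reaches y j es (m⊔n≤o⇒n≤o (depth s) (depth t) d) (λ p → ⊆es (∈-++⁺ʳ _ p))
      (flat-reaches x j es (m⊔n≤o⇒m≤o (depth s) (depth t) d) (λ p → ⊆es (∈-++⁺ˡ p)) r)
  flat-reaches (e-done eq) j es d ⊆es r = step-reaches es (⊆es (there (here refl))) (pad-zero j eq) r
  flat-reaches (e-loop eq x y) j es d ⊆es r =
    flat-reaches y j es d ⊆es (flat-reaches x j es d (λ p → ⊆es (there (there p)))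
      (step-reaches es (⊆es (here refl)) (pad-dec j eq) r))
  flat-reaches (e-local x) (suc j) es (s≤s d) ⊆es r = flat-reaches x j es d ⊆es r

  Within : ∀ {K} → ℕ → ℕ → Edge K → Set
  Within a b e = a ≤ src e × src e < b

  flat-within : ∀ {m} (s : Stmt m) j a e → All (Within a (a + size s)) (flat s j a e)
  flat-within (inc r) j a e = (≤-refl , m<m+n a z<s) ∷ []
  flat-within (clear r) j a e = (≤-refl , m<m+n a z<s) ∷ (≤-refl , m<m+n a z<s) ∷ []
  flat-within (s ⨾ t) j a e = All.++⁺
    (All.map (λ (l , u) → l , <-≤-trans u (+-monoʳ-≤ a (m≤m+n (size s) (size t)))) (flat-within s j a (a + size s)))
    (All.map (λ (l , u) → ≤-trans (m≤m+n a (size s)) l , <-≤-trans u (≤-reflexive (+-assoc a (size s) (size t))))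
             (flat-within t j (a + size s) e))
  flat-within (loop r s) j a e =
    (≤-refl , m<m+n a z<s) ∷ (≤-refl , m<m+n a z<s) ∷
    All.map (λ (l , u) → ≤-trans (n≤1+n a) l , <-≤-trans u (≤-reflexive (sym (+-suc a (size s))))) (flat-within s j (suc a) a)
  flat-within (local s) zero a e = []
  flat-within (local s) (suc j) a e = flat-within s j a e

  below : ∀ {K a b} {e : Edge K} {es} → src e < a → All (Within a b) es → All (Exclusive e) es
  below {a = a} {b} {e} lt = All.map {P = Within a b} {Q = Exclusive e} (λ (l , _) → inj₁ (<⇒≢ (<-≤-trans lt l)))

  flat-det : ∀ {m} (s : Stmt m) j a e → Det (flat s j a e)
  flat-det (inc r) j a e = [] ∷ []
  flat-det (clear r) j a e = (inj₂ (refl , refl , refl) ∷ []) ∷ [] ∷ []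
  flat-det (s ⨾ t) j a e = AllPairs.++⁺ (flat-det s j a (a + size s)) (flat-det t j (a + size s) e)
    (All.map (λ {x} (_ , u) → below {e = x} u (flat-within t j (a + size s) e)) (flat-within s j a (a + size s)))
  flat-det (loop r s) j a e =
    (inj₂ (refl , refl , refl) ∷ below {e = edge a dec (raise j r) (suc a)} (n<1+n a) (flat-within s j (suc a) a)) ∷
    below {e = edge a zero (raise j r) e} (n<1+n a) (flat-within s j (suc a) a) ∷
    flat-det s j (suc a) a
  flat-det (local s) zero a e = [] 
  flat-det (local s) (suc j) a e = flat-det s j a e

  -- Answer 1 makes the machine halt and answer 0 makes it run forever. Infinite runs will become
  -- tilings, so this inverts the verdict, as the diagonal argument requires.
  record Decider (q : Code 1) : Set where
    field
      K    : ℕ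
      es   : List (Edge K)
      inp  : Fin K
      det  : Det es
    v₀ : ℕ → Vec ℕ K
    v₀ n = replicate K 0 [ inp ]≔ n
    field
      halts : ∀ n → q ⟦ n ∷ [] ⟧⇓ 1 → ∃₂ λ p v → Reaches es (v₀ n) p v × (∀ x → src (L.lookup es x) ≢ p)
      loops : ∀ n → q ⟦ n ∷ [] ⟧⇓ 0 → ∀ i → ∃ λ h → ∃₂ λ p v → Trace es (v₀ n) i h p v

  trace-prefix : ∀ {K es v₀ i j h p v} → i ≤ j → Trace {K} es v₀ j h p v → ∃ λ h → ∃₂ λ p v → Trace es v₀ i h p v
  trace-prefix {i = i} {j} i≤j t with m≤n⇒m<n∨m≡n i≤j
  trace-prefix i≤j t | inj₂ refl = -, -, -, t
  trace-prefix i≤j (more t x s) | inj₁ (s≤s lt) = trace-prefix lt t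

  decider : (q : Code 1) → Decider q
  decider q = record
    { K = D +ʳ 2 ; es = es ; inp = raise D zero ; det = det
    ; halts = halts ; loops = λ n q⇓ → loop-forever (result n q⇓) }
    where
    s : Stmt 2
    s = compile q (zero ∷ []) (suc zero)
    D = depth s
    A = size s
    out = raise D (suc zero)
    -- At the exit address a nonzero output leads to `suc A`, which no edge leaves, whereas a zero
    -- output passes the zero test back to `A` forever.
    tail = edge A dec out (suc A) ∷ edge A zero out A ∷ []
    es = flat s D 0 A L.++ tail

    start-pad : ∀ n → pad D (n ∷ 0 ∷ []) ≡ replicate (D +ʳ 2) 0 [ raise D zero ]≔ n
    start-pad n = sym (trans (cong (_[ raise D zero ]≔ n) (sym (pad-zeros D 2))) (update-pad D (0 ∷ 0 ∷ []) zero n))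

    det : Det es
    det = AllPairs.++⁺ (flat-det s D 0 A) ((inj₂ (refl , refl , refl) ∷ []) ∷ [] ∷ [])
      (All.map (λ (_ , u) → inj₁ (<⇒≢ u) ∷ inj₁ (<⇒≢ u) ∷ []) (flat-within s D 0 A))

    result : ∀ n {y} → q ⟦ n ∷ [] ⟧⇓ y → Reaches es (replicate (D +ʳ 2) 0 [ raise D zero ]≔ n) A (pad D (n ∷ y ∷ []))
    result n q⇓ = flat-reaches (compile-exec q⇓ (zero ∷ []) (suc zero) (n ∷ 0 ∷ []) refl refl) D es ≤-refl ∈-++⁺ˡ
      (subst (Reaches es _ 0) (sym (start-pad n)) (0 , [] , start))

    bounded : All (λ e → src e ≢ suc A) es
    bounded = All.++⁺ (All.map (λ (_ , u) → <⇒≢ (m<n⇒m<1+n u)) (flat-within s D 0 A)) (<⇒≢ (n<1+n A) ∷ <⇒≢ (n<1+n A) ∷ [])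

    halts : ∀ n → q ⟦ n ∷ [] ⟧⇓ 1 → _
    halts n q⇓ = suc A , _ , step-reaches es (∈-++⁺ʳ (flat s D 0 A) (here refl)) (pad-dec D refl) (result n q⇓)
               , λ x → All.lookup bounded (∈-lookup {xs = es} x)

    loop-forever : ∀ {v₁ n} → Reaches es v₁ A (pad D (n ∷ 0 ∷ [])) → ∀ i → ∃ λ h → ∃₂ λ p v → Trace es v₁ i h p v
    loop-forever {v₁} {n} r i with spin i
      where
      spin : ∀ i → ∃₂ λ j h → i ≤ j × Trace es v₁ j h A (pad D (n ∷ 0 ∷ []))
      spin zero = proj₁ r , proj₁ (proj₂ r) , z≤n , proj₂ (proj₂ r)
      spin (suc i) with spin i
      ... | j , h , i≤j , t = suc j , _ , s≤s i≤j ,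
        proj₂ (proj₂ (step-reaches es (∈-++⁺ʳ (flat s D 0 A) (there (here refl)))
                                   (pad-zero {r = suc zero} {n ∷ 0 ∷ []} D refl) (j , h , t)))
    ... | j , h , i≤j , t = trace-prefix i≤j t

-- Stack machines on partially known stacks, and their infinite runs.

module StackMachines where
  open import Data.Nat using (ℕ; zero; suc)
  open import Data.Fin using (Fin)
  open import Data.List using (List; []; _∷_)
  open import Data.Vec using (Vec; lookup; _[_]≔_)
  open import Data.Product using (Σ; ∃; ∃₂; _×_; _,_; proj₁; proj₂)
  open import Relation.Binary.PropositionalEquality

  data Op (L : ℕ) (Sym : Set) : Set where
    push pop peek : Fin L → Sym → Op L Sym

  layer : ∀ {L Sym} → Op L Sym → Fin L
  layer (push l _) = l
  layer (pop l _) = l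
  layer (peek l _) = l

  -- Only the known top part of a stack is recorded; below it the contents are arbitrary.
  data Act {L Sym} : Op L Sym → List Sym → List Sym → Set where
    push  : ∀ {l a s} → Act (push l a) s (a ∷ s)
    pop   : ∀ {l a s} → Act (pop l a) (a ∷ s) s
    pop∅  : ∀ {l a} → Act (pop l a) [] []
    peek  : ∀ {l a s} → Act (peek l a) (a ∷ s) (a ∷ s)
    peek∅ : ∀ {l a} → Act (peek l a) [] []

  module Run {L : ℕ} {Sym St : Set} (Tr : St → Op L Sym → St → Set) where
    Stacks : Set
    Stacks = Vec (List Sym) L

    Conf : Set
    Conf = St × Stacks

    record Step (c c′ : Conf) : Set where
      constructor step
      field
        {op}  : Op L Sym
        {top} : List Sym
        tr    : Tr (proj₁ c) op (proj₁ c′)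
        act   : Act op (lookup (proj₂ c) (layer op)) top
        upd   : proj₂ c′ ≡ proj₂ c [ layer op ]≔ top

    Inf : Conf → Set
    Inf c = Σ (ℕ → Conf) λ ρ → ρ 0 ≡ c × (∀ n → Step (ρ n) (ρ (suc n)))

    uncons : ∀ {c} → Inf c → ∃ λ c′ → Step c c′ × Inf c′
    uncons (ρ , refl , st) = ρ 1 , st 0 , (λ n → ρ (suc n)) , refl , λ n → st (suc n)

    infixr 5 _∷_
    data Path : Conf → Conf → Set where
      []  : ∀ {c} → Path c c
      _∷_ : ∀ {c c′ c″} → Step c c′ → Path c′ c″ → Path c c″

    Path⁺ : Conf → Conf → Set
    Path⁺ c c″ = ∃ λ c′ → Step c c′ × Path c′ c″

    -- A position remembers the rest of the current link. Links are nonempty, so when this rest is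
    -- exhausted the next step can be taken from the following link.
    glue : (C : ℕ → Conf) → (∀ i → Path⁺ (C i) (C (suc i))) → Inf (C 0)
    glue C link = (λ n → at (state n)) , refl , λ n → go (state n)
      where
      Pos : Set
      Pos = ∃₂ λ i c → Path c (C i)
      at : Pos → Conf
      at (i , c , p) = c
      next : Pos → Pos
      next (i , c , (s ∷ p)) = i , _ , p
      next (i , _ , []) = suc i , _ , proj₂ (proj₂ (link i))
      state : ℕ → Pos
      state zero = 0 , C 0 , []
      state (suc n) = next (state n)
      go : ∀ x → Step (at x) (at (next x))
      go (i , c , (s ∷ p)) = s
      go (i , _ , []) = proj₁ (proj₂ (link i))

    prepend : ∀ {c c′} → Path c c′ → Inf c′ → Inf c
    prepend [] r = r
    prepend {c} (s ∷ p) r with prepend p r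
    ... | ρ , refl , st = ρ′ , refl , st′
      where
      ρ′ : ℕ → Conf
      ρ′ zero = c
      ρ′ (suc n) = ρ n
      st′ : ∀ n → Step (ρ′ n) (ρ′ (suc n))
      st′ zero = s
      st′ (suc n) = st n

-- The machine of nested frames, and correctness of a single frame.

module NestedFrames where
  open import Data.Nat
  open import Data.Nat.Properties
  open import Data.Bool using (Bool; true; false; not; if_then_else_)
  open import Data.Bool.Properties using (not-involutive)
  open import Data.Fin using (Fin; zero; suc; toℕ; fromℕ<)
  open import Data.Fin.Properties using (toℕ-fromℕ<)
  open import Data.List using (List; []; _∷_; length; map; _++_)
  import Data.List as L
  open import Data.List.Relation.Unary.All using ([]; _∷_)
  open import Data.List.Relation.Unary.AllPairs using ([]; _∷_)
  open import Data.Vec using (Vec; []; _∷_; lookup; _[_]≔_; replicate; zipWith)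
  import Data.Vec as V
  open import Data.Vec.Properties using ([]≔-lookup; []≔-idempotent; lookup∘update)
  open import Data.Product using (Σ; ∃; ∃₂; _,_)
  open import Relation.Binary.PropositionalEquality
  open CounterMachines using (inc; dec; zero; Edge; edge; src; tgt; MStep; m-inc; m-dec; m-zero; Trace; start; more; trace-prefix)
  open StackMachines

  data Sym (E : ℕ) : Set where
    o u bot st : Sym E
    mk : Bool → Sym E
    ed : Fin E → Sym E

  -- A frame works in a direction d.  Two stacks hold the cells o ahead of it and behind it.  In loop A it
  -- moves over the cells ahead up to the next marker, in loop B it moves back to its own marker mk x, where x
  -- tells in which loop its caller is.  At each cell it first calls a frame of the opposite direction, working
  -- between the current cell and the marker.  In loop A each cell is accompanied by a step of the counter
  -- machine, recorded on a history stack and undone in loop B.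
  data St (E : ℕ) : Set where
    A B O V CA CB : Bool → St E
    A′ R : Bool → Bool → St E
    I N S : Bool → ℕ → St E
    P U : Bool → Fin E → St E
    Nf Fr : Bool → Bool → ℕ → St E

  module Layout {K} (es : List (Edge K)) where
    E = length es
    Layers = 3 + K

    F : Bool → Fin Layers
    F d = if d then zero else suc zero

    hL : Fin Layers
    hL = suc (suc zero)

    rL : Fin K → Fin Layers
    rL j = suc (suc (suc j))

    the : Fin E → Edge K
    the = L.lookup es

    opOf undoOf : Edge K → Op Layers (Sym E)
    opOf (edge _ inc r _) = push (rL r) u
    opOf (edge _ dec r _) = pop (rL r) u
    opOf (edge _ zero r _) = peek (rL r) bot
    undoOf (edge _ inc r _) = pop (rL r) u
    undoOf (edge _ dec r _) = push (rL r) u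
    undoOf (edge _ zero r _) = peek (rL r) bot

  module Frames {K} (es : List (Edge K)) (inp : Fin K) (n : ℕ) where
    open Layout es public

    -- The marker of a call goes on the caller's stack `F d`, which lies behind the called frame
    -- because that frame works in direction `not d`. Its flag returns in `R`: `false` resumes loop
    -- A with a step of the counter machine, `true` resumes loop B with the undoing of one.
    data Tr : St E → Op Layers (Sym E) → St E → Set where
      a-o      : ∀ {d} → Tr (A d) (pop (F d) o) (CA d)
      a-m      : ∀ {d x} → Tr (A d) (pop (F d) (mk x)) (A′ d x)
      a-back   : ∀ {d x} → Tr (A′ d x) (push (F d) (mk x)) (B d)
      call-a   : ∀ {d} → Tr (CA d) (push (F d) (mk false)) (I (not d) 0)
      call-b   : ∀ {d} → Tr (CB d) (push (F d) (mk true)) (I (not d) 0)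
      init     : ∀ {d i} (j : Fin K) → i ≡ toℕ j → Tr (I d i) (push (rL j) bot) (I d (suc i))
      init-end : ∀ {d i} → i ≡ K → Tr (I d i) (peek (rL inp) bot) (N d 0)
      num      : ∀ {d i} → i < n → Tr (N d i) (push (rL inp) u) (N d (suc i))
      num-end  : ∀ {d i} → i ≡ n → Tr (N d i) (push hL st) (A d)
      r-st     : ∀ {d} → Tr (R d false) (peek hL st) (S d 0)
      r-ed     : ∀ {d} e → Tr (R d false) (peek hL (ed e)) (S d (tgt (the e)))
      s-op     : ∀ {d p} e → p ≡ src (the e) → Tr (S d p) (opOf (the e)) (P d e)
      p-push   : ∀ {d e} → Tr (P d e) (push hL (ed e)) (O d)
      o-push   : ∀ {d} → Tr (O d) (push (F (not d)) o) (A d)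
      r-pop    : ∀ {d} e → Tr (R d true) (pop hL (ed e)) (U d e)
      u-op     : ∀ {d e} → Tr (U d e) (undoOf (the e)) (V d)
      v-push   : ∀ {d} → Tr (V d) (push (F d) o) (B d)
      b-o      : ∀ {d} → Tr (B d) (pop (F (not d)) o) (CB d)
      b-m      : ∀ {d x} → Tr (B d) (pop (F (not d)) (mk x)) (Nf d x 0)
      nf       : ∀ {d x i} → i < n → Tr (Nf d x i) (pop (rL inp) u) (Nf d x (suc i))
      nf-end   : ∀ {d x i} → i ≡ n → Tr (Nf d x i) (peek (rL inp) bot) (Fr d x 0)
      fr       : ∀ {d x i} (j : Fin K) → i ≡ toℕ j → Tr (Fr d x i) (pop (rL j) bot) (Fr d x (suc i))
      fr-end   : ∀ {d x i} → i ≡ K → Tr (Fr d x i) (pop hL st) (R (not d) x)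

    open Run Tr public

    Cells = List (Sym E)
    Regs = Vec Cells K

    stk : Bool → Cells → Cells → Cells → Regs → Stacks
    stk d f g h r = (if d then f else g) ∷ (if d then g else f) ∷ h ∷ r

    stk-not : ∀ d f g h r → stk (not d) g f h r ≡ stk d f g h r
    stk-not true f g h r = refl
    stk-not false f g h r = refl

    lookF : ∀ d {f g h r} → lookup (stk d f g h r) (F d) ≡ f
    lookF true = refl
    lookF false = refl

    lookG : ∀ d {f g h r} → lookup (stk d f g h r) (F (not d)) ≡ g
    lookG true = refl
    lookG false = refl

    updF : ∀ d {f g h r} f′ → stk d f g h r [ F d ]≔ f′ ≡ stk d f′ g h r
    updF true f′ = refl
    updF false f′ = refl

    updG : ∀ d {f g h r} g′ → stk d f g h r [ F (not d) ]≔ g′ ≡ stk d f g′ h r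
    updG true g′ = refl
    updG false g′ = refl

    data Known : ∀ {op s t} → Act {Layers} {Sym E} op s t → Set where
      push : ∀ {l a s} → Known (push {l = l} {a} {s})
      pop  : ∀ {l a s} → Known (pop {l = l} {a} {s})
      peek : ∀ {l a s} → Known (peek {l = l} {a} {s})

    infixr 5 _∷_
    -- Paths that never touch the unknown part of a stack. They serve twice: to build a run, and,
    -- once the machine is seen to be deterministic, to force every infinite run along them.
    data Det-Path : Conf → Conf → Set where
      []  : ∀ {c} → Det-Path c c
      _∷_ : ∀ {c c′ c″} → (Σ (Step c c′) λ s → Known (Step.act s)) → Det-Path c′ c″ → Det-Path c c″

    infixr 5 _∙ᵈ_
    _∙ᵈ_ : ∀ {c c′ c″} → Det-Path c c′ → Det-Path c′ c″ → Det-Path c c″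
    [] ∙ᵈ q = q
    (s ∷ p) ∙ᵈ q = s ∷ (p ∙ᵈ q)

    path : ∀ {c c′} → Det-Path c c′ → Path c c′
    path [] = []
    path ((s , _) ∷ p) = s ∷ path p

    module _ {s s′ : St E} (d : Bool) {f g h : Cells} {r : Regs} where
      pushF : ∀ {a} → Tr s (push (F d) a) s′ → Det-Path (s , stk d f g h r) (s′ , stk d (a ∷ f) g h r)
      pushF {a} tr = (step tr push (sym (trans (cong (λ z → stk d f g h r [ F d ]≔ (a ∷ z)) (lookF d)) (updF d (a ∷ f)))) , push) ∷ []

      pushG : ∀ {a} → Tr s (push (F (not d)) a) s′ → Det-Path (s , stk d f g h r) (s′ , stk d f (a ∷ g) h r)
      pushG {a} tr = (step tr push (sym (trans (cong (λ z → stk d f g h r [ F (not d) ]≔ (a ∷ z)) (lookG d)) (updG d (a ∷ g)))) , push) ∷ []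

      pushH : ∀ {a} → Tr s (push hL a) s′ → Det-Path (s , stk d f g h r) (s′ , stk d f g (a ∷ h) r)
      pushH tr = (step tr push refl , push) ∷ []

      popH : ∀ {a} → Tr s (pop hL a) s′ → Det-Path (s , stk d f g (a ∷ h) r) (s′ , stk d f g h r)
      popH tr = (step tr pop refl , pop) ∷ []

      peekH : ∀ {a} → Tr s (peek hL a) s′ → Det-Path (s , stk d f g (a ∷ h) r) (s′ , stk d f g (a ∷ h) r)
      peekH tr = (step tr peek refl , peek) ∷ []

      pushR : ∀ {a} j → Tr s (push (rL j) a) s′ → Det-Path (s , stk d f g h r) (s′ , stk d f g h (r [ j ]≔ (a ∷ lookup r j)))
      pushR j tr = (step tr push refl , push) ∷ []

      popR : ∀ {a t} j → lookup r j ≡ a ∷ t → Tr s (pop (rL j) a) s′ → Det-Path (s , stk d f g h r) (s′ , stk d f g h (r [ j ]≔ t))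
      popR {a} {t} j eq tr = kstep eq
        where
        kstep : lookup r j ≡ a ∷ t → Det-Path (s , stk d f g h r) (s′ , stk d f g h (r [ j ]≔ t))
        kstep eq with lookup r j in e
        kstep refl | _ = (step tr (subst (λ z → Act (pop (rL j) a) z t) (sym e) pop) refl , known (sym e)) ∷ []
          where
          known : ∀ {z} (q : a ∷ t ≡ z) → Known (subst (λ z → Act (pop {Layers} (rL j) a) z t) q pop)
          known refl = pop

      peekR : ∀ {a t} j → lookup r j ≡ a ∷ t → Tr s (peek (rL j) a) s′ → Det-Path (s , stk d f g h r) (s′ , stk d f g h r)
      peekR {a} {t} j eq tr = kstep eq
        where
        kstep : lookup r j ≡ a ∷ t → Det-Path (s , stk d f g h r) (s′ , stk d f g h r)
        kstep eq with lookup r j in e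
        kstep refl | _ = (step tr (subst (λ z → Act (peek (rL j) a) z (a ∷ t)) (sym e) peek)
                            (cong (stk d f g h) (trans (sym ([]≔-lookup r j)) (cong (r [ j ]≔_) e))) , known (sym e)) ∷ []
          where
          known : ∀ {z} (q : a ∷ t ≡ z) → Known (subst (λ z → Act (peek {Layers} (rL j) a) z (a ∷ t)) q peek)
          known refl = peek

    popF : ∀ d {s s′ f g h r a} → Tr s (pop (F d) a) s′ → Det-Path (s , stk d (a ∷ f) g h r) (s′ , stk d f g h r)
    popF true tr = (step tr pop refl , pop) ∷ []
    popF false tr = (step tr pop refl , pop) ∷ []

    popG : ∀ d {s s′ f g h r a} → Tr s (pop (F (not d)) a) s′ → Det-Path (s , stk d f (a ∷ g) h r) (s′ , stk d f g h r)
    popG true tr = (step tr pop refl , pop) ∷ []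
    popG false tr = (step tr pop refl , pop) ∷ []

    us : ℕ → Cells → Cells
    us zero s = s
    us (suc k) s = u ∷ us k s

    regs : ∀ {k} → Vec ℕ k → Vec Cells k → Vec Cells k
    regs = zipWith (λ k b → us k (bot ∷ b))

    lookup-regs : ∀ {k} (v : Vec ℕ k) r j → lookup (regs v r) j ≡ us (lookup v j) (bot ∷ lookup r j)
    lookup-regs (x ∷ v) (b ∷ r) zero = refl
    lookup-regs (x ∷ v) (b ∷ r) (suc j) = lookup-regs v r j

    update-regs : ∀ {k} (v : Vec ℕ k) r j x → regs v r [ j ]≔ us x (bot ∷ lookup r j) ≡ regs (v [ j ]≔ x) r
    update-regs (_ ∷ v) (b ∷ r) zero x = refl
    update-regs (_ ∷ v) (b ∷ r) (suc j) x = cong (_ ∷_) (update-regs v r j x)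

    hist : List (Fin E) → Cells → Cells
    hist hs h = map ed hs ++ h

    os : ℕ → Cells → Cells
    os zero s = s
    os (suc i) s = o ∷ os i s

    os-o : ∀ i s → os i (o ∷ s) ≡ o ∷ os i s
    os-o zero s = refl
    os-o (suc i) s = cong (o ∷_) (os-o i s)

    module _ {d : Bool} {f g h : Cells} {r : Regs} where
      M-forward : ∀ {p v q w} x → MStep (the x) p v q w →
                  Det-Path (S d p , stk d f g h (regs v r)) (P d x , stk d f g h (regs w r))
      M-forward x ms = go ms refl
        where
        go : ∀ {e p v q w} → MStep e p v q w → the x ≡ e → Det-Path (S d p , stk d f g h (regs v r)) (P d x , stk d f g h (regs w r))
        go {v = v} (m-inc {r = j}) eq = subst (λ z → Det-Path _ (P d x , stk d f g h z))
          (trans (cong (λ z → regs v r [ j ]≔ (u ∷ z)) (lookup-regs v r j)) (update-regs v r j _))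
          (pushR d j (subst (λ e → Tr (S d (src e)) (opOf e) (P d x)) eq (s-op x refl)))
        go {v = v} (m-dec {r = j} {k = k} vj) eq = subst (λ z → Det-Path _ (P d x , stk d f g h z)) (update-regs v r j k)
          (popR d j (trans (lookup-regs v r j) (cong (λ z → us z (bot ∷ lookup r j)) vj))
                    (subst (λ e → Tr (S d (src e)) (opOf e) (P d x)) eq (s-op x refl)))
        go {v = v} (m-zero {r = j} vj) eq =
          peekR d j (trans (lookup-regs v r j) (cong (λ z → us z (bot ∷ lookup r j)) vj))
                    (subst (λ e → Tr (S d (src e)) (opOf e) (P d x)) eq (s-op x refl))

      -- The edge alone determines how to undo it, since a decrement removes one known symbol and a
      -- zero test changes nothing. This is why the history need only record edges.
      M-back : ∀ {p v q w} x → MStep (the x) p v q w →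
               Det-Path (U d x , stk d f g h (regs w r)) (V d , stk d f g h (regs v r))
      M-back x ms = go ms refl
        where
        u-op′ : ∀ {e} → the x ≡ e → Tr (U d x) (undoOf e) (V d)
        u-op′ refl = u-op
        same : ∀ (v : Vec ℕ K) j y {z} → lookup v j ≡ z → (v [ j ]≔ y) [ j ]≔ z ≡ v
        same v j y refl = trans ([]≔-idempotent v j) ([]≔-lookup v j)
        go : ∀ {e p v q w} → MStep e p v q w → the x ≡ e → Det-Path (U d x , stk d f g h (regs w r)) (V d , stk d f g h (regs v r))
        go {v = v} (m-inc {r = j}) eq = subst (λ z → Det-Path (U d x , stk d f g h (regs (v [ j ]≔ suc (lookup v j)) r)) (V d , stk d f g h z))
          (trans (update-regs (v [ j ]≔ suc (lookup v j)) r j (lookup v j)) (cong (λ z → regs z r) (same v j _ refl)))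
          (popR d j (trans (lookup-regs (v [ j ]≔ _) r j) (cong (λ z → us z (bot ∷ lookup r j)) (lookup∘update j v _))) (u-op′ eq))
        go {v = v} (m-dec {r = j} {k = k} vj) eq = subst (λ z → Det-Path (U d x , stk d f g h (regs (v [ j ]≔ k) r)) (V d , stk d f g h z))
          (trans (cong (λ z → regs (v [ j ]≔ k) r [ j ]≔ (u ∷ z))
                       (trans (lookup-regs (v [ j ]≔ k) r j) (cong (λ z → us z (bot ∷ lookup r j)) (lookup∘update j v k))))
                 (trans (update-regs (v [ j ]≔ k) r j (suc k)) (cong (λ z → regs z r) (same v j k vj))))
          (pushR d j (u-op′ eq))
        go {v = v} (m-zero {r = j} vj) eq =
          peekR d j (trans (lookup-regs v r j) (cong (λ z → us z (bot ∷ lookup r j)) vj)) (u-op′ eq)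

    mark unmark : ∀ {k} → ℕ → Vec Cells k → Vec Cells k
    mark zero r = r
    mark (suc i) [] = []
    mark (suc i) (b ∷ r) = (bot ∷ b) ∷ mark i r
    unmark zero r = V.map (bot ∷_) r
    unmark (suc i) [] = []
    unmark (suc i) (b ∷ r) = b ∷ unmark i r

    mark-suc : ∀ {k} (r : Vec Cells k) (j : Fin k) → mark (toℕ j) r [ j ]≔ (bot ∷ lookup (mark (toℕ j) r) j) ≡ mark (suc (toℕ j)) r
    mark-suc (b ∷ r) zero = refl
    mark-suc (b ∷ r) (suc j) = cong (_ ∷_) (mark-suc r j)

    mark-all : ∀ {k} (r : Vec Cells k) → mark k r ≡ regs (replicate k 0) r
    mark-all [] = refl
    mark-all (b ∷ r) = cong (_ ∷_) (mark-all r)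

    unmark-look : ∀ {k} (r : Vec Cells k) (j : Fin k) → lookup (unmark (toℕ j) r) j ≡ bot ∷ lookup r j
    unmark-look (b ∷ r) zero = refl
    unmark-look (b ∷ r) (suc j) = unmark-look r j

    unmark-suc : ∀ {k} (r : Vec Cells k) (j : Fin k) → unmark (toℕ j) r [ j ]≔ lookup r j ≡ unmark (suc (toℕ j)) r
    unmark-suc (b ∷ r) zero = refl
    unmark-suc (b ∷ r) (suc j) = cong (_ ∷_) (unmark-suc r j)

    unmark-all : ∀ {k} (r : Vec Cells k) → unmark k r ≡ r
    unmark-all [] = refl
    unmark-all (b ∷ r) = cong (_ ∷_) (unmark-all r)

    unmark-none : ∀ {k} (r : Vec Cells k) → unmark 0 r ≡ regs (replicate k 0) r
    unmark-none [] = refl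
    unmark-none (b ∷ r) = cong (_ ∷_) (unmark-none r)

    v₀ : Vec ℕ K
    v₀ = replicate K 0 [ inp ]≔ n

    count : ℕ → Vec ℕ K
    count i = replicate K 0 [ inp ]≔ i

    count-look : ∀ i r → lookup (regs (count i) r) inp ≡ us i (bot ∷ lookup r inp)
    count-look i r = trans (lookup-regs (count i) r inp) (cong (λ z → us z (bot ∷ lookup r inp)) (lookup∘update inp (replicate K 0) i))

    count-0 : count 0 ≡ replicate K 0
    count-0 = trans (cong (replicate K 0 [ inp ]≔_) (sym (lookup-replicate inp))) ([]≔-lookup (replicate K 0) inp)
      where
      lookup-replicate : ∀ {k} (j : Fin k) → lookup (replicate k 0) j ≡ 0
      lookup-replicate zero = refl
      lookup-replicate (suc j) = lookup-replicate j

    count-step : ∀ i j r → regs (count i) r [ inp ]≔ us j (bot ∷ lookup r inp) ≡ regs (count j) r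
    count-step i j r = trans (update-regs (count i) r inp j) (cong (λ z → regs z r) ([]≔-idempotent (replicate K 0) inp))

    module _ (d : Bool) (f g h : Cells) (r : Regs) where
      marks : ∀ i → i ≤ K → Det-Path (I d 0 , stk d f g h r) (I d i , stk d f g h (mark i r))
      marks zero _ = []
      marks (suc i) i<K = marks i (<⇒≤ i<K) ∙ᵈ
        subst (λ z → Det-Path (I d z , stk d f g h (mark z r)) (I d (suc z) , stk d f g h (mark (suc z) r))) (toℕ-fromℕ< i<K)
          (subst (λ z → Det-Path (I d (toℕ j) , stk d f g h (mark (toℕ j) r)) (I d (suc (toℕ j)) , stk d f g h z)) (mark-suc r j)
            (pushR d j (init j refl)))
        where j = fromℕ< i<K

      nums : ∀ i → i ≤ n → Det-Path (N d 0 , stk d f g h (regs (count 0) r)) (N d i , stk d f g h (regs (count i) r))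
      nums zero _ = []
      nums (suc i) i<n = nums i (<⇒≤ i<n) ∙ᵈ
        subst (λ z → Det-Path (N d i , stk d f g h (regs (count i) r)) (N d (suc i) , stk d f g h z))
          (trans (cong (λ z → regs (count i) r [ inp ]≔ (u ∷ z)) (count-look i r)) (count-step i (suc i) r))
          (pushR d inp (num i<n))

      init-path : Det-Path (I d 0 , stk d f g h r) (A d , stk d f g (st ∷ h) (regs v₀ r))
      init-path =
        subst (λ z → Det-Path (I d 0 , stk d f g h r) (I d K , stk d f g h z)) (trans (mark-all r) (cong (λ z → regs z r) (sym count-0))) (marks K ≤-refl)
        ∙ᵈ peekR d inp (count-look 0 r) (init-end refl)
        ∙ᵈ nums n ≤-refl ∙ᵈ pushH d (num-end refl)

      unnums : ∀ x i → i ≤ n → Det-Path (Nf d x 0 , stk d f g h (regs v₀ r)) (Nf d x i , stk d f g h (regs (count (n ∸ i)) r))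
      unnums x zero _ = []
      unnums x (suc i) i<n = unnums x i (<⇒≤ i<n) ∙ᵈ
        subst (λ z → Det-Path (Nf d x i , stk d f g h (regs (count (n ∸ i)) r)) (Nf d x (suc i) , stk d f g h z))
          (count-step (n ∸ i) (n ∸ suc i) r)
          (popR d inp (trans (count-look (n ∸ i) r) (cong (λ z → us z (bot ∷ lookup r inp)) (+-∸-assoc 1 i<n))) (nf i<n))

      unmarks : ∀ x i → i ≤ K → Det-Path (Fr d x 0 , stk d f g h (unmark 0 r)) (Fr d x i , stk d f g h (unmark i r))
      unmarks x zero _ = []
      unmarks x (suc i) i<K = unmarks x i (<⇒≤ i<K) ∙ᵈ
        subst (λ z → Det-Path (Fr d x z , stk d f g h (unmark z r)) (Fr d x (suc z) , stk d f g h (unmark (suc z) r))) (toℕ-fromℕ< i<K)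
          (subst (λ z → Det-Path (Fr d x (toℕ j) , stk d f g h (unmark (toℕ j) r)) (Fr d x (suc (toℕ j)) , stk d f g h z)) (unmark-suc r j)
            (popR d j (unmark-look r j) (fr j refl)))
        where j = fromℕ< i<K

    end-path : ∀ d x f g h r → Det-Path (Nf d x 0 , stk d f g (st ∷ h) (regs v₀ r)) (R (not d) x , stk d f g h r)
    end-path d x f g h r =
      unnums d f g (st ∷ h) r x n ≤-refl
      ∙ᵈ subst (λ z → Det-Path (Nf d x n , stk d f g (st ∷ h) (regs (count (n ∸ n)) r)) (Fr d x 0 , stk d f g (st ∷ h) z))
           (trans (cong (λ z → regs (count z) r) (n∸n≡0 n)) (trans (cong (λ z → regs z r) count-0) (sym (unmark-none r))))
           (peekR d inp (trans (count-look (n ∸ n) r) (cong (λ z → us z (bot ∷ lookup r inp)) (n∸n≡0 n))) (nf-end refl))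
      ∙ᵈ unmarks d f g (st ∷ h) r x K ≤-refl
      ∙ᵈ subst (λ z → Det-Path (Fr d x K , stk d f g (st ∷ h) z) (R (not d) x , stk d f g h r)) (sym (unmark-all r)) (popH d (fr-end refl))

    Traced : ℕ → Set
    Traced i = ∃ λ hs → ∃₂ λ p v → Trace es v₀ i hs p v

    hist-peek : ∀ {i hs p v d f g h r} → Trace es v₀ i hs p v →
                Det-Path (R d false , stk d f g (hist hs (st ∷ h)) r) (S d p , stk d f g (hist hs (st ∷ h)) r)
    hist-peek {d = d} start = peekH d r-st
    hist-peek {d = d} {f} {g} {h} {r} (more {h = hs} t x ms) =
      subst (λ p → Det-Path (R d false , stk d f g (ed x ∷ hist hs (st ∷ h)) r) (S d p , stk d f g (ed x ∷ hist hs (st ∷ h)) r)) (target ms)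
            (peekH d (r-ed x))
      where
      target : ∀ {e p v q w} → MStep e p v q w → tgt e ≡ q
      target m-inc = refl
      target (m-dec _) = refl
      target (m-zero _) = refl

    -- Apart from the removal of the frame's own marker `mk x` the call is invisible, so the caller
    -- can go on with its history and counters. The length `i` of the region is also the number of
    -- counter machine steps that the frame makes.
    Frame : ℕ → Set
    Frame i = ∀ d x y f g h r →
      Det-Path (I d 0 , stk d (os i (mk y ∷ f)) (mk x ∷ g) h r) (R (not d) x , stk d (os i (mk y ∷ f)) g h r)

    nested : ∀ {i} → Frame i → ∀ d {s} b y f g h r → Tr s (push (F d) (mk b)) (I (not d) 0) →
             Det-Path (s , stk d f (os i (mk y ∷ g)) h r) (R d b , stk d f (os i (mk y ∷ g)) h r)
    nested {i} φ d b y f g h r tr = pushF d tr ∙ᵈ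
      subst₂ Det-Path (cong (I (not d) 0 ,_) (stk-not d _ _ h r)) (cong₂ (λ z → R z b ,_) (not-involutive d) (stk-not d _ _ h r))
        (φ (not d) b y g f h r)

    module _ (d x : Bool) (f g : Cells) (h : Cells) (r : Regs) where
      -- The frame called after `k` steps works over the `k` cells already behind. So a sweep of `i`
      -- cells needs only frames shorter than `i`, which makes the nesting well-founded.
      sweep : ∀ {i hs p v} → Trace es v₀ i hs p v → (∀ k → k < i → Frame k) → ∀ j →
              Det-Path (A d , stk d (os (j + i) f) (mk x ∷ g) (st ∷ h) (regs v₀ r))
                       (A d , stk d (os j f) (os i (mk x ∷ g)) (hist hs (st ∷ h)) (regs v r))
      sweep start φ j = subst (λ z → Det-Path (A d , stk d (os z f) (mk x ∷ g) (st ∷ h) (regs v₀ r))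
                                               (A d , stk d (os j f) (mk x ∷ g) (st ∷ h) (regs v₀ r)))
                               (sym (+-identityʳ j)) []
      sweep (more {i} {hs} {v = v} t e ms) φ j =
        subst (λ z → Det-Path (A d , stk d (os z f) (mk x ∷ g) (st ∷ h) (regs v₀ r))
                              (A d , stk d (os (suc j) f) (os i (mk x ∷ g)) (hist hs (st ∷ h)) (regs v r)))
              (sym (+-suc j i)) (sweep t (λ k lt → φ k (m<n⇒m<1+n lt)) (suc j))
        ∙ᵈ popF d a-o ∙ᵈ nested (φ i ≤-refl) d false x (os j f) g _ _ call-a ∙ᵈ hist-peek t ∙ᵈ M-forward e ms ∙ᵈ pushH d p-push ∙ᵈ pushG d o-push

      sweep-back : ∀ {i hs p v} → Trace es v₀ i hs p v → (∀ k → k < i → Frame k) → ∀ j →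
                   Det-Path (B d , stk d (os j f) (os i (mk x ∷ g)) (hist hs (st ∷ h)) (regs v r))
                            (B d , stk d (os (j + i) f) (mk x ∷ g) (st ∷ h) (regs v₀ r))
      sweep-back start φ j = subst (λ z → Det-Path (B d , stk d (os j f) (mk x ∷ g) (st ∷ h) (regs v₀ r))
                                                    (B d , stk d (os z f) (mk x ∷ g) (st ∷ h) (regs v₀ r)))
                                    (sym (+-identityʳ j)) []
      sweep-back (more {i} {hs} {v = v} t e ms) φ j =
        popG d b-o ∙ᵈ nested (φ i ≤-refl) d true x (os j f) g _ _ call-b ∙ᵈ popH d (r-pop e) ∙ᵈ M-back e ms ∙ᵈ pushF d v-push
        ∙ᵈ subst (λ z → Det-Path (B d , stk d (os (suc j) f) (os i (mk x ∷ g)) (hist hs (st ∷ h)) (regs v r))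
                                 (B d , stk d (os z f) (mk x ∷ g) (st ∷ h) (regs v₀ r)))
                 (sym (+-suc j i)) (sweep-back t (λ k lt → φ k (m<n⇒m<1+n lt)) (suc j))

    -- The part of a frame after it has met the far marker. It is separate because a frame moving
    -- into unknown cells learns only on the way where its marker is, and from then on is determined
    -- again.
    return : ∀ d x y f g h r {i hs p v} → Trace es v₀ i hs p v → (∀ k → k < i → Frame k) →
             Det-Path (A′ d y , stk d f (os i (mk x ∷ g)) (hist hs (st ∷ h)) (regs v r)) (R (not d) x , stk d (os i (mk y ∷ f)) g h r)
    return d x y f g h r t φ =
      pushF d a-back ∙ᵈ sweep-back d x (mk y ∷ f) g h r t φ 0 ∙ᵈ popG d b-m ∙ᵈ end-path d x _ g h r

    frames : ∀ b i → i < b → Traced i → Frame i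
    frames (suc b) i (s≤s i≤b) (_ , _ , _ , t) d x y f g h r =
      init-path d _ (mk x ∷ g) h r ∙ᵈ sweep d x (mk y ∷ f) g h r t inner 0 ∙ᵈ popF d a-m ∙ᵈ return d x y f g h r t inner
      where
      inner : ∀ k → k < i → Frame k
      inner k k<i = frames b k (<-≤-trans k<i i≤b) (trace-prefix (<⇒≤ k<i) t)

    frame : ∀ i → Traced i → Frame i
    frame i = frames (suc i) i ≤-refl

-- The infinite run of a machine whose computation is infinite, and determinism.

module FrameRuns where
  open import Data.Nat
  open import Data.Nat.Properties
  open import Data.Bool using (Bool; true; false; not)
  open import Data.Bool.Properties using (not-involutive)
  open import Data.Fin using (Fin; zero; suc)
  open import Data.Fin.Properties using (toℕ<n; toℕ-injective)
  open import Data.List using (List; []; _∷_)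
  import Data.List as L
  open import Data.List.Relation.Unary.All using (All; []; _∷_)
  import Data.List.Relation.Unary.All as All
  open import Data.List.Relation.Unary.AllPairs using (AllPairs; []; _∷_)
  open import Data.List.Membership.Propositional.Properties using (∈-lookup)
  open import Data.Vec using ([]; _∷_; lookup; _[_]≔_; replicate)
  open import Data.Product using (Σ; ∃; ∃₂; _×_; _,_; proj₁; proj₂; -,_)
  open import Data.Sum using (_⊎_; inj₁; inj₂)
  open import Data.Empty using (⊥; ⊥-elim)
  open import Relation.Binary.PropositionalEquality
  open import Relation.Nullary using (¬_; yes; no)
  open CounterMachines using (inc; dec; zero; Edge; edge; src; kind; reg; MStep; m-inc; m-dec; m-zero; Trace; start; more; Det; trace-prefix)
  import Data.Fin as Finₚ
  open StackMachines
  open NestedFrames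

  all-pairs : ∀ {A : Set} {R : A → A → Set} {xs} → AllPairs R xs → ∀ i j →
              i ≡ j ⊎ R (L.lookup xs i) (L.lookup xs j) ⊎ R (L.lookup xs j) (L.lookup xs i)
  all-pairs (_ ∷ _) zero zero = inj₁ refl
  all-pairs {xs = _ ∷ xs} (px ∷ _) zero (suc j) = inj₂ (inj₁ (All.lookup px (∈-lookup {xs = xs} j)))
  all-pairs {xs = _ ∷ xs} (px ∷ _) (suc i) zero = inj₂ (inj₂ (All.lookup px (∈-lookup {xs = xs} i)))
  all-pairs (_ ∷ ps) (suc i) (suc j) with all-pairs ps i j
  ... | inj₁ refl = inj₁ refl
  ... | inj₂ r = inj₂ r

  module Runs {K} (es : List (Edge K)) (inp : Fin K) (n : ℕ) (det : Det es) where
    open Frames es inp n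

    mstep-src : ∀ {e p v q w} → MStep {K} e p v q w → src e ≡ p
    mstep-src m-inc = refl
    mstep-src (m-dec _) = refl
    mstep-src (m-zero _) = refl

    dec-zero : ∀ {e e′ p v q w q′ w′} → MStep {K} e p v q w → MStep e′ p v q′ w′ →
               reg e ≡ reg e′ → kind e ≡ dec → kind e′ ≡ zero → ⊥
    dec-zero (m-dec eq) (m-zero eq′) refl refl refl with trans (sym eq) eq′
    ... | ()

    mstep-edge : ∀ {x y p v q w q′ w′} → MStep (the x) p v q w → MStep (the y) p v q′ w′ → x ≡ y
    mstep-edge {x} {y} ms ms′ with all-pairs det x y
    ... | inj₁ eq = eq
    ... | inj₂ (inj₁ (inj₁ ne)) = ⊥-elim (ne (trans (mstep-src ms) (sym (mstep-src ms′))))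
    ... | inj₂ (inj₁ (inj₂ (r , k , k′))) = ⊥-elim (dec-zero ms ms′ r k k′)
    ... | inj₂ (inj₂ (inj₁ ne)) = ⊥-elim (ne (trans (mstep-src ms′) (sym (mstep-src ms))))
    ... | inj₂ (inj₂ (inj₂ (r , k , k′))) = ⊥-elim (dec-zero ms′ ms r k k′)

    mstep-fun : ∀ {e p v q w q′ w′} → MStep {K} e p v q w → MStep e p v q′ w′ → q ≡ q′ × w ≡ w′
    mstep-fun m-inc m-inc = refl , refl
    mstep-fun (m-dec eq) (m-dec eq′) with trans (sym eq) eq′
    ... | refl = refl , refl
    mstep-fun (m-zero _) (m-zero _) = refl , refl

    trace-det : ∀ {i hs p v hs′ p′ v′} → Trace es v₀ i hs p v → Trace es v₀ i hs′ p′ v′ → (hs , p , v) ≡ (hs′ , p′ , v′)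
    trace-det start start = refl
    trace-det (more t x ms) (more t′ x′ ms′) with trace-det t t′
    ... | refl with mstep-edge ms ms′
    ... | refl with mstep-fun ms ms′
    ... | refl , refl = refl

    module Forever (T : ∀ i → Traced i) where
      empties : Regs
      empties = replicate K []

      top : ∀ i → Traced i → Conf
      top i (hs , p , v , _) = A false , stk false [] (os i (mk false ∷ [])) (hist hs (st ∷ [])) (regs v empties)

      link : ∀ i (t : Traced i) (t′ : Traced (suc i)) → Path⁺ (top i t) (top (suc i) t′)
      link i (_ , _ , v , t) (_ , _ , _ , more t′ e ms) with trace-det t t′
      -- The stack ahead of the outermost frame is empty, that is unknown; `pop∅` lets the frame
      -- find one more cell there.
      ... | refl = -, step a-o pop∅ refl ,
        path (nested (frame i (-, -, -, t)) false false false [] [] _ _ call-a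
              ∙ᵈ hist-peek t ∙ᵈ M-forward e ms ∙ᵈ pushH false p-push ∙ᵈ pushG false o-push)

      -- Beginning with a call lets the machine itself write the marker behind the outermost frame,
      -- so that all stacks can be empty at the start.
      forever : Inf (CA true , replicate (3 + K) [])
      forever = prepend (path (pushF true {f = []} {g = []} {h = []} {r = empties} call-a
                               ∙ᵈ init-path false [] (mk false ∷ []) [] empties
                               ∙ᵈ same (trace-det start (proj₂ (proj₂ (proj₂ (T 0)))))))
                        (glue (λ i → top i (T i)) (λ i → link i (T i) (T (suc i))))
        where
        same : ∀ {z z′} → z ≡ z′ →
               Det-Path (A false , stk false [] (mk false ∷ []) (hist (proj₁ z) (st ∷ [])) (regs (proj₂ (proj₂ z)) empties))
                        (A false , stk false [] (mk false ∷ []) (hist (proj₁ z′) (st ∷ [])) (regs (proj₂ (proj₂ z′)) empties))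
        same refl = []

    data Reads : Op Layers (Sym E) → Fin Layers → Sym E → Set where
      pop  : ∀ {l a} → Reads (pop l a) l a
      peek : ∀ {l a} → Reads (peek l a) l a

    Clash : Op Layers (Sym E) → Op Layers (Sym E) → Set
    Clash op op′ = ∃ λ l → ∃₂ λ a b → a ≢ b × Reads op l a × Reads op′ l b

    reads-dec : ∀ e → kind e ≡ dec → Reads (opOf e) (rL (reg e)) u
    reads-dec (edge _ _ _ _) refl = pop

    reads-zero : ∀ e → kind e ≡ zero → Reads (opOf e) (rL (reg e)) bot
    reads-zero (edge _ _ _ _) refl = peek

    ed-inj : ∀ {x y : Fin E} → ed x ≡ ed y → x ≡ y
    ed-inj refl = refl

    -- Clashing rules read different symbols from one stack, so a known top symbol excludes one of
    -- them. Over unknown contents both remain possible, which is why only a `Det-Path` can be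
    -- followed.
    tr-det : ∀ {s op op′ s₁ s₂} → Tr s op s₁ → Tr s op′ s₂ → (op ≡ op′ × s₁ ≡ s₂) ⊎ Clash op op′
    tr-det a-o a-o = inj₁ (refl , refl)
    tr-det a-o a-m = inj₂ (-, -, -, (λ ()) , pop , pop)
    tr-det a-m a-o = inj₂ (-, -, -, (λ ()) , pop , pop)
    tr-det (a-m {x = false}) (a-m {x = false}) = inj₁ (refl , refl)
    tr-det (a-m {x = false}) (a-m {x = true}) = inj₂ (-, -, -, (λ ()) , pop , pop)
    tr-det (a-m {x = true}) (a-m {x = false}) = inj₂ (-, -, -, (λ ()) , pop , pop)
    tr-det (a-m {x = true}) (a-m {x = true}) = inj₁ (refl , refl)
    tr-det a-back a-back = inj₁ (refl , refl)
    tr-det call-a call-a = inj₁ (refl , refl)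
    tr-det call-b call-b = inj₁ (refl , refl)
    tr-det (init j eq) (init j′ eq′) with toℕ-injective (trans (sym eq) eq′)
    ... | refl = inj₁ (refl , refl)
    tr-det (init j refl) (init-end eq) = ⊥-elim (<-irrefl eq (toℕ<n j))
    tr-det (init-end eq) (init j refl) = ⊥-elim (<-irrefl eq (toℕ<n j))
    tr-det (init-end _) (init-end _) = inj₁ (refl , refl)
    tr-det (num _) (num _) = inj₁ (refl , refl)
    tr-det (num lt) (num-end refl) = ⊥-elim (<-irrefl refl lt)
    tr-det (num-end refl) (num lt) = ⊥-elim (<-irrefl refl lt)
    tr-det (num-end _) (num-end _) = inj₁ (refl , refl)
    tr-det r-st r-st = inj₁ (refl , refl)
    tr-det r-st (r-ed e) = inj₂ (-, -, -, (λ ()) , peek , peek)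
    tr-det (r-ed e) r-st = inj₂ (-, -, -, (λ ()) , peek , peek)
    tr-det (r-ed e) (r-ed e′) with e Finₚ.≟ e′
    ... | yes refl = inj₁ (refl , refl)
    ... | no ne = inj₂ (-, -, -, (λ eq → ne (ed-inj eq)) , peek , peek)
    tr-det (s-op e eq) (s-op e′ eq′) with all-pairs det e e′
    ... | inj₁ refl = inj₁ (refl , refl)
    ... | inj₂ (inj₁ (inj₁ ne)) = ⊥-elim (ne (trans (sym eq) eq′))
    ... | inj₂ (inj₂ (inj₁ ne)) = ⊥-elim (ne (trans (sym eq′) eq))
    ... | inj₂ (inj₁ (inj₂ (r , k , k′))) =
      inj₂ (-, -, -, (λ ()) , reads-dec (the e) k , subst (λ z → Reads (opOf (the e′)) (rL z) bot) (sym r) (reads-zero (the e′) k′))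
    ... | inj₂ (inj₂ (inj₂ (r , k , k′))) =
      inj₂ (-, -, -, (λ ()) , reads-zero (the e) k′ , subst (λ z → Reads (opOf (the e′)) (rL z) u) r (reads-dec (the e′) k))
    tr-det p-push p-push = inj₁ (refl , refl)
    tr-det o-push o-push = inj₁ (refl , refl)
    tr-det (r-pop e) (r-pop e′) with e Finₚ.≟ e′
    ... | yes refl = inj₁ (refl , refl)
    ... | no ne = inj₂ (-, -, -, (λ eq → ne (ed-inj eq)) , pop , pop)
    tr-det u-op u-op = inj₁ (refl , refl)
    tr-det v-push v-push = inj₁ (refl , refl)
    tr-det b-o b-o = inj₁ (refl , refl)
    tr-det b-o b-m = inj₂ (-, -, -, (λ ()) , pop , pop)
    tr-det b-m b-o = inj₂ (-, -, -, (λ ()) , pop , pop)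
    tr-det (b-m {x = false}) (b-m {x = false}) = inj₁ (refl , refl)
    tr-det (b-m {x = false}) (b-m {x = true}) = inj₂ (-, -, -, (λ ()) , pop , pop)
    tr-det (b-m {x = true}) (b-m {x = false}) = inj₂ (-, -, -, (λ ()) , pop , pop)
    tr-det (b-m {x = true}) (b-m {x = true}) = inj₁ (refl , refl)
    tr-det (nf _) (nf _) = inj₁ (refl , refl)
    tr-det (nf lt) (nf-end refl) = ⊥-elim (<-irrefl refl lt)
    tr-det (nf-end refl) (nf lt) = ⊥-elim (<-irrefl refl lt)
    tr-det (nf-end _) (nf-end _) = inj₁ (refl , refl)
    tr-det (fr j eq) (fr j′ eq′) with toℕ-injective (trans (sym eq) eq′)
    ... | refl = inj₁ (refl , refl)
    tr-det (fr j refl) (fr-end eq) = ⊥-elim (<-irrefl eq (toℕ<n j))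
    tr-det (fr-end eq) (fr j refl) = ⊥-elim (<-irrefl eq (toℕ<n j))
    tr-det (fr-end _) (fr-end _) = inj₁ (refl , refl)

    known-head : ∀ {op s t l a} {act : Act op s t} → Known act → Reads op l a → l ≡ layer op × ∃ λ s′ → s ≡ a ∷ s′
    known-head pop pop = refl , -, refl
    known-head peek peek = refl , -, refl

    act-head : ∀ {op s t l a b s′} → Act op s t → Reads op l a → s ≡ b ∷ s′ → l ≡ layer op × a ≡ b
    act-head pop pop refl = refl , refl
    act-head peek peek refl = refl , refl

    act-fun : ∀ {op s t t′} (act : Act {Layers} {Sym E} op s t) → Known act → Act op s t′ → t ≡ t′
    act-fun push push push = refl
    act-fun pop pop pop = refl
    act-fun peek peek peek = refl

    same-step : ∀ {c c₁ c₂} (s : Step c c₁) → Known (Step.act s) → Step c c₂ → c₁ ≡ c₂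
    same-step {_ , σ} {_ , _} {_ , _} (step tr act upd) kn (step tr′ act′ upd′) with tr-det tr tr′
    ... | inj₁ (refl , refl) = cong (_ ,_) (trans upd (trans (cong (σ [ _ ]≔_) (act-fun act kn act′)) (sym upd′)))
    ... | inj₂ (l , a , b , ne , ra , rb) with known-head kn ra | layer-of rb
      where
      layer-of : ∀ {op l b} → Reads op l b → l ≡ layer op
      layer-of pop = refl
      layer-of peek = refl
    ... | refl , s′ , eq | eq′ =
      ⊥-elim (ne (sym (proj₂ (act-head act′ rb (trans (cong (lookup σ) (sym eq′)) eq)))))

    follow : ∀ {c c′} → Det-Path c c′ → Inf c → Inf c′
    follow [] r = r
    follow ((s , kn) ∷ p) r with uncons r
    ... | _ , s′ , r′ = follow p (subst Inf (sym (same-step s kn s′)) r′)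

    -- A halting computation leaves no infinite run from any configuration.

    module Halting {i₀ hs₀ p₀ w₀} (t₀ : Trace es v₀ i₀ hs₀ p₀ w₀) (stuck : ∀ x → src (the x) ≢ p₀) where

      -- By determinism a longer trace would pass through `p₀`, where no edge starts. The bounds on
      -- the lengths of regions and sweeps below come from here.
      bound : ∀ {i} → Traced i → i ≤ i₀
      bound {i} (_ , _ , _ , t) with i ≤? i₀
      ... | yes le = le
      ... | no nle with trace-prefix (≰⇒> nle) t
      ... | _ , _ , _ , more t′ x ms with trace-det t′ t₀
      ... | refl = ⊥-elim (stuck x (mstep-src ms))

      Popped : Sym E → Cells → Cells → Set
      Popped a s t = s ≡ a ∷ t ⊎ (s ≡ [] × t ≡ [])

      popped : ∀ {l a s t} → Act {Layers} (pop l a) s t → Popped a s t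
      popped pop = inj₁ refl
      popped pop∅ = inj₂ (refl , refl)

      afterF : ∀ d {f g h r s a t τ} → Act (pop (F d) a) (lookup (stk d f g h r) (F d)) t → τ ≡ stk d f g h r [ F d ]≔ t →
               Inf (s , τ) → Popped a f t × Inf (s , stk d t g h r)
      afterF d act refl r = subst (λ z → Popped _ z _) (lookF d) (popped act) , subst (λ z → Inf (_ , z)) (updF d _) r

      afterG : ∀ d {f g h r s a t τ} → Act (pop (F (not d)) a) (lookup (stk d f g h r) (F (not d))) t → τ ≡ stk d f g h r [ F (not d) ]≔ t →
               Inf (s , τ) → Popped a g t × Inf (s , stk d f t h r)
      afterG d act refl r = subst (λ z → Popped _ z _) (lookG d) (popped act) , subst (λ z → Inf (_ , z)) (updG d _) r

      -- Moving a garbage frame forward we only keep track of the stacks F and G.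
      Inf′ : St E → Bool → Cells → Cells → Set
      Inf′ s d f g = ∃₂ λ h r → Inf (s , stk d f g h r)

      flip′ : ∀ {s} d {f g} → Inf′ s d f g → Inf′ s (not d) g f
      flip′ {s} d (h , r , i) = h , r , subst (λ z → Inf (s , z)) (sym (stk-not d _ _ h r)) i

      on-reg : ∀ d {f g h r s e τ t} → τ ≡ stk d f g h r [ layer (opOf e) ]≔ t → Inf (s , τ) → Inf′ s d f g
      on-reg d {e = edge _ inc _ _} refl i = -, -, i
      on-reg d {e = edge _ dec _ _} refl i = -, -, i
      on-reg d {e = edge _ zero _ _} refl i = -, -, i

      on-reg-undo : ∀ d {f g h r s e τ t} → τ ≡ stk d f g h r [ layer (undoOf e) ]≔ t → Inf (s , τ) → Inf′ s d f g
      on-reg-undo d {e = edge _ inc _ _} refl i = -, -, i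
      on-reg-undo d {e = edge _ dec _ _} refl i = -, -, i
      on-reg-undo d {e = edge _ zero _ _} refl i = -, -, i

      from-O : ∀ {d f g} → Inf′ (O d) d f g → Inf′ (A d) d f (o ∷ g)
      from-O {d} (h , r , i) = h , r , follow (pushG d o-push) i

      from-P : ∀ {d e f g} → Inf′ (P d e) d f g → Inf′ (A d) d f (o ∷ g)
      from-P {d} (h , r , i) = from-O (-, -, follow (pushH d p-push) i)

      from-S : ∀ {d p f g} → Inf′ (S d p) d f g → Inf′ (A d) d f (o ∷ g)
      from-S {d} (h , r , i) with uncons i
      ... | _ , step (s-op e _) act upd , i′ = from-P (on-reg d {e = the e} upd i′)

      from-R-a : ∀ {d f g} → Inf′ (R d false) d f g → Inf′ (A d) d f (o ∷ g)
      from-R-a {d} (h , r , i) with uncons i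
      ... | _ , step r-st act refl , i′ = from-S (-, -, i′)
      ... | _ , step (r-ed e) act refl , i′ = from-S (-, -, i′)

      from-V : ∀ {d f g} → Inf′ (V d) d f g → Inf′ (B d) d (o ∷ f) g
      from-V {d} (h , r , i) = h , r , follow (pushF d v-push) i

      from-U : ∀ {d e f g} → Inf′ (U d e) d f g → Inf′ (B d) d (o ∷ f) g
      from-U {d} {e} (h , r , i) with uncons i
      ... | _ , step u-op act upd , i′ = from-V (on-reg-undo d {e = the e} upd i′)

      from-R-b : ∀ {d f g} → Inf′ (R d true) d f g → Inf′ (B d) d (o ∷ f) g
      from-R-b {d} (h , r , i) with uncons i
      ... | _ , step (r-pop e) act refl , i′ = from-U (-, -, i′)

      -- No rule leaves an index beyond `K`, so nothing need be known about `i` and even a garbage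
      -- state must finish this phase; `k` bounds the rounds left.
      from-Fr : ∀ k {i d x f g} → K ≤ k + i → Inf′ (Fr d x i) d f g → Inf′ (R (not d) x) d f g
      from-Fr k {i = i} le (h , r , inf) with uncons inf
      from-Fr k le (h , r , inf) | _ , step (fr-end _) act refl , i′ = -, -, i′
      from-Fr zero le (h , r , inf) | _ , step (fr j refl) act refl , i′ = ⊥-elim (<⇒≱ (toℕ<n j) le)
      from-Fr (suc k) {i} le (h , r , inf) | _ , step (fr j _) act refl , i′ =
        from-Fr k (≤-trans le (≤-reflexive (sym (+-suc k i)))) (-, -, i′)

      from-Nf : ∀ k {i d x f g} → n ≤ k + i → Inf′ (Nf d x i) d f g → Inf′ (R (not d) x) d f g
      from-Nf k le (h , r , inf) with uncons inf
      from-Nf k le (h , r , inf) | _ , step (nf-end _) act refl , i′ = from-Fr K (m≤m+n K 0) (-, -, i′)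
      from-Nf zero le (h , r , inf) | _ , step (nf lt) act refl , i′ = ⊥-elim (<⇒≱ lt le)
      from-Nf (suc k) {i} le (h , r , inf) | _ , step (nf _) act refl , i′ =
        from-Nf k (≤-trans le (≤-reflexive (sym (+-suc k i)))) (-, -, i′)

      from-N : ∀ k {i d f g} → n ≤ k + i → Inf′ (N d i) d f g → Inf′ (A d) d f g
      from-N k le (h , r , inf) with uncons inf
      from-N k le (h , r , inf) | _ , step (num-end _) act refl , i′ = -, -, i′
      from-N zero le (h , r , inf) | _ , step (num lt) act refl , i′ = ⊥-elim (<⇒≱ lt le)
      from-N (suc k) {i} le (h , r , inf) | _ , step (num _) act refl , i′ =
        from-N k (≤-trans le (≤-reflexive (sym (+-suc k i)))) (-, -, i′)

      from-I : ∀ k {i d f g} → K ≤ k + i → Inf′ (I d i) d f g → Inf′ (A d) d f g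
      from-I k le (h , r , inf) with uncons inf
      from-I k le (h , r , inf) | _ , step (init-end _) act refl , i′ = from-N n (m≤m+n n 0) (-, -, i′)
      from-I zero le (h , r , inf) | _ , step (init j refl) act refl , i′ = ⊥-elim (<⇒≱ (toℕ<n j) le)
      from-I (suc k) {i} le (h , r , inf) | _ , step (init j _) act refl , i′ =
        from-I k (≤-trans le (≤-reflexive (sym (+-suc k i)))) (-, -, i′)

      us-head : ∀ k {s : Cells} {t} → Popped u (us k (bot ∷ s)) t → ∃ λ k′ → k ≡ suc k′
      us-head zero (inj₁ ())
      us-head zero (inj₂ (() , _))
      us-head (suc k) _ = k , refl

      us-bot : ∀ k {s : Cells} {s′} → us k (bot ∷ s) ≡ bot ∷ s′ → k ≡ 0
      us-bot zero _ = refl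

      -- The counters were set up by the current frame and end in `bot`, so their tops are known and
      -- the rule chosen by the run must be a genuine step of the counter machine.
      next-edge : ∀ {d p f g h v r} → Inf (S d p , stk d f g h (regs v r)) → ∃ λ e → ∃₂ λ q w → MStep (the e) p v q w
      next-edge {d₀} {_} {f₀} {g₀} {h₀} {v} {r} i with uncons i
      ... | _ , step (s-op e refl) act _ , _ = e , go (the e) {d₀} {f₀} {g₀} {h₀} act
        where
        peeked : ∀ {l a s t} → Act {Layers} {Sym E} (peek l a) s t → Σ Cells (λ s′ → s ≡ a ∷ s′) ⊎ s ≡ []
        peeked peek = inj₁ (-, refl)
        peeked peek∅ = inj₂ refl
        us-nonempty : ∀ k {s : Cells} → us k (bot ∷ s) ≢ []
        us-nonempty zero ()
        us-nonempty (suc k) ()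
        go : ∀ z {d f g h t} → Act (opOf z) (lookup (stk d f g h (regs v r)) (layer (opOf z))) t →
             ∃₂ λ q w → MStep z (src z) v q w
        go (edge p inc j q) act = q , _ , m-inc
        go (edge p dec j q) act with us-head (lookup v j) (subst (λ z → Popped u z _) (lookup-regs v r j) (popped act))
        ... | k , vj = q , _ , m-dec vj
        go (edge p zero j q) act with peeked act
        ... | inj₁ (_ , e₁) = q , _ , m-zero (us-bot (lookup v j) (trans (sym (lookup-regs v r j)) e₁))
        ... | inj₂ e₁ = ⊥-elim (us-nonempty (lookup v j) (trans (sym (lookup-regs v r j)) e₁))

      os-popped : ∀ k {f t} → Popped o (os (suc k) f) t → t ≡ os k f
      os-popped k (inj₁ refl) = refl

      not-mk : ∀ k {x} {f t : Cells} → Popped (mk x) (os k f) t → k ≡ 0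
      not-mk zero _ = refl
      not-mk (suc k) (inj₁ ())
      not-mk (suc k) (inj₂ (() , _))

      -- The result of a call: the region ends with a marker after k′ ≥ k cells.
      Returned : Bool → Bool → ℕ → Cells → Cells → Regs → Set
      Returned d x k g h r = ∃ λ k′ → ∃₂ λ y f → k ≤ k′ × Traced k′ × Inf (R (not d) x , stk d (os k′ (mk y ∷ f)) g h r)

      -- A freshly started frame has to find a marker, as each cell passed lengthens a trace limited
      -- by `bound`. Cells popped from the unknown part become known by being passed, so afterwards
      -- the whole region is known up to its marker.
      loop-a : ∀ fuel {i hs p v} → suc i₀ ≤ fuel + i → (t : Trace es v₀ i hs p v) → ∀ {d x f g h r} k f₀ → f ≡ os k f₀ →
               Inf (A d , stk d f (os i (mk x ∷ g)) (hist hs (st ∷ h)) (regs v r)) → Returned d x (k + i) g h r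
      loop-a zero le t k f₀ eq inf = ⊥-elim (<⇒≱ le (bound (-, -, -, t)))
      loop-a (suc fuel) {i} le t {d} {x} {g = g} k f₀ refl inf with uncons inf
      ... | _ , step (a-m {x = y}) act upd , i₁ with afterF d act upd i₁
      ... | pop≡ , i₂ with not-mk k pop≡
      ... | refl = i , y , _ , ≤-refl , (-, -, -, t) ,
        follow (return d x y _ g _ _ t (λ j lt → frame j (trace-prefix (<⇒≤ lt) t))) i₂
      loop-a (suc fuel) {i} le t {d} {x} {g = g} k f₀ refl inf | _ , step a-o act upd , i₁ with afterF d act upd i₁
      ... | pop≡ , i₂ with follow (nested (frame i (-, -, -, t)) d false x _ g _ _ call-a ∙ᵈ hist-peek t) i₂
      ... | i₃ with next-edge i₃
      ... | e , q , w , ms with loop-a fuel (≤-trans le (≤-reflexive (sym (+-suc fuel i)))) (more t e ms) (pred k) (rest k pop≡)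
                                       (rest-eq k pop≡) (follow (M-forward e ms ∙ᵈ pushH d p-push ∙ᵈ pushG d o-push) i₃)
        where
        rest : ∀ k {t} → Popped o (os k f₀) t → Cells
        rest zero {t} _ = t
        rest (suc k) _ = f₀
        rest-eq : ∀ k {t} (p : Popped o (os k f₀) t) → t ≡ os (pred k) (rest k p)
        rest-eq zero p = refl
        rest-eq (suc k) p = os-popped k p
      ... | k′ , y , f , le′ , ret = k′ , y , f , ≤-trans (shift k) le′ , ret
        where
        shift : ∀ k → k + i ≤ pred k + suc i
        shift zero = n≤1+n i
        shift (suc k) = ≤-reflexive (sym (+-suc k i))

      call : ∀ {d x g h r} k f → Inf (I d 0 , stk d (os k f) (mk x ∷ g) h r) → Returned d x k g h r
      call {d} {x} {g} {h} {r} k f inf =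
        subst (λ z → Returned d x z g h r) (+-identityʳ k)
          (loop-a (suc i₀) (m≤m+n (suc i₀) 0) start k f refl (follow (init-path d _ _ _ _) inf))

      -- The call made by a garbage frame, whose region begins with k cells.
      garbage-call : ∀ {d s b f g h r} k → Tr s (push (F d) (mk b)) (I (not d) 0) → Inf (s , stk d f (os k g) h r) →
                     ∃ λ k′ → ∃₂ λ y g′ → k ≤ k′ × Traced k′ × Inf′ (R d b) d f (os k′ (mk y ∷ g′))
      garbage-call {d} {b = b} k tr inf
        with call {not d} k _ (subst (λ z → Inf (I (not d) 0 , z)) (sym (stk-not d _ _ _ _)) (follow (pushF d tr) inf))
      ... | k′ , y , g′ , le , t , inf′ = k′ , y , g′ , le , t , -, -,
        subst Inf (cong₂ (λ z → R z b ,_) (not-involutive d) (stk-not d _ _ _ _)) inf′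

      -- Each call is a fresh frame over the cells behind; it reveals a marker after some `k′ ≥ i`
      -- cells, where `k′ ≤ i₀`. As every round adds a cell behind, `suc i₀` rounds cannot all take
      -- place.
      garbage-a : ∀ fuel {d f g} i → suc i₀ ≤ fuel + i → Inf′ (A d) d f (os i g) →
                  ∃ λ i′ → ∃₂ λ f′ g′ → i ≤ i′ × Inf′ (B d) d f′ (os i′ g′)
      garbage-a fuel {d} i le (h , r , inf) with uncons inf
      garbage-a fuel {d} i le (h , r , inf) | _ , step a-m act upd , i₁ with afterF d act upd i₁
      ... | _ , i₂ = i , _ , _ , ≤-refl , -, -, follow (pushF d a-back) i₂
      garbage-a fuel {d} i le (h , r , inf) | _ , step a-o act upd , i₁ with afterF d act upd i₁
      ... | _ , i₂ with garbage-call {d} i call-a i₂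
      garbage-a zero i le _ | _ | _ , i₂ | k′ , y , g′ , le′ , t , inf′ = ⊥-elim (<⇒≱ (≤-trans le le′) (bound t))
      garbage-a (suc fuel) i le _ | _ | _ , i₂ | k′ , y , g′ , le′ , t , inf′
        with garbage-a fuel (suc k′) (≤-trans le (≤-trans (≤-reflexive (sym (+-suc fuel i))) (+-monoʳ-≤ fuel (s≤s le′)))) (from-R-a inf′)
      ... | i′ , f′ , g″ , le″ , inf″ = i′ , f′ , g″ , ≤-trans (m≤n⇒m≤1+n le′) le″ , inf″

      -- Once the cells behind are known up to a marker, the calls on the way back are regular
      -- frames. The garbage frame's own history and counters may be arbitrary, for they affect only
      -- what `Inf′` forgets.
      known-b : ∀ i {d f x g} → Traced i → Inf′ (B d) d f (os i (mk x ∷ g)) → ∃₂ λ y g′ → Inf′ (R (not d) y) d (os i f) g′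
      known-b zero {d} {f} {x} {g} _ (h , r , inf) with follow (popG d {f = f} {g = g} {h = h} {r = r} b-m) inf
      ... | i₁ = x , g , from-Nf n {0} {d} {x} {f} {g} (m≤m+n n 0) (_ , _ , i₁)
      known-b (suc i) {d} {f} {x} {g} (_ , _ , _ , more t e ms) (h , r , inf)
        with follow (popG d {f = f} {g = os i (mk x ∷ g)} {h = h} {r = r} b-o ∙ᵈ nested (frame i (-, -, -, t)) d true x f g h r call-b) inf
      ... | i₁ with known-b i {d} {o ∷ f} {x} {g} (-, -, -, t) (from-R-b {d} {f} {os i (mk x ∷ g)} (-, -, i₁))
      ... | y , g′ , i₂ = y , g′ , subst (λ z → Inf′ (R (not d) y) d z g′) (os-o i f) i₂

      os-split : ∀ {i k s} → i ≤ k → os k s ≡ os i (os (k ∸ i) s)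
      os-split z≤n = refl
      os-split (s≤s le) = cong (o ∷_) (os-split le)

      -- The first call reveals the marker behind, and `known-b` does the rest. One cell is taken
      -- off before that call, so the call traces at least `pred i` cells; this gives the bound
      -- `suc i₀`.
      garbage-b : ∀ i {d f g} → Inf′ (B d) d f (os i g) →
                  i ≤ suc i₀ × ∃ λ k → ∃₂ λ y g′ → i ≤ k × Inf′ (R (not d) y) d (os k f) g′
      garbage-b i {d} {f} {g} (h , r , inf) with uncons inf
      ... | _ , step (b-m {x = x}) act upd , i₁ with afterG d {f = f} {os i g} {h} {r} act upd i₁
      ... | pop≡ , i₂ with not-mk i pop≡
      ... | refl = z≤n , 0 , x , _ , z≤n , from-Nf n {0} {d} {x} {f} (m≤m+n n 0) (h , r , i₂)
      garbage-b i {d} {f} {g} (h , r , inf) | _ , step b-o act upd , i₁ with afterG d {f = f} {os i g} {h} {r} act upd i₁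
      ... | pop≡ , i₂ with garbage-call {d} {f = f} {g = rest i pop≡} (pred i) call-b (subst (λ z → Inf (CB d , stk d f z h r)) (rest-eq i pop≡) i₂)
        where
        rest : ∀ k {t} → Popped o (os k g) t → Cells
        rest zero {t} _ = t
        rest (suc k) _ = g
        rest-eq : ∀ k {t} (p : Popped o (os k g) t) → t ≡ os (pred k) (rest k p)
        rest-eq zero p = refl
        rest-eq (suc k) p = os-popped k p
      ... | k , x , g₁ , i≤k , t , i₃ with known-b k {d} {o ∷ f} {x} {g₁} t (from-R-b {d} {f} {os k (mk x ∷ g₁)} i₃)
      ... | y , g′ , i₄ = ≤-trans (up i) (s≤s (≤-trans i≤k (bound t))) , suc k , y , g′ , ≤-trans (up i) (s≤s i≤k) ,
        subst (λ z → Inf′ (R (not d) y) d z g′) (os-o k f) i₄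
        where
        up : ∀ i → i ≤ suc (pred i)
        up zero = z≤n
        up (suc i) = ≤-refl

      Resumed : ℕ → Set
      Resumed j = ∃₂ λ d x → ∃₂ λ f g → Inf′ (R d x) d f (os j g)

      -- The cells ahead of a returning frame are behind its caller, which works in the opposite
      -- direction.
      to-caller : ∀ j {d y k f g} → j ≤ k → Inf′ (R (not d) y) d (os k f) g → Resumed j
      to-caller j {d} {y} {k} {f} {g} le inf = not d , y , g , os (k ∸ j) f ,
        flip′ d {os j (os (k ∸ j) f)} {g} (subst (λ z → Inf′ (R (not d) y) d z g) (os-split le) inf)

      resumed-a : ∀ j {d f g} → Inf′ (A d) d f (os j g) → j ≤ suc i₀ × Resumed j
      resumed-a j {d} {f} {g} inf with garbage-a (suc i₀) {d} {f} {g} j (m≤m+n (suc i₀) j) inf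
      ... | i′ , f′ , g′ , j≤i′ , inf′ with garbage-b i′ {d} {f′} {g′} inf′
      ... | le , k , y , g″ , i′≤k , inf″ = ≤-trans j≤i′ le , to-caller j {d} {y} {k} {f′} {g″} (≤-trans j≤i′ i′≤k) inf″

      -- Each return of a garbage frame to its caller enlarges the known region by one cell.
      grow : ∀ j → Resumed j → j ≤ suc i₀ × Resumed (suc j)
      grow j (d , false , f , g , inf) with resumed-a (suc j) {d} {f} {g} (from-R-a {d} {f} {os j g} inf)
      ... | le , res = ≤-trans (n≤1+n j) le , res
      grow j (d , true , f , g , inf) with garbage-b j {d} {o ∷ f} {g} (from-R-b {d} {f} {os j g} inf)
      ... | le , k , y , g′ , j≤k , inf′ = le , to-caller (suc j) {d} {y} {suc k} {f} {g′} (s≤s j≤k)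
                                            (subst (λ z → Inf′ (R (not d) y) d z g′) (os-o k f) inf′)

      no-resumed : ¬ Resumed 0
      no-resumed res = <⇒≱ ≤-refl (proj₁ (grow (suc (suc i₀)) (grows (suc (suc i₀)))))
        where
        grows : ∀ j → Resumed j
        grows zero = res
        grows (suc j) = proj₂ (grow j (grows j))

      from-A : ∀ d {f g} → ¬ Inf′ (A d) d f g
      from-A d {f} {g} inf = no-resumed (proj₂ (resumed-a 0 {d} {f} {g} inf))

      from-B : ∀ d {f g} → ¬ Inf′ (B d) d f g
      from-B d {f} {g} inf with garbage-b 0 {d} {f} {g} inf
      ... | _ , k , y , g′ , le , inf′ = no-resumed (to-caller 0 {d} {y} {k} {f} {g′} le inf′)

      from-R : ∀ d x {f g} → ¬ Inf′ (R d x) d f g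
      from-R d x {f} {g} inf = no-resumed (d , x , f , g , inf)

      from-called : ∀ d {s b f g} → Tr s (push (F d) (mk b)) (I (not d) 0) → ¬ Inf′ s d f g
      from-called d {s} {b} {f} {g} tr (h , r , inf) with garbage-call {d} {f = f} {g = g} 0 tr inf
      ... | k , y , g′ , _ , _ , inf′ = from-R d b {f} {os k (mk y ∷ g′)} inf′

      dir : St E → Bool
      dir (A d) = d
      dir (B d) = d
      dir (O d) = d
      dir (V d) = d
      dir (CA d) = d
      dir (CB d) = d
      dir (A′ d _) = d
      dir (R d _) = d
      dir (I d _) = d
      dir (N d _) = d
      dir (S d _) = d
      dir (P d _) = d
      dir (U d _) = d
      dir (Nf d _ _) = d
      dir (Fr d _ _) = d

      from-any : ∀ s {f g} → ¬ Inf′ s (dir s) f g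
      from-any (A d) {f} {g} i = from-A d {f} {g} i
      from-any (B d) {f} {g} i = from-B d {f} {g} i
      from-any (O d) {f} {g} i = from-A d {f} {o ∷ g} (from-O {d} {f} {g} i)
      from-any (V d) {f} {g} i = from-B d {o ∷ f} {g} (from-V {d} {f} {g} i)
      from-any (CA d) {f} {g} i = from-called d {f = f} {g} call-a i
      from-any (CB d) {f} {g} i = from-called d {f = f} {g} call-b i
      from-any (A′ d x) {f} {g} (h , r , i) = from-B d {mk x ∷ f} {g} (h , r , follow (pushF d {f = f} {g} {h} {r} a-back) i)
      from-any (R d x) {f} {g} i = from-R d x {f} {g} i
      from-any (I d j) {f} {g} i = from-A d {f} {g} (from-I K {j} {d} {f} {g} (m≤m+n K j) i)
      from-any (N d j) {f} {g} i = from-A d {f} {g} (from-N n {j} {d} {f} {g} (m≤m+n n j) i)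
      from-any (S d p) {f} {g} i = from-A d {f} {o ∷ g} (from-S {d} {p} {f} {g} i)
      from-any (P d e) {f} {g} i = from-A d {f} {o ∷ g} (from-P {d} {e} {f} {g} i)
      from-any (U d e) {f} {g} i = from-B d {o ∷ f} {g} (from-U {d} {e} {f} {g} i)
      from-any (Nf d x j) {f} {g} i = from-R (not d) x {g} {f} (flip′ d {f} {g} (from-Nf n {j} {d} {x} {f} {g} (m≤m+n n j) i))
      from-any (Fr d x j) {f} {g} i = from-R (not d) x {g} {f} (flip′ d {f} {g} (from-Fr K {j} {d} {x} {f} {g} (m≤m+n K j) i))

      no-run : ∀ c → ¬ Inf c
      no-run (s , x ∷ y ∷ h ∷ r) i with dir s in eq
      ... | true = from-any s {x} {y} (h , r , subst (λ d → Inf (s , stk d x y h r)) (sym eq) i)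
      ... | false = from-any s {y} {x} (h , r , subst (λ d → Inf (s , stk d y x h r)) (sym eq) i)

-- Stacks stored in a row of tiles: local rules and their invariant.

module RowInvariant where
  open import Data.Nat
  open import Data.Nat.Properties
  open import Data.Bool using (Bool; true; false; if_then_else_)
  open import Data.List using (List; []; _∷_; length; map; _++_)
  open import Data.List.Relation.Unary.All using (All; []; _∷_)
  import Data.List.Relation.Unary.All as All
  import Data.List.Relation.Unary.All.Properties as All
  open import Data.List.Relation.Unary.Any using (Any; here; there)
  import Data.List.Relation.Unary.Any as Any
  import Data.List.Relation.Unary.Any.Properties as Any
  open import Data.Product using (∃; ∃₂; _×_; _,_; proj₁; proj₂; -,_)
  open import Data.Sum using (_⊎_; inj₁; inj₂)
  open import Data.Unit using (⊤; tt)
  open import Data.Empty using (⊥-elim)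
  open import Relation.Binary.PropositionalEquality
  open import Relation.Binary.Definitions using (DecidableEquality)
  open import Relation.Nullary using (Dec; yes)
  open import Relation.Nullary.Decidable using (_×-dec_)
  open import Data.Fin using (Fin)
  open StackMachines

  -- The state of a tile with respect to one of the stacks.  A cell remembers a symbol pushed at the row where it
  -- was born; it is on top or covered by later symbols; its bit tells whether, at its birth, the cell on its left
  -- was on top.
  data Cell (Sym : Set) : Set where
    free : Cell Sym
    top cov : Sym → Bool → Cell Sym

  module _ {Sym : Set} where
    isTop : Cell Sym → Bool
    isTop (top _ _) = true
    isTop _ = false

    -- While a symbol is popped, the cells holding it send their bits to the left.
    sig : Bool → Cell Sym → Bool
    sig y free = y
    sig y (top _ b) = b
    sig y (cov _ _) = false

    Reads : Sym → Cell Sym → Set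
    Reads a (top b _) = b ≡ a
    Reads a _ = ⊤

    -- Here `x` and `y` are the bits on the left and right side of a tile. During a push information
    -- flows to the right (whether the own cell is on top), during a pop to the left.
    Ok : ∀ {L} → Op L Sym → Bool → Bool → Cell Sym → Set
    Ok (push _ a) x y σ = y ≡ isTop σ
    Ok (pop _ a) x y σ = x ≡ sig y σ × Reads a σ
    Ok (peek _ a) x y σ = Reads a σ

    post : ∀ {L} → Op L Sym → Bool → Bool → Cell Sym → Cell Sym
    post (push _ a) x y free = top a x
    post (push _ a) x y (top b z) = cov b z
    post (push _ a) x y (cov b z) = cov b z
    post (pop _ a) x y free = free
    post (pop _ a) x y (top b z) = free
    -- A true `y` comes from the nearest cell on the right: it is being popped, and had been placed
    -- beside a cell then on top. The covered cell is on top again.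
    post (pop _ a) x y (cov b z) = if y then top b z else cov b z
    post (peek _ a) x y σ = σ

    Ok? : DecidableEquality Sym → ∀ {L} (op : Op L Sym) x y σ → Dec (Ok op x y σ)
    Ok? _≟ˢ_ op x y σ = ok op
      where
      reads : ∀ a σ → Dec (Reads a σ)
      reads a (top b _) = b ≟ˢ a
      reads a free = yes tt
      reads a (cov _ _) = yes tt
      ok : ∀ {L} (op : Op L Sym) → Dec (Ok op x y σ)
      ok (push _ a) = y Data.Bool.≟ isTop σ
      ok (pop _ a) = (x Data.Bool.≟ sig y σ) ×-dec reads a σ
      ok (peek _ a) = reads a σ

    data IsCell : Cell Sym → Bool → Set where
      top : ∀ {a b} → IsCell (top a b) b
      cov : ∀ {a b} → IsCell (cov a b) b

    -- Heights count from the bottom of the known part, starting with 1, so that later pushes and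
    -- pops leave them valid.
    data At : List Sym → ℕ → Sym → Set where
      here  : ∀ {a s} → At (a ∷ s) (suc (length s)) a
      there : ∀ {b s h a} → At s h a → At (b ∷ s) h a

    at-bound : ∀ {s h a} → At s h a → h ≤ length s
    at-bound here = ≤-refl
    at-bound (there p) = m≤n⇒m≤1+n (at-bound p)

    at-lower : ∀ {b s h a} → At (b ∷ s) h a → h ≤ length s → At s h a
    at-lower here le = ⊥-elim (<-irrefl refl le)
    at-lower (there p) _ = p

    data Rel (s : List Sym) : Cell Sym × ℕ → Set where
      free : ∀ {h} → Rel s (free , h)
      top  : ∀ {a b h} → h ≡ length s → At s h a → Rel s (top a b , h)
      cov  : ∀ {a b h} → h < length s → At s h a → Rel s (cov a b , h)

    rel-bound : ∀ {s σ h b} → Rel s (σ , h) → IsCell σ b → h ≤ length s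
    rel-bound (top _ p) _ = at-bound p
    rel-bound (cov _ p) _ = at-bound p

    -- A row lists its cells with their heights in the stack, which the tiles themselves do not know.
    Row : Set
    Row = List (Cell Sym × ℕ)

    -- Cells higher than `K` are passed over, as they will have been freed when the stack has shrunk
    -- to height `K`. A free tile carries a meaningless height, so either `high` or `skip` may pass
    -- it.
    data First (K : ℕ) : Row → ℕ → Bool → Set where
      hit  : ∀ {σ h b L} → IsCell σ b → h ≤ K → First K ((σ , h) ∷ L) h b
      high : ∀ {σ h L h′ b′} → K < h → First K L h′ b′ → First K ((σ , h) ∷ L) h′ b′
      skip : ∀ {h L h′ b′} → First K L h′ b′ → First K ((free , h) ∷ L) h′ b′

    -- Why one bit per cell suffices: once the stack has been popped down to height K, the cell on the right of the given
    -- one is the first of height at most K, and its bit tells whether it directly covers the given one.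
    Good : ℕ → Row → Set
    Good H [] = ⊤
    Good H ((σ , h) ∷ L) =
      (∀ {b K} → IsCell σ b → h < K → K ≤ H → ∃₂ λ h′ b′ → First K L h′ b′ × h < h′ × b′ ≡ (h′ ≡ᵇ suc h)) × Good H L

    -- With this, a push always creates a new cell immediately to the right of each old one, and the
    -- bit of the new cell speaks about that old cell. Rows keep the property because each tile has
    -- a free child to the right of its heir.
    Apart : Row → Set
    Apart [] = ⊤
    Apart ((σ , h) ∷ L) = (∀ {b} → IsCell σ b → ∃₂ λ h′ L′ → L ≡ (free , h′) ∷ L′) × Apart L

    record Inv (s : List Sym) (L : Row) : Set where
      constructor inv
      field
        rel  : All (Rel s) L
        good : Good (length s) L
        full : ∀ {h a} → At s h a → Any (λ (σ , h′) → h′ ≡ h × ∃ λ b → IsCell σ b) L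
    open Inv public

    HasFree : Row → Set
    HasFree = Any (λ (σ , _) → σ ≡ free)

    Item : Set
    Item = (Cell Sym × ℕ) × Bool × Bool

    row : List Item → Row
    row = map proj₁

    Wired : List Item → Set
    Wired [] = ⊤
    Wired (_ ∷ []) = ⊤
    Wired ((_ , _ , y) ∷ i@(_ , x , _) ∷ is) = y ≡ x × Wired (i ∷ is)

    next : ∀ {L} → Op L Sym → ℕ → Item → Cell Sym × ℕ
    next op@(push _ _) H ((free , h) , x , y) = post op x y free , suc H
    next op H ((σ , h) , x , y) = post op x y σ , h

    OkItem : ∀ {L} → Op L Sym → Item → Set
    OkItem op ((σ , _) , x , y) = Ok op x y σ

    ≡ᵇ-refl : ∀ n → (n ≡ᵇ n) ≡ true
    ≡ᵇ-refl zero = refl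
    ≡ᵇ-refl (suc n) = ≡ᵇ-refl n

    <⇒≢ᵇ : ∀ {m n} → m < n → (n ≡ᵇ m) ≡ false
    <⇒≢ᵇ {zero} (s≤s _) = refl
    <⇒≢ᵇ {suc m} (s≤s lt) = <⇒≢ᵇ lt

    <⇒≢ᵇ′ : ∀ {m n} → m < n → (m ≡ᵇ n) ≡ false
    <⇒≢ᵇ′ {zero} (s≤s _) = refl
    <⇒≢ᵇ′ {suc m} (s≤s lt) = <⇒≢ᵇ′ lt

    first-bound : ∀ {K L h b} → First K L h b → h ≤ K
    first-bound (hit _ le) = le
    first-bound (high _ f) = first-bound f
    first-bound (skip f) = first-bound f

    tail-wired : ∀ i is → Wired (i ∷ is) → Wired is
    tail-wired i [] w = tt
    tail-wired i (_ ∷ is) (_ , w) = w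

    module _ {L} (l : Fin L) (a : Sym) where
      rel-push : ∀ {s} is → All (Rel s) (row is) → All (Rel (a ∷ s)) (map (next (push l a) (length s)) is)
      rel-push [] [] = []
      rel-push (((free , h) , x , y) ∷ is) (_ ∷ rs) = top refl here ∷ rel-push is rs
      rel-push (((top b z , h) , x , y) ∷ is) (top eq p ∷ rs) = cov (s≤s (≤-reflexive eq)) (there p) ∷ rel-push is rs
      rel-push (((cov b z , h) , x , y) ∷ is) (cov lt p ∷ rs) = cov (m<n⇒m<1+n lt) (there p) ∷ rel-push is rs

      first-push : ∀ {K H h b} is → K ≤ H → First K (row is) h b → First K (map (next (push l a) H) is) h b
      first-push (((top _ _ , h) , x , y) ∷ is) le (hit top p) = hit cov p
      first-push (((cov _ _ , h) , x , y) ∷ is) le (hit cov p) = hit cov p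
      first-push (((free , h) , x , y) ∷ is) le (high p f) = high (s≤s le) (first-push is le f)
      first-push (((top _ _ , h) , x , y) ∷ is) le (high p f) = high p (first-push is le f)
      first-push (((cov _ _ , h) , x , y) ∷ is) le (high p f) = high p (first-push is le f)
      first-push (((free , h) , x , y) ∷ is) le (skip f) = high (s≤s le) (first-push is le f)

      -- Only `K = suc (length s)` is new. For it the first cell is the adjacent tile, free before
      -- by `Apart`, and by the wiring its bit tells whether the given cell was on top, that is
      -- whether the heights differ by one. New cells have the greatest height, so nothing is
      -- required of them.
      good-push : ∀ {s} is → Wired is → All (OkItem (push l a)) is → All (Rel s) (row is) → Apart (row is) →
                  Good (length s) (row is) → Good (suc (length s)) (map (next (push l a) (length s)) is)
      good-push [] _ _ _ _ _ = tt
      good-push {s} (i@((free , h) , x , y) ∷ is) w (_ ∷ oks) (_ ∷ rs) (_ , ap) (_ , g) =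
        (λ _ lt le → ⊥-elim (<⇒≱ lt le)) , good-push is (tail-wired i is w) oks rs ap g
      good-push {s} (i@((σ@(top c z) , h) , x , y) ∷ is) w (ok ∷ oks) (top refl p ∷ rs) (f , ap) (gd , g) =
        new is w (f top) , good-push is (tail-wired i is w) oks rs ap g
        where
        new : ∀ is → Wired (i ∷ is) → (∃₂ λ h′ L′ → row is ≡ (free , h′) ∷ L′) → ∀ {b K} → IsCell (cov c z) b →
              length s < K → K ≤ suc (length s) →
              ∃₂ λ h′ b′ → First K (map (next (push l a) (length s)) is) h′ b′ × length s < h′ × b′ ≡ (h′ ≡ᵇ suc (length s))
        new (((free , h′) , x′ , y′) ∷ is) (yx , _) (_ , _ , refl) _ lt le =
          suc (length s) , x′ , hit top lt , ≤-refl , trans (sym yx) (trans ok (sym (≡ᵇ-refl (suc (length s)))))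
      good-push {s} (i@((σ@(cov c z) , h) , x , y) ∷ is) w (ok ∷ oks) (cov h<H p ∷ rs) (f , ap) (gd , g) =
        (λ {b} {K} _ → new is w (f cov) gd) , good-push is (tail-wired i is w) oks rs ap g
        where
        new : ∀ is → Wired (i ∷ is) → (∃₂ λ h′ L′ → row is ≡ (free , h′) ∷ L′) →
              (∀ {b K} → IsCell σ b → h < K → K ≤ length s → ∃₂ λ h′ b′ → First K (row is) h′ b′ × h < h′ × b′ ≡ (h′ ≡ᵇ suc h)) →
              ∀ {K} → h < K → K ≤ suc (length s) →
              ∃₂ λ h′ b′ → First K (map (next (push l a) (length s)) is) h′ b′ × h < h′ × b′ ≡ (h′ ≡ᵇ suc h)
        new is w fr gd {K} lt le with m≤n⇒m<n∨m≡n le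
        new is w fr gd lt le | inj₁ (s≤s le′) with gd cov lt le′
        ... | h′ , b′ , first , lt′ , eq = h′ , b′ , first-push is le′ first , lt′ , eq
        new (((free , h′) , x′ , y′) ∷ is) (yx , _) (_ , _ , refl) gd lt le | inj₂ refl =
          suc (length s) , x′ , hit top ≤-refl , m<n⇒m<1+n h<H , trans (sym yx) (trans ok (sym (<⇒≢ᵇ h<H)))

      full-push-new : ∀ {H} is → HasFree (row is) → Any (λ (σ , h′) → h′ ≡ suc H × ∃ λ b → IsCell σ b) (map (next (push l a) H) is)
      full-push-new (((free , h) , x , y) ∷ is) _ = here (refl , -, top)
      full-push-new (((top _ _ , h) , x , y) ∷ is) (there p) = there (full-push-new is p)
      full-push-new (((cov _ _ , h) , x , y) ∷ is) (there p) = there (full-push-new is p)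

      full-push-old : ∀ {H k} is → Any (λ (σ , h′) → h′ ≡ k × ∃ λ b → IsCell σ b) (row is) →
                      Any (λ (σ , h′) → h′ ≡ k × ∃ λ b → IsCell σ b) (map (next (push l a) H) is)
      full-push-old (((top _ _ , h) , x , y) ∷ is) (here (eq , _)) = here (eq , -, cov)
      full-push-old (((cov _ _ , h) , x , y) ∷ is) (here (eq , _)) = here (eq , -, cov)
      full-push-old (((free , h) , x , y) ∷ is) (here (eq , _ , ()))
      full-push-old (_ ∷ is) (there p) = there (full-push-old is p)

      inv-push : ∀ {s} is → Wired is → All (OkItem (push l a)) is → Apart (row is) → HasFree (row is) →
                 Inv s (row is) → Inv (a ∷ s) (map (next (push l a) (length s)) is)
      inv-push {s} is w oks ap hf (inv r g f) = inv (rel-push is r) (good-push is w oks r ap g) full′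
        where
        full′ : ∀ {h b} → At (a ∷ s) h b → _
        full′ here = full-push-new is hf
        full′ (there p) = full-push-old is (f p)

      -- No cell is higher than the stack, so `First (length s)` is just the nearest cell. Free
      -- tiles pass the signal on, and that cell sends its bit if it is being popped and `false`
      -- otherwise.
      signal : ∀ {s σ₀ x₀ y₀ h b} is → Wired ((σ₀ , x₀ , y₀) ∷ is) → All (OkItem (pop l a)) is → All (Rel s) (row is) →
               First (length s) (row is) h b → y₀ ≡ (if h ≡ᵇ length s then b else false)
      signal (((top c z , h) , x , y) ∷ is) (refl , _) ((ok , _) ∷ _) (top refl _ ∷ _) (hit top _) =
        trans ok (cong (if_then z else false) (sym (≡ᵇ-refl h)))
      signal (((cov c z , h) , x , y) ∷ is) (refl , _) ((ok , _) ∷ _) (cov lt _ ∷ _) (hit cov _) =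
        trans ok (cong (if_then z else false) (sym (<⇒≢ᵇ′ lt)))
      signal (((free , h) , x , y) ∷ is) (refl , w) ((ok , _) ∷ oks) (_ ∷ rs) (skip f) =
        trans ok (signal is w oks rs f)
      signal (((free , h) , x , y) ∷ is) (refl , w) ((ok , _) ∷ oks) (_ ∷ rs) (high _ f) =
        trans ok (signal is w oks rs f)
      signal (((top c z , h) , x , y) ∷ is) (refl , w) _ (top eq _ ∷ _) (high lt f) = ⊥-elim (<-irrefl (sym eq) lt)
      signal (((cov c z , h) , x , y) ∷ is) (refl , w) _ (cov h<H _ ∷ _) (high lt f) = ⊥-elim (<-asym lt h<H)

      rel-pop : ∀ {c s} is → Wired is → All (OkItem (pop l a)) is → All (Rel (c ∷ s)) (row is) → Good (suc (length s)) (row is) →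
                All (Rel s) (map (next (pop l a) (suc (length s))) is)
      rel-pop [] _ _ _ _ = []
      rel-pop (i@((free , h) , x , y) ∷ is) w (_ ∷ oks) (_ ∷ rs) (_ , g) = free ∷ rel-pop is (tail-wired i is w) oks rs g
      rel-pop (i@((top b z , h) , x , y) ∷ is) w (_ ∷ oks) (_ ∷ rs) (_ , g) = free ∷ rel-pop is (tail-wired i is w) oks rs g
      rel-pop {c} {s} (i@((cov b z , h) , x , y) ∷ is) w (_ ∷ oks) (cov lt p ∷ rs) (gd , g) with gd cov lt ≤-refl
      ... | h′ , b′ , first , h<h′ , b≡ = here′ y (signal is w oks rs first) ∷ rel-pop is (tail-wired i is w) oks rs g
        where
        here′ : ∀ y → y ≡ (if h′ ≡ᵇ suc (length s) then b′ else false) → Rel s ((if y then top b z else cov b z) , h)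
        -- If the nearest cell of height `h′` stays, then `h < h′` keeps the given cell covered. If
        -- it is popped, its bit says whether `h` is exactly one less, that is the new top.
        here′ y eq with m≤n⇒m<n∨m≡n (first-bound first)
        here′ y eq | inj₁ h′<H rewrite <⇒≢ᵇ′ h′<H | eq = cov (<-≤-trans h<h′ (s≤s⁻¹ h′<H)) (at-lower p (s≤s⁻¹ lt))
        here′ y eq | inj₂ refl rewrite ≡ᵇ-refl (length s) | eq | b≡ with m≤n⇒m<n∨m≡n (s≤s⁻¹ lt)
        ... | inj₁ h<s rewrite <⇒≢ᵇ h<s = cov h<s (at-lower p (s≤s⁻¹ lt))
        ... | inj₂ refl rewrite ≡ᵇ-refl h = top refl (at-lower p ≤-refl)

      cov-or-top : ∀ b {c : Sym} {z} → IsCell (if b then top c z else cov c z) z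
      cov-or-top true = top
      cov-or-top false = cov

      first-pop : ∀ {K c s h b} is → K ≤ length s → All (Rel (c ∷ s)) (row is) → First K (row is) h b →
                  First K (map (next (pop l a) (suc (length s))) is) h b
      first-pop (((top _ _ , h) , x , y) ∷ is) le (top refl _ ∷ rs) (hit top p) = ⊥-elim (<⇒≱ ≤-refl (≤-trans p le))
      first-pop (((cov _ _ , h) , x , y) ∷ is) le (_ ∷ rs) (hit cov p) = hit (cov-or-top y) p
      first-pop (((free , h) , x , y) ∷ is) le (_ ∷ rs) (high p f) = high p (first-pop is le rs f)
      first-pop (((top _ _ , h) , x , y) ∷ is) le (_ ∷ rs) (high p f) = high p (first-pop is le rs f)
      first-pop (((cov _ _ , h) , x , y) ∷ is) le (_ ∷ rs) (high p f) = high p (first-pop is le rs f)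
      first-pop (((free , h) , x , y) ∷ is) le (_ ∷ rs) (skip f) = skip (first-pop is le rs f)

      good-pop : ∀ {c s} is → All (Rel (c ∷ s)) (row is) → Good (suc (length s)) (row is) →
                 Good (length s) (map (next (pop l a) (suc (length s))) is)
      good-pop [] _ _ = tt
      good-pop (((free , h) , x , y) ∷ is) (_ ∷ rs) (_ , g) = (λ ()) , good-pop is rs g
      good-pop (((top _ _ , h) , x , y) ∷ is) (_ ∷ rs) (_ , g) = (λ ()) , good-pop is rs g
      good-pop {c} {s} (((cov d z , h) , x , y) ∷ is) (_ ∷ rs) (gd , g) = (λ _ → old) , good-pop is rs g
        where
        old : ∀ {K} → h < K → K ≤ length s → _
        old lt le with gd cov lt (m≤n⇒m≤1+n le)
        ... | h′ , b′ , first , rest = h′ , b′ , first-pop is le rs first , rest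

      full-pop : ∀ {c s k} is → All (Rel (c ∷ s)) (row is) → k ≤ length s →
                 Any (λ (σ , h′) → h′ ≡ k × ∃ λ b → IsCell σ b) (row is) →
                 Any (λ (σ , h′) → h′ ≡ k × ∃ λ b → IsCell σ b) (map (next (pop l a) (suc (length s))) is)
      full-pop (((top _ _ , h) , x , y) ∷ is) (top refl _ ∷ _) le (here (refl , _)) = ⊥-elim (<-irrefl refl le)
      full-pop (((cov _ _ , h) , x , y) ∷ is) _ le (here (eq , _)) = here (eq , -, cov-or-top y)
      full-pop (((free , h) , x , y) ∷ is) _ le (here (_ , _ , ()))
      full-pop (_ ∷ is) (_ ∷ rs) le (there p) = there (full-pop is rs le p)

      inv-pop : ∀ {c s} is → Wired is → All (OkItem (pop l a)) is → Inv (c ∷ s) (row is) →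
                Inv s (map (next (pop l a) (suc (length s))) is)
      inv-pop is w oks (inv r g f) =
        inv (rel-pop is w oks r g) (good-pop is r g) (λ p → full-pop is r (at-bound p) (f (there p)))

      inv-pop∅ : ∀ is → Inv [] (row is) → Inv [] (map (next (pop l a) 0) is)
      inv-pop∅ is (inv r _ _) = inv (rels is r) (goods is r) (λ ())
        where
        rels : ∀ is → All (Rel []) (row is) → All (Rel []) (map (next (pop l a) 0) is)
        rels [] [] = []
        rels (((free , h) , x , y) ∷ is) (_ ∷ rs) = free ∷ rels is rs
        rels (((top _ _ , h) , x , y) ∷ is) (top _ () ∷ rs)
        rels (((cov _ _ , h) , x , y) ∷ is) (cov () _ ∷ rs)
        goods : ∀ is → All (Rel []) (row is) → Good 0 (map (next (pop l a) 0) is)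
        goods [] _ = tt
        goods (((free , h) , x , y) ∷ is) (_ ∷ rs) = (λ ()) , goods is rs
        goods (((top _ _ , h) , x , y) ∷ is) (top _ () ∷ rs)
        goods (((cov _ _ , h) , x , y) ∷ is) (cov () _ ∷ rs)

      peek-same : ∀ H is → map (next (peek l a) H) is ≡ row is
      peek-same H [] = refl
      peek-same H (((free , _) , _) ∷ is) = cong (_ ∷_) (peek-same H is)
      peek-same H (((top _ _ , _) , _) ∷ is) = cong (_ ∷_) (peek-same H is)
      peek-same H (((cov _ _ , _) , _) ∷ is) = cong (_ ∷_) (peek-same H is)

    inv-step : ∀ {L} (op : Op L Sym) {s s′} is → Act op s s′ → Wired is → All (OkItem op) is → Apart (row is) → HasFree (row is) →
               Inv s (row is) → Inv s′ (map (next op (length s)) is)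
    inv-step (push l a) is push w oks ap hf i = inv-push l a is w oks ap hf i
    inv-step (pop l a) is pop w oks ap hf i = inv-pop l a is w oks i
    inv-step (pop l a) is pop∅ w oks ap hf i = inv-pop∅ l a is i
    inv-step (peek l a) {s} is peek w oks ap hf i = subst (Inv s) (sym (peek-same l a (length s) is)) i
    inv-step (peek l a) is peek∅ w oks ap hf i = subst (Inv []) (sym (peek-same l a 0 is)) i

    reads-act : ∀ {L} {l : Fin L} {a s s′ σ h} → Act (pop l a) s s′ ⊎ Act (peek l a) s s′ → Rel s (σ , h) → Reads a σ
    reads-act _ free = tt
    reads-act _ (cov _ _) = tt
    reads-act (inj₁ pop) (top _ here) = refl
    reads-act (inj₁ pop) (top refl (there p)) = ⊥-elim (<⇒≱ ≤-refl (at-bound p))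
    reads-act (inj₂ peek) (top _ here) = refl
    reads-act (inj₂ peek) (top refl (there p)) = ⊥-elim (<⇒≱ ≤-refl (at-bound p))

    top-read : ∀ {c s a} is → (∀ {x y σ} → Any (λ i → i ≡ (σ , x , y)) is → Reads a (proj₁ σ)) → Inv (c ∷ s) (row is) → c ≡ a
    top-read {c} {s} {a} is rd (inv r _ f) = go is rd r (f here)
      where
      go : ∀ is → (∀ {x y σ} → Any (λ i → i ≡ (σ , x , y)) is → Reads a (proj₁ σ)) → All (Rel (c ∷ s)) (row is) →
           Any (λ (σ , h′) → h′ ≡ suc (length s) × ∃ λ b → IsCell σ b) (row is) → c ≡ a
      go (((top _ _ , _) , _) ∷ is) rd (top _ here ∷ _) (here _) = rd (here refl)
      go (((top _ _ , _) , _) ∷ is) rd (top _ (there p) ∷ _) (here (refl , _)) = ⊥-elim (<⇒≱ ≤-refl (at-bound p))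
      go (((cov _ _ , _) , _) ∷ is) rd (cov lt _ ∷ _) (here (refl , _)) = ⊥-elim (<-irrefl refl lt)
      go (((free , _) , _) ∷ is) rd _ (here (_ , _ , ()))
      go (_ ∷ is) rd (_ ∷ rs) (there p) = go is (λ q → rd (there q)) rs p

    -- The tiles only ensure that every cell on top holds the symbol being read. By `full` a known
    -- top symbol is held by at least one cell, so it has to be that symbol; nothing can go wrong
    -- below the known part.
    act-exists : ∀ {L} (op : Op L Sym) s is → All (OkItem op) is → Inv s (row is) → ∃ (Act op s)
    act-exists (push l a) s is oks i = -, push
    act-exists (pop l a) [] is oks i = -, pop∅
    act-exists (pop l a) (c ∷ s) is oks i
      with top-read is (λ q → proj₂ (All.lookup oks (Any.map sym q))) i
    ... | refl = -, pop
    act-exists (peek l a) [] is oks i = -, peek∅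
    act-exists (peek l a) (c ∷ s) is oks i with top-read is (λ q → All.lookup oks (Any.map sym q)) i
    ... | refl = -, peek

    -- The passage to the row of children: the heir, then at least one free tile. This single free
    -- tile restores both `Apart` and `HasFree`.
    data Expand : Row → Row → Set where
      []  : Expand [] []
      put : ∀ {x h fs L L′} → All (λ (σ , _) → σ ≡ free) fs → Expand L L′ → Expand (x ∷ L) (x ∷ (free , h) ∷ fs ++ L′)

    first-frees : ∀ {K fs L h b} → All (λ (σ , _) → σ ≡ free) fs → First K L h b → First K (fs ++ L) h b
    first-frees [] f = f
    first-frees (refl ∷ ps) f = skip (first-frees ps f)

    good-frees : ∀ {H fs L} → All (λ (σ , _) → σ ≡ free) fs → Good H L → Good H (fs ++ L)
    good-frees [] g = g
    good-frees (refl ∷ ps) g = (λ ()) , good-frees ps g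

    apart-frees : ∀ {fs L} → All (λ (σ , _) → σ ≡ free) fs → Apart L → Apart (fs ++ L)
    apart-frees [] g = g
    apart-frees (refl ∷ ps) g = (λ ()) , apart-frees ps g

    first-expand : ∀ {K L L′ h b} → Expand L L′ → First K L h b → First K L′ h b
    first-expand (put ps e) (hit c le) = hit c le
    first-expand (put ps e) (high lt f) = high lt (skip (first-frees ps (first-expand e f)))
    first-expand (put ps e) (skip f) = skip (skip (first-frees ps (first-expand e f)))

    good-expand : ∀ {H L L′} → Expand L L′ → Good H L → Good H L′
    good-expand [] g = tt
    good-expand (put {x = σ , h} ps e) (gd , g) = old , (λ ()) , good-frees ps (good-expand e g)
      where
      old : ∀ {b K} → IsCell σ b → h < K → K ≤ _ → _
      old c lt le with gd c lt le
      ... | h′ , b′ , first , rest = h′ , b′ , skip (first-frees ps (first-expand e first)) , rest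

    inv-expand : ∀ {s L L′} → Expand L L′ → Inv s L → Inv s L′
    inv-expand e (inv r g f) = inv (rels e r) (good-expand e g) (λ p → fulls e (f p))
      where
      rels : ∀ {s L L′} → Expand L L′ → All (Rel s) L → All (Rel s) L′
      rels [] [] = []
      rels (put ps e) (r ∷ rs) = r ∷ free ∷ All.++⁺ (All.map (λ { refl → free }) ps) (rels e rs)
      fulls : ∀ {P : Cell Sym × ℕ → Set} {L L′} → Expand L L′ → Any P L → Any P L′
      fulls (put ps e) (here p) = here p
      fulls (put {fs = fs} ps e) (there p) = there (there (Any.++⁺ʳ fs (fulls e p)))

    apart-expand : ∀ {L L′} → Expand L L′ → Apart L′
    apart-expand [] = tt
    apart-expand (put ps e) = (λ _ → -, -, refl) , (λ ()) , apart-frees ps (apart-expand e)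

    free-expand : ∀ {x L L′} → Expand (x ∷ L) L′ → HasFree L′
    free-expand (put ps e) = there (here refl)

-- Local colours that force the rows of the heptagrid.

module Heptagons where
  open import Data.Nat using (ℕ; zero; suc; _+_; _*_; _≡ᵇ_)
  open import Data.Nat.Properties using (≡⇒≡ᵇ)
  open import Data.Nat.DivMod using (_mod_)
  open import Data.Bool using (Bool; true; false; not; if_then_else_; _∧_; _∨_; T)
  open import Data.Bool.Properties using (T-∧; T-∨)
  open import Data.Fin using (Fin; zero; suc; toℕ)
  import Data.Fin as Finₚ
  open import Data.Fin.Properties using (all?)
  open import Data.Fin.Patterns
  open import Data.Vec using (Vec; []; _∷_; lookup)
  open import Data.Bool.ListAction using (any; all)
  open import Data.List using (List; []; _∷_; allFin)
  import Data.List as L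
  open import Data.List.Membership.Propositional using (_∈_)
  open import Data.List.Membership.Propositional.Properties using (∈-allFin; ∈-cartesianProductWith⁺)
  open import Data.List.Relation.Unary.Any using (here; there)
  open import Data.Product using (_×_; _,_; proj₁; proj₂)
  open import Data.Sum using (inj₁; inj₂)
  open import Data.Unit using (tt)
  open import Function.Bundles using (Equivalence)
  open import Relation.Binary.PropositionalEquality
  open import Relation.Nullary using (Dec; yes; no; does)
  open import Relation.Nullary.Decidable using (from-yes)

  data DownKind : Set where
    m n lW lB kW kB : DownKind

  data HorKind : Set where
    hi hj hb h₀ : HorKind

  data Parents : Set where
    WW WB BW : Parents

  -- Rows of the tiling consist of W- and B-tiles.  A W-tile has one neighbour in the row above and four in the row
  -- below, a B-tile has two above and three below.  The Boolean is the parity of the row, and b P Q has the parents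
  -- P and Q from left to right.  The tile v only occurs in a topmost row.
  data Shape : Set where
    wf wm wn : Bool → Shape
    b        : Parents → Bool → Shape
    v        : Shape

  succ neg : Fin 7 → Fin 7
  succ 0F = 1F
  succ 1F = 2F
  succ 2F = 3F
  succ 3F = 4F
  succ 4F = 5F
  succ 5F = 6F
  succ 6F = 0F
  neg 0F = 0F
  neg 1F = 6F
  neg 2F = 5F
  neg 3F = 4F
  neg 4F = 3F
  neg 5F = 2F
  neg 6F = 1F

  turned : ℕ → Fin 7 → Fin 7
  turned zero k = k
  turned (suc i) k = succ (turned i k)

  -- The side of a prototile that is i steps after side k, for either orientation.
  rot : Bool → Fin 7 → Fin 7 → Fin 7
  rot true  k i = turned (toℕ i) k
  rot false k i = turned (toℕ (neg i)) k

  prev : Fin 7 → Fin 7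
  prev = turned 6

  abstract
    rot-true : ∀ k i → rot true k i ≡ (toℕ k + toℕ i) mod 7
    rot-true = from-yes (all? λ k → all? λ i → rot true k i Finₚ.≟ (toℕ k + toℕ i) mod 7)

    rot-false : ∀ k i → rot false k i ≡ (toℕ k + 6 * toℕ i) mod 7
    rot-false = from-yes (all? λ k → all? λ i → rot false k i Finₚ.≟ (toℕ k + 6 * toℕ i) mod 7)

  module Kinds where
    par : Bool → ℕ → ℕ
    par p k = if p then suc k else k

    downKind : DownKind → ℕ
    downKind m = 0
    downKind n = 2
    downKind lW = 4
    downKind lB = 6
    downKind kW = 8
    downKind kB = 10

    horKind : HorKind → ℕ
    horKind hi = 14
    horKind hj = 16
    horKind hb = 18
    horKind h₀ = 20

    lKind kKind : Parents → DownKind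
    lKind WW = lW
    lKind WB = lW
    lKind BW = lB
    kKind WW = kW
    kKind WB = kB
    kKind BW = kW

    -- To the left of a last child stands the middle child of its left parent, or the first child if
    -- that parent is a B-tile and has no middle one.
    lastLeft : Parents → HorKind
    lastLeft BW = hi
    lastLeft _ = hj

    D H : Bool → _ → ℕ
    D p k = par p (downKind k)
    H p k = par p (horKind k)

    F : Bool → ℕ
    F p = par p 12

    -- For W- and B-tiles the order is: sides leading up, right side, sides leading down from right
    -- to left, left side. Side 5 leads to the last child of the left neighbour, a B-tile with two
    -- parents.
    kinds : Shape → Vec ℕ 7
    kinds (wf p) = F (not p)   ∷ H p hi ∷ D p lW ∷ D p m ∷ F p ∷ D p kW ∷ H p hb ∷ []
    kinds (wm p) = D (not p) m ∷ H p hj ∷ D p lW ∷ D p m ∷ F p ∷ D p kW ∷ H p hi ∷ []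
    kinds (wn p) = D (not p) n ∷ H p hi ∷ D p lW ∷ D p m ∷ F p ∷ D p kW ∷ H p hi ∷ []
    kinds (b P p) = D (not p) (lKind P) ∷ D (not p) (kKind P) ∷ H p hb ∷ D p lB ∷ F p ∷ D p kB ∷ H p (lastLeft P) ∷ []
    kinds v = H false h₀ ∷ D false lW ∷ D false m ∷ D false n ∷ F false ∷ D false kW ∷ H false h₀ ∷ []

  open Kinds

  shapes : List Shape
  shapes = wf false ∷ wm false ∷ wn false ∷ b WW false ∷ b WB false ∷ b BW false ∷ v ∷
           wf true ∷ wm true ∷ wn true ∷ b WW true ∷ b WB true ∷ b BW true ∷ []

  shapes-complete : ∀ s → s ∈ shapes
  shapes-complete (wf false) = here refl
  shapes-complete (wm false) = there (here refl)
  shapes-complete (wn false) = there (there (here refl))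
  shapes-complete (b WW false) = there (there (there (here refl)))
  shapes-complete (b WB false) = there (there (there (there (here refl))))
  shapes-complete (b BW false) = there (there (there (there (there (here refl)))))
  shapes-complete v = there (there (there (there (there (there (here refl))))))
  shapes-complete (wf true) = there (there (there (there (there (there (there (here refl)))))))
  shapes-complete (wm true) = there (there (there (there (there (there (there (there (here refl))))))))
  shapes-complete (wn true) = there (there (there (there (there (there (there (there (there (here refl)))))))))
  shapes-complete (b WW true) = there (there (there (there (there (there (there (there (there (there (here refl))))))))))
  shapes-complete (b WB true) = there (there (there (there (there (there (there (there (there (there (there (here refl)))))))))))
  shapes-complete (b BW true) = there (there (there (there (there (there (there (there (there (there (there (there (here refl))))))))))))

  bools : List Bool
  bools = true ∷ false ∷ []

  bools-complete : ∀ x → x ∈ bools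
  bools-complete true = here refl
  bools-complete false = there (here refl)

  placements : List (Shape × Fin 7 × Bool)
  placements = L.cartesianProduct shapes (L.cartesianProduct (allFin 7) bools)

  placements-complete : ∀ x → x ∈ placements
  placements-complete (s , k , o) = ∈-cartesianProductWith⁺ _,_ (shapes-complete s) (∈-cartesianProductWith⁺ _,_ (∈-allFin k) (bools-complete o))

  at : Shape × Fin 7 × Bool → Fin 7 → ℕ
  at (s , k , o) i = lookup (kinds s) (rot o k i)

  any-true : ∀ {A : Set} (f : A → Bool) {x xs} → x ∈ xs → T (f x) → T (any f xs)
  any-true f (here refl) t = Equivalence.from T-∨ (inj₁ t)
  any-true f {xs = y ∷ ys} (there p) t = Equivalence.from (T-∨ {f y}) (inj₂ (any-true f p t))

  all-true : ∀ {A : Set} (f : A → Bool) {x xs} → x ∈ xs → T (all f xs) → T (f x)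
  all-true f (here refl) t = proj₁ (Equivalence.to T-∧ t)
  all-true f {xs = y ∷ ys} (there p) t = all-true f p (proj₂ (Equivalence.to (T-∧ {f y}) t))

  data Side : Set where
    sf sm sl : Side

  pos : Shape → Side → Fin 7
  pos (b _ _) sl = 3F
  pos v sm = 2F
  pos v sl = 1F
  pos _ sf = 4F
  pos _ sm = 3F
  pos _ sl = 2F

  -- The sides of a tile to be crossed towards its children fst, mid, lst.
  own : Shape → List Side
  own (b _ _) = sf ∷ sl ∷ []
  own _ = sf ∷ sm ∷ sl ∷ []

  data Child : Side → Shape → Set where
    fst : ∀ {p} → Child sf (wf p)
    mid : ∀ {p} → Child sm (wm p)
    lst : ∀ {P p} → Child sl (b P p)

  child? : ∀ e s → Dec (Child e s)
  child? sf (wf _) = yes fst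
  child? sm (wm _) = yes mid
  child? sl (b _ _) = yes lst
  child? sf (wm _) = no λ ()
  child? sf (wn _) = no λ ()
  child? sf (b _ _) = no λ ()
  child? sf v = no λ ()
  child? sm (wf _) = no λ ()
  child? sm (wn _) = no λ ()
  child? sm (b _ _) = no λ ()
  child? sm v = no λ ()
  child? sl (wf _) = no λ ()
  child? sl (wm _) = no λ ()
  child? sl (wn _) = no λ ()
  child? sl v = no λ ()

  both : ∀ {x y} → T x → T y → T (x ∧ y)
  both {true} _ t = t

  same : ∀ k → T (k ≡ᵇ k)
  same k = ≡⇒≡ᵇ k k refl

  abstract
    -- Three tiles meet at a vertex, and the third must show `k` and `k′` on consecutive sides. The
    -- colour of one side alone would not do: it also fits a reflected child, or the same side of
    -- another parent.
    corner : ℕ → ℕ → Bool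
    corner k k′ = any (λ x → (at x 0F ≡ᵇ k) ∧ (at x 1F ≡ᵇ k′)) placements

    corner-intro : ∀ x {k k′} → at x 0F ≡ k → at x 1F ≡ k′ → T (corner k k′)
    corner-intro x {k} {k′} refl refl = any-true (λ x → (at x 0F ≡ᵇ k) ∧ (at x 1F ≡ᵇ k′)) (placements-complete x) (both {at x 0F ≡ᵇ k} (same k) (same k′))

    fits : Shape → Fin 7 → Shape × Fin 7 × Bool → Bool
    fits s i x = (at x 0F ≡ᵇ lookup (kinds s) i) ∧
      (corner (lookup (kinds s) (succ i)) (at x 6F) ∧ corner (at x 1F) (lookup (kinds s) (prev i)))

    fits-intro : ∀ s i x → at x 0F ≡ lookup (kinds s) i → T (corner (lookup (kinds s) (succ i)) (at x 6F)) →
                 T (corner (at x 1F) (lookup (kinds s) (prev i))) → T (fits s i x)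
    fits-intro s i x e c c′ = both {at x 0F ≡ᵇ lookup (kinds s) i} (≡⇒≡ᵇ _ _ e) (both {corner (lookup (kinds s) (succ i)) (at x 6F)} c c′)

    expected : Side → Shape × Fin 7 × Bool → Bool
    expected e (s , k , o) = does (child? e s) ∧ ((toℕ k ≡ᵇ 0) ∧ o)

    checked : Shape → Side → Shape × Fin 7 × Bool → Bool
    checked s e x = not (fits s (pos s e) x) ∨ expected e x

    -- The colours around the two ends of a side leading down determine the tile below it and its position.
    all-checked : T (all (λ s → all (λ e → all (checked s e) placements) (own s)) shapes)
    all-checked = tt

    crossing : ∀ {s e s′ k o} → e ∈ own s → T (fits s (pos s e) (s′ , k , o)) → Child e s′ × k ≡ 0F × o ≡ true
    crossing {s} {e} {s′} {k} {o} e∈ t = result (apply t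
        (all-true (checked s e) (placements-complete (s′ , k , o))
          (all-true (λ e → all (checked s e) placements) e∈
            (all-true (λ s → all (λ e → all (checked s e) placements) (own s)) (shapes-complete s) all-checked))))
      where
      apply : ∀ {x y} → T x → T (not x ∨ y) → T y
      apply {true} _ t = t
      is-zero : ∀ {k : Fin 7} → T (toℕ k ≡ᵇ 0) → k ≡ 0F
      is-zero {zero} _ = refl
      tt≡ : ∀ {o} → T o → o ≡ true
      tt≡ {true} _ = refl
      result : T (expected e (s′ , k , o)) → Child e s′ × k ≡ 0F × o ≡ true
      result t with child? e s′
      ... | yes c = c , is-zero (proj₁ (Equivalence.to (T-∧ {toℕ k ≡ᵇ 0}) t)) , tt≡ (proj₂ (Equivalence.to (T-∧ {toℕ k ≡ᵇ 0}) t))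

-- The prototiles belonging to a list of transitions.

module Tilesets where
  open import Defs hiding (a; c)
  open import Data.Nat using (ℕ; zero; suc; _+_; _*_)
  open import Data.Nat.DivMod using (_mod_; _%_; %-distribˡ-+; m%n%n≡m%n)
  open import Data.Bool using (Bool; true; false; not)
  open import Data.Fin using (Fin; zero; suc; toℕ)
  open import Data.Fin.Patterns
  open import Data.Fin.Properties using (toℕ-injective; toℕ-fromℕ<; all?)
  open import Data.Vec using (Vec; []; _∷_; lookup; replicate; _[_]≔_)
  import Data.Vec as V
  open import Data.Vec.Properties using (≡-dec)
  open import Data.List using (List; []; _∷_; map; concatMap; cartesianProduct; cartesianProductWith; filter; _++_)
  import Data.List as L
  open import Data.List.Properties using (++-assoc; ++-identityʳ)
  open import Data.List.Membership.Propositional using (_∈_; find; lose)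
  open import Data.List.Membership.Propositional.Properties using (∈-map⁺; ∈-map⁻; ∈-filter⁺; ∈-filter⁻; ∈-cartesianProductWith⁺; ∈-concatMap⁺; ∈-concatMap⁻; ∈-++⁺ˡ; ∈-++⁺ʳ)
  open import Data.List.Relation.Unary.Any using (here; there)
  open import Data.Product using (∃; ∃₂; _×_; _,_; proj₁; proj₂)
  open import Data.Sum using (inj₁; inj₂)
  open import Data.Unit using (⊤; tt)
  open import Relation.Binary.Definitions using (DecidableEquality)
  open import Relation.Binary.PropositionalEquality
  open import Relation.Nullary using (Dec; yes; no)
  open import Relation.Nullary.Decidable using (_×-dec_; from-yes)
  open StackMachines
  open RowInvariant using (Cell; free; top; cov; Ok; Ok?; post)
  open Heptagons

  allVecs : ∀ {A : Set} → List A → ∀ k → List (Vec A k)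
  allVecs xs zero = [] ∷ []
  allVecs xs (suc k) = cartesianProductWith _∷_ xs (allVecs xs k)

  allVecs-complete : ∀ {A : Set} {xs : List A} → (∀ x → x ∈ xs) → ∀ {k} (w : Vec A k) → w ∈ allVecs xs k
  allVecs-complete c [] = here refl
  allVecs-complete c (x ∷ w) = ∈-cartesianProductWith⁺ _∷_ (c x) (allVecs-complete c w)

  module Tiles {L : ℕ} {Sym : Set} (_≟ˢ_ : DecidableEquality Sym) (syms : List Sym) (syms-complete : ∀ a → a ∈ syms) where
    State : Set
    State = Vec (Cell Sym) L

    frees : State
    frees = replicate L free

    cells : List (Cell Sym)
    cells = free ∷ cartesianProductWith top syms bools ++ cartesianProductWith cov syms bools

    cells-complete : ∀ σ → σ ∈ cells
    cells-complete free = here refl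
    cells-complete (top a z) = there (∈-++⁺ˡ (∈-cartesianProductWith⁺ top (syms-complete a) (bools-complete z)))
    cells-complete (cov a z) = there (∈-++⁺ʳ _ (∈-cartesianProductWith⁺ cov (syms-complete a) (bools-complete z)))

    _≟ᶜ_ : DecidableEquality (Cell Sym)
    free ≟ᶜ free = yes refl
    free ≟ᶜ top _ _ = no λ ()
    free ≟ᶜ cov _ _ = no λ ()
    top _ _ ≟ᶜ free = no λ ()
    top a z ≟ᶜ top a′ z′ with a ≟ˢ a′ | z Data.Bool.≟ z′
    ... | yes refl | yes refl = yes refl
    ... | no ne | _ = no λ { refl → ne refl }
    ... | _ | no ne = no λ { refl → ne refl }
    top _ _ ≟ᶜ cov _ _ = no λ ()
    cov _ _ ≟ᶜ free = no λ ()
    cov _ _ ≟ᶜ top _ _ = no λ ()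
    cov a z ≟ᶜ cov a′ z′ with a ≟ˢ a′ | z Data.Bool.≟ z′
    ... | yes refl | yes refl = yes refl
    ... | no ne | _ = no λ { refl → ne refl }
    ... | _ | no ne = no λ { refl → ne refl }

    -- What a side of a tile carries besides a label of the machine.
    data Slot : Set where
      dn  : DownKind → Bool → Slot
      dst : Bool → State → Slot
      hor : HorKind → Bool → Op L Sym → Bool → Slot

    kindOf : Slot → ℕ
    kindOf (dn k p) = Kinds.D p k
    kindOf (dst p _) = Kinds.F p
    kindOf (hor k p _ _) = Kinds.H p k

    after : Op L Sym → Bool → Bool → State → State
    after op x y σ = σ [ layer op ]≔ post op x y (lookup σ (layer op))

    -- Only sides leading up carry the source label; all others carry the target. Neighbours in a
    -- row thus share operation and target, and the sources of a row agree because they are the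
    -- common target of the row above.
    src-of tgt-of : Slot → Bool × Slot
    src-of s = true , s
    tgt-of s = false , s

    rowW : (up : Slot) → HorKind → HorKind → Bool → Op L Sym → State → Bool → Bool → Vec (Bool × Slot) 7
    rowW up r l p op σ x y =
      src-of up ∷ tgt-of (hor r p op y) ∷ tgt-of (dn lW p) ∷ tgt-of (dn m p) ∷ tgt-of (dst p (after op x y σ)) ∷
      tgt-of (dn kW p) ∷ tgt-of (hor l p op x) ∷ []

    scheme : Op L Sym → Shape → State → Bool → Bool → Vec (Bool × Slot) 7
    scheme op (wf p) σ x y = rowW (dst (not p) σ) hi hb p op σ x y
    scheme op (wm p) σ x y = rowW (dn m (not p)) hj hi p op σ x y
    scheme op (wn p) σ x y = rowW (dn n (not p)) hi hi p op σ x y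
    scheme op (b P p) σ x y =
      src-of (dn (Kinds.lKind P) (not p)) ∷ src-of (dn (Kinds.kKind P) (not p)) ∷ tgt-of (hor hb p op y) ∷ tgt-of (dn lB p) ∷
      tgt-of (dst p (after op x y σ)) ∷ tgt-of (dn kB p) ∷ tgt-of (hor (Kinds.lastLeft P) p op x) ∷ []
    scheme op v σ x y =
      tgt-of (hor h₀ false op y) ∷ tgt-of (dn lW false) ∷ tgt-of (dn m false) ∷ tgt-of (dn n false) ∷
      tgt-of (dst false (after op x y σ)) ∷ tgt-of (dn kW false) ∷ tgt-of (hor h₀ false op x) ∷ []

    -- Only the heir `wf` receives a state, through its side leading up. In the tiling built later
    -- `v` is its own neighbour, so its two bits agree there.
    Fits : Shape → State → Bool → Bool → Set
    Fits (wf _) σ x y = ⊤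
    Fits v σ x y = σ ≡ frees × x ≡ y
    Fits _ σ x y = σ ≡ frees

    fits? : ∀ s σ x y → Dec (Fits s σ x y)
    fits? (wf _) σ x y = yes tt
    fits? (wm _) σ x y = ≡-dec _≟ᶜ_ σ frees
    fits? (wn _) σ x y = ≡-dec _≟ᶜ_ σ frees
    fits? (b _ _) σ x y = ≡-dec _≟ᶜ_ σ frees
    fits? v σ x y = ≡-dec _≟ᶜ_ σ frees ×-dec (x Data.Bool.≟ y)

    Datum : Set
    Datum = Shape × State × Bool × Bool

    Valid : Op L Sym → Datum → Set
    Valid op (s , σ , x , y) = Ok op x y (lookup σ (layer op)) × Fits s σ x y

    valid? : ∀ op t → Dec (Valid op t)
    valid? op (s , σ , x , y) = Ok? _≟ˢ_ op x y (lookup σ (layer op)) ×-dec fits? s σ x y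

    data-list : List Datum
    data-list = cartesianProduct shapes (cartesianProduct (allVecs cells L) (cartesianProduct bools bools))

    data-complete : ∀ t → t ∈ data-list
    data-complete (s , σ , x , y) = ∈-cartesianProductWith⁺ _,_ (shapes-complete s)
      (∈-cartesianProductWith⁺ _,_ (allVecs-complete cells-complete σ)
        (∈-cartesianProductWith⁺ _,_ (bools-complete x) (bools-complete y)))

    schemeOf : Op L Sym → Datum → Vec (Bool × Slot) 7
    schemeOf op (s , σ , x , y) = scheme op s σ x y

    schemes : Op L Sym → List (Vec (Bool × Slot) 7)
    schemes op = map (schemeOf op) (filter (valid? op) data-list)

    -- Forgetting everything but the kinds leaves one of 13 shapes whatever the machine is, so the
    -- finite check of the geometry applies to every tile set.
    kinds-scheme : ∀ op t → V.map (λ z → kindOf (proj₂ z)) (schemeOf op t) ≡ Kinds.kinds (proj₁ t)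
    kinds-scheme op (wf _ , _) = refl
    kinds-scheme op (wm _ , _) = refl
    kinds-scheme op (wn _ , _) = refl
    kinds-scheme op (b _ _ , _) = refl
    kinds-scheme op (v , _) = refl

    module Paint {Lab : Set} (colour : Slot → Lab → ℕ)
                 (colour-injective : ∀ {s s′ l l′} → colour s l ≡ colour s′ l′ → s ≡ s′ × l ≡ l′) where
      paint : Lab → Lab → Bool × Slot → ℕ
      paint p q (true , s) = colour s p
      paint p q (false , s) = colour s q

      Δs : Set
      Δs = List (Lab × Op L Sym × Lab)

      tilesOf : Lab × Op L Sym × Lab → List Prototile
      tilesOf (p , op , q) = map (V.map (paint p q)) (schemes op)

      tileset : Δs → List Prototile
      tileset = concatMap tilesOf

      tile : Lab → Op L Sym → Lab → Datum → Prototile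
      tile p op q t = V.map (paint p q) (schemeOf op t)

      ∈-tileset⁻ : ∀ {Δ x} → x ∈ tileset Δ → ∃₂ λ p op → ∃₂ λ q t → (p , op , q) ∈ Δ × Valid op t × x ≡ tile p op q t
      ∈-tileset⁻ {Δ} x∈ with find (∈-concatMap⁻ tilesOf {xs = Δ} x∈)
      ... | (p , op , q) , e∈ , x∈′ with ∈-map⁻ (V.map (paint p q)) x∈′
      ... | sch , sch∈ , refl with ∈-map⁻ (schemeOf op) sch∈
      ... | t , t∈ , refl with ∈-filter⁻ (valid? op) {xs = data-list} t∈
      ... | _ , valid = p , op , q , t , e∈ , valid , refl

      ∈-tileset⁺ : ∀ {Δ p op q t} → (p , op , q) ∈ Δ → Valid op t → tile p op q t ∈ tileset Δ
      ∈-tileset⁺ {Δ} {p} {op} {q} {t} e∈ valid = ∈-concatMap⁺ tilesOf (lose e∈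
        (∈-map⁺ (V.map (paint p q)) (∈-map⁺ (schemeOf op) (∈-filter⁺ (valid? op) (data-complete t) valid))))

  -- Tilings as colourings of abstract darts.

  iter : ∀ {X : Set} → (X → X) → ℕ → X → X
  iter f zero x = x
  iter f (suc i) x = f (iter f i x)

  -- Darts of a coloured tiling, with A turning to the next side of the same tile and C crossing the side.
  record Darts (S : List Prototile) : Set₁ where
    infix 4 _~_
    field
      X     : Set
      _~_   : X → X → Set
      A C   : X → X
      ~refl : ∀ {x} → x ~ x
      ~sym  : ∀ {x y} → x ~ y → y ~ x
      ~trans : ∀ {x y z} → x ~ y → y ~ z → x ~ z
      A-cong : ∀ {x y} → x ~ y → A x ~ A y
      C-cong : ∀ {x y} → x ~ y → C x ~ C y
      A⁷    : ∀ x → iter A 7 x ~ x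
      C²    : ∀ x → C (C x) ~ x
      AC³   : ∀ x → C (A (C (A (C (A x))))) ~ x
      col   : X → ℕ
      col-cong : ∀ {x y} → x ~ y → col x ≡ col y
      col-C : ∀ x → col (C x) ≡ col x
      copy  : ∀ x → ∃ λ p → p ∈ S × ∃₂ λ k o → ∀ i → col (iter A (toℕ i) x) ≡ lookup p (rot o k i)

    A^ : ℕ → X → X
    A^ = iter A

    A^-cong : ∀ i {x y} → x ~ y → A^ i x ~ A^ i y
    A^-cong zero e = e
    A^-cong (suc i) e = A-cong (A^-cong i e)

    A^-+ : ∀ i j x → A^ i (A^ j x) ≡ A^ (i + j) x
    A^-+ zero j x = refl
    A^-+ (suc i) j x = cong A (A^-+ i j x)

    A^-7 : ∀ i x → A^ (i + 7) x ~ A^ i x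
    A^-7 i x = subst (_~ A^ i x) (A^-+ i 7 x) (A^-cong i (A⁷ x))

    A-inj : ∀ {x y} → A x ~ A y → x ~ y
    A-inj e = ~trans (~sym (A⁷ _)) (~trans (A^-cong 6 e) (A⁷ _))

    C-inj : ∀ {x y} → C x ~ C y → x ~ y
    C-inj e = ~trans (~sym (C² _)) (~trans (C-cong e) (C² _))

    -- From c a c a c a = 1.
    turn : ∀ w → A (C (A (C w))) ~ C (A^ 6 w)
    turn w = C-inj (~trans (A-inj (~trans (C-inj (AC³ (C w))) (~sym (A⁷ w)))) (~sym (C² _)))

  abstract
    rot-neg-not : ∀ o k i → rot o k (neg i) ≡ rot (not o) k i
    rot-neg-not true = from-yes (all? λ k → all? λ i → rot true k (neg i) Data.Fin.≟ rot false k i)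
    rot-neg-not false = from-yes (all? λ k → all? λ i → rot false k (neg i) Data.Fin.≟ rot true k i)

  -- Reflecting the plane amounts to turning the other way: `A` becomes its inverse `A^ 6`, and each
  -- copy of a prototile changes its orientation.
  mirror : ∀ {S} → Darts S → Darts S
  mirror {S} D = record
    { X = X ; _~_ = _~_ ; A = A^ 6 ; C = C ; ~refl = ~refl ; ~sym = ~sym ; ~trans = ~trans
    ; A-cong = A^-cong 6 ; C-cong = C-cong ; A⁷ = A⁷′ ; C² = C² ; AC³ = AC³′
    ; col = col ; col-cong = col-cong ; col-C = col-C
    ; copy = λ x → let (p , p∈ , k , o , eq) = copy x in
        p , p∈ , k , not o , λ i → trans (col-cong (opposite i x)) (trans (eq (neg i)) (cong (lookup p) (rot-neg-not o k i))) }
    where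
    open Darts D
    A⁷′ : ∀ x → A^ 42 x ~ x
    A⁷′ x = ~trans (A^-7 35 x) (~trans (A^-7 28 x) (~trans (A^-7 21 x) (~trans (A^-7 14 x) (~trans (A^-7 7 x) (A⁷ x)))))
    AC³′ : ∀ x → C (A^ 6 (C (A^ 6 (C (A^ 6 x))))) ~ x
    -- The inverse word, applied to `u`, fixes `u` by `AC³` and at the same time cancels it letter
    -- by letter down to `x`.
    AC³′ x = ~trans (~sym (C-inj (AC³ (C u))))
      (~trans (A-cong (C-cong (A-cong (C-cong (~trans (A-cong (C² _)) (A⁷ _))))))
        (~trans (A-cong (C-cong (~trans (A-cong (C² _)) (A⁷ _)))) (~trans (A-cong (C² _)) (A⁷ _))))
      where u = C (A^ 6 (C (A^ 6 (C (A^ 6 x)))))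
    opposite : ∀ (i : Fin 7) x → iter (A^ 6) (toℕ i) x ~ A^ (toℕ (neg i)) x
    opposite 0F x = ~refl
    opposite 1F x = ~refl
    opposite 2F x = A^-7 5 x
    opposite 3F x = ~trans (A^-7 11 x) (A^-7 4 x)
    opposite 4F x = ~trans (A^-7 17 x) (~trans (A^-7 10 x) (A^-7 3 x))
    opposite 5F x = ~trans (A^-7 23 x) (~trans (A^-7 16 x) (~trans (A^-7 9 x) (A^-7 2 x)))
    opposite 6F x = ~trans (A^-7 29 x) (~trans (A^-7 22 x) (~trans (A^-7 15 x) (~trans (A^-7 8 x) (A^-7 1 x))))

  toℕ-mod : ∀ k → toℕ (k mod 7) ≡ k % 7
  toℕ-mod k = toℕ-fromℕ< _

  mod-+ : ∀ k j → (toℕ (k mod 7) + j) mod 7 ≡ (k + j) mod 7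
  mod-+ k j = toℕ-injective (trans (toℕ-mod (toℕ (k mod 7) + j)) (trans (cong (λ z → (z + j) % 7) (toℕ-mod k))
    (trans (%-distribˡ-+ (k % 7) j 7) (trans (cong (λ z → (z + j % 7) % 7) (m%n%n≡m%n k 7))
      (trans (sym (%-distribˡ-+ k j 7)) (sym (toℕ-mod (k + j))))))))

  -- No quotient group is formed: words are identified when all their continuations have equal
  -- colours. Compatibility with right multiplication is then immediate, and each relation of darts
  -- is an instance of `WellDefined`.
  word-darts : ∀ S → Tileable S → Darts S
  word-darts S (col , wd , matching , copies) = record
    { X = Word ; _~_ = λ g g′ → ∀ w → col (g ++ w) ≡ col (g′ ++ w)
    ; A = λ g → g ++ (Defs.a ∷ []) ; C = λ g → g ++ (Defs.c ∷ [])
    ; ~refl = λ w → refl ; ~sym = λ e w → sym (e w) ; ~trans = λ e e′ w → trans (e w) (e′ w)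
    ; A-cong = step (Defs.a ∷ []) ; C-cong = step (Defs.c ∷ [])
    ; A⁷ = λ g w → trans (cong col (trans (cong (_++ w) (iter-a 7 g)) (++-assoc g _ w))) (wd g w _ (here refl))
    ; C² = λ g w → trans (cong col (trans (++-assoc (g ++ _) _ w) (++-assoc g _ _))) (wd g w _ (there (here refl)))
    ; AC³ = λ g w → trans (cong col (flat g w)) (wd g w _ (there (there (here refl))))
    ; col = col ; col-cong = λ {g} {g′} e → trans (cong col (sym (++-identityʳ g))) (trans (e []) (cong col (++-identityʳ g′)))
    ; col-C = matching
    ; copy = λ g → let (p , p∈ , k , eq) = find (copies g) in copy g p p∈ (k , eq) }
    where
    step : ∀ u {g g′} → (∀ w → col (g ++ w) ≡ col (g′ ++ w)) → ∀ w → col ((g ++ u) ++ w) ≡ col ((g′ ++ u) ++ w)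
    step u {g} {g′} e w = trans (cong col (++-assoc g u w)) (trans (e (u ++ w)) (cong col (sym (++-assoc g′ u w))))
    iter-a : ∀ i g → iter (λ g → g ++ (Defs.a ∷ [])) i g ≡ g ++ L.replicate i Defs.a
    iter-a zero g = sym (++-identityʳ g)
    iter-a (suc i) g = trans (cong (_++ (Defs.a ∷ [])) (iter-a i g)) (trans (++-assoc g _ _) (cong (g ++_) (snoc i)))
      where
      snoc : ∀ i → L.replicate i Defs.a ++ (Defs.a ∷ []) ≡ Defs.a ∷ L.replicate i Defs.a
      snoc zero = refl
      snoc (suc i) = cong (Defs.a ∷_) (snoc i)
    flat : ∀ g w → ((((((g ++ (Defs.a ∷ [])) ++ (Defs.c ∷ [])) ++ (Defs.a ∷ [])) ++ (Defs.c ∷ [])) ++ (Defs.a ∷ [])) ++ (Defs.c ∷ [])) ++ w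
                   ≡ g ++ (Defs.a ∷ Defs.c ∷ Defs.a ∷ Defs.c ∷ Defs.a ∷ Defs.c ∷ []) ++ w
    flat g w = trans (++-assoc (((((g ++ _) ++ _) ++ _) ++ _) ++ _) _ w) (trans (++-assoc ((((g ++ _) ++ _) ++ _) ++ _) _ _)
      (trans (++-assoc (((g ++ _) ++ _) ++ _) _ _) (trans (++-assoc ((g ++ _) ++ _) _ _) (trans (++-assoc (g ++ _) _ _) (++-assoc g _ _)))))
    copy : ∀ g p → p ∈ S → IsCopy col g p → ∃ λ p → p ∈ S × ∃₂ λ k o → ∀ i → col (iter (λ g → g ++ (Defs.a ∷ [])) (toℕ i) g) ≡ lookup p (rot o k i)
    copy g p p∈ (k , inj₁ eq) = p , p∈ , k mod 7 , true , λ i →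
      trans (cong col (iter-a (toℕ i) g)) (trans (eq i) (cong (lookup p) (trans (sym (mod-+ k (toℕ i))) (sym (rot-true (k mod 7) i)))))
    copy g p p∈ (k , inj₂ eq) = p , p∈ , k mod 7 , false , λ i →
      trans (cong col (iter-a (toℕ i) g)) (trans (eq i) (cong (lookup p) (trans (sym (mod-+ k (6 * toℕ i))) (sym (rot-false (k mod 7) i)))))

-- Every tiling contains an infinite run.

module ForcedRuns where
  open import Data.Nat using (ℕ; zero; suc; _+_)
  open import Data.Nat.Properties using (+-comm; +-suc)
  open import Data.Bool using (Bool; true; false; not; T)
  open import Data.Fin using (Fin; zero; suc; toℕ)
  open import Data.Fin.Patterns
  open import Data.Fin.Properties using (all?)
  open import Data.Vec using (Vec; []; _∷_; lookup; replicate; _[_]≔_)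
  open import Data.Vec.Properties using (lookup-map; lookup∘update; lookup∘update′; lookup-replicate)
  open import Data.List using (List; []; _∷_; _++_; map; length)
  open import Data.List.Properties using (map-∘)
  open import Data.List.Membership.Propositional using (_∈_)
  open import Data.List.Relation.Unary.All using (All; []; _∷_)
  import Data.List.Relation.Unary.All as All
  open import Data.List.Relation.Unary.Any using (here; there)
  open import Data.Product using (Σ; ∃; ∃₂; _×_; _,_; proj₁; proj₂; -,_)
  open import Data.Sum using (_⊎_; inj₁; inj₂)
  open import Data.Unit using (⊤; tt)
  open import Relation.Binary.Definitions using (DecidableEquality)
  open import Relation.Binary.PropositionalEquality
  open import Relation.Nullary using (yes; no)
  open import Relation.Nullary.Decidable using (from-yes; _⊎-dec_)
  open StackMachines
  open RowInvariant
  open Heptagons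
  open Tilesets

  abstract
    rot-neg : ∀ k i → rot true k (rot true (neg k) i) ≡ i
    rot-neg = from-yes (all? λ k → all? λ i → rot true k (rot true (neg k) i) Data.Fin.≟ i)

    rot-add : ∀ j i → toℕ i + toℕ j ≡ toℕ (rot true j i) ⊎ toℕ i + toℕ j ≡ toℕ (rot true j i) + 7
    rot-add = from-yes (all? λ j → all? λ i → (toℕ i + toℕ j Data.Nat.≟ toℕ (rot true j i)) ⊎-dec (toℕ i + toℕ j Data.Nat.≟ toℕ (rot true j i) + 7))

  rot-0 : ∀ i → rot true 0F i ≡ i
  rot-0 0F = refl
  rot-0 1F = refl
  rot-0 2F = refl
  rot-0 3F = refl
  rot-0 4F = refl
  rot-0 5F = refl
  rot-0 6F = refl

  module Forced {L : ℕ} {Sym : Set} (_≟ˢ_ : DecidableEquality Sym) (syms : List Sym) (syms-complete : ∀ a → a ∈ syms) {Lab : Set} where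
    open Tiles {L} _≟ˢ_ syms syms-complete

    module Follow (colour : Slot → Lab → ℕ) (colour-injective : ∀ {s s′ l l′} → colour s l ≡ colour s′ l′ → s ≡ s′ × l ≡ l′)
                  (Δ : List (Lab × Op L Sym × Lab)) where
      open Paint colour colour-injective

      data Tr : Lab → Op L Sym → Lab → Set where
        tr : ∀ {p op q} → (p , op , q) ∈ Δ → Tr p op q

      open Run Tr public

      lab : Lab → Lab → Bool → Lab
      lab p q true = p
      lab p q false = q

      paint-injective : ∀ {p q z p′ q′ z′} → paint p q z ≡ paint p′ q′ z′ →
                        proj₂ z ≡ proj₂ z′ × lab p q (proj₁ z) ≡ lab p′ q′ (proj₁ z′)
      paint-injective {z = true , _} {z′ = true , _} e = colour-injective e
      paint-injective {z = true , _} {z′ = false , _} e = colour-injective e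
      paint-injective {z = false , _} {z′ = true , _} e = colour-injective e
      paint-injective {z = false , _} {z′ = false , _} e = colour-injective e

      module On (D : Darts (tileset Δ)) where
        open Darts D

        record View (x : X) : Set where
          field
            p q   : Lab
            op    : Op L Sym
            t     : Datum
            k     : Fin 7
            o     : Bool
            moves : (p , op , q) ∈ Δ
            valid : Valid op t
            looks : ∀ i → col (A^ (toℕ i) x) ≡ paint p q (lookup (schemeOf op t) (rot o k i))

          place : Shape × Fin 7 × Bool
          place = proj₁ t , k , o

        open View

        Copy : X → Set
        Copy x = ∃ λ pr → pr ∈ tileset Δ × ∃₂ λ k o → ∀ i → col (A^ (toℕ i) x) ≡ lookup pr (rot o k i)

        unreflected : ∀ {x} → Copy x → Bool
        unreflected (_ , _ , _ , o , _) = o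

        view-copy : ∀ x (c : Copy x) → Σ (View x) λ w → o w ≡ unreflected c
        view-copy x (pr , pr∈ , k , o , eq) with ∈-tileset⁻ pr∈
        ... | p , op , q , t , e∈ , valid , refl = record
          { p = p ; q = q ; op = op ; t = t ; k = k ; o = o ; moves = e∈ ; valid = valid
          ; looks = λ i → trans (eq i) (lookup-map (rot o k i) (paint p q) (schemeOf op t)) } , refl

        view : ∀ x → View x
        view x = proj₁ (view-copy x (copy x))

        kind-at : ∀ op t i → kindOf (proj₂ (lookup (schemeOf op t) i)) ≡ lookup (Kinds.kinds (proj₁ t)) i
        kind-at op t i = trans (sym (lookup-map i (λ z → kindOf (proj₂ z)) (schemeOf op t))) (cong (λ z → lookup z i) (kinds-scheme op t))

        same-kind : ∀ {x x′} (w : View x) (w′ : View x′) i i′ → col (A^ (toℕ i) x) ≡ col (A^ (toℕ i′) x′) →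
                    at (place w) i ≡ at (place w′) i′
        same-kind w w′ i i′ e = trans (sym (kind-at (op w) (t w) (rot (o w) (k w) i)))
          (trans (cong kindOf (proj₁ (paint-injective {p w} {q w} {z} {p w′} {q w′} {z′} (trans (sym (looks w i)) (trans e (looks w′ i′))))))
                 (kind-at (op w′) (t w′) (rot (o w′) (k w′) i′)))
          where
          z = lookup (schemeOf (op w) (t w)) (rot (o w) (k w) i)
          z′ = lookup (schemeOf (op w′) (t w′)) (rot (o w′) (k w′) i′)

        A^-add : ∀ (i j : Fin 7) x → A^ (toℕ i) (A^ (toℕ j) x) ~ A^ (toℕ (rot true j i)) x
        A^-add i j x with rot-add j i
        ... | inj₁ e = subst (λ z → A^ (toℕ i) (A^ (toℕ j) x) ~ z) (trans (A^-+ (toℕ i) (toℕ j) x) (cong (λ z → A^ z x) e)) ~refl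
        ... | inj₂ e = subst (λ z → z ~ A^ (toℕ (rot true j i)) x)
                             (sym (trans (A^-+ (toℕ i) (toℕ j) x) (cong (λ z → A^ z x) e))) (A^-7 (toℕ (rot true j i)) x)

        -- A tile seen from its first side, in the orientation of the prototile.
        record Tile : Set where
          field
            y     : X
            vw    : View y
            front : k vw ≡ 0F × o vw ≡ true
            hs    : Vec ℕ L

          src tgt : Lab
          src = p vw
          tgt = q vw
          opr : Op L Sym
          opr = op vw
          datum : Datum
          datum = t vw

          looks₀ : ∀ i → col (A^ (toℕ i) y) ≡ paint src tgt (lookup (schemeOf opr datum) i)
          looks₀ i = trans (looks vw i) (cong (λ j → paint src tgt (lookup (schemeOf opr datum) j))
                       (trans (cong₂ (λ o k → rot o k i) (proj₂ front) (proj₁ front)) (rot-0 i)))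

          shape : Shape
          shape = proj₁ datum
          state : State
          state = proj₁ (proj₂ datum)
          left right : Bool
          left = proj₁ (proj₂ (proj₂ datum))
          right = proj₂ (proj₂ (proj₂ datum))

        straighten : ∀ {x} (w : View x) → o w ≡ true → Tile
        straighten {x} w eq = record
          { y = A^ (toℕ (neg (k w))) x
          ; vw = record
            { p = p w ; q = q w ; op = op w ; t = t w ; k = 0F ; o = true ; moves = moves w ; valid = valid w
            ; looks = λ i → trans (col-cong (A^-add i (neg (k w)) x)) (trans (looks w (rot true (neg (k w)) i))
                (cong (λ j → paint (p w) (q w) (lookup (schemeOf (op w) (t w)) j))
                  (trans (cong (λ z → rot z (k w) (rot true (neg (k w)) i)) eq) (trans (rot-neg (k w) i) (sym (rot-0 i)))))) }
          ; front = refl , refl ; hs = replicate L 0 }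

        A^-succ : ∀ i y → A^ (toℕ (succ i)) y ~ A (A^ (toℕ i) y)
        A^-succ 0F y = ~refl
        A^-succ 1F y = ~refl
        A^-succ 2F y = ~refl
        A^-succ 3F y = ~refl
        A^-succ 4F y = ~refl
        A^-succ 5F y = ~refl
        A^-succ 6F y = ~sym (A⁷ y)

        A^-prev : ∀ i y → A^ (toℕ (prev i)) y ~ A^ 6 (A^ (toℕ i) y)
        A^-prev 0F y = ~refl
        A^-prev 1F y = ~sym (A⁷ y)
        A^-prev 2F y = ~sym (A^-7 1 y)
        A^-prev 3F y = ~sym (A^-7 2 y)
        A^-prev 4F y = ~sym (A^-7 3 y)
        A^-prev 5F y = ~sym (A^-7 4 y)
        A^-prev 6F y = ~sym (A^-7 5 y)

        corner-of : ∀ {x k k′} (w : View x) → at (place w) 0F ≡ k → at (place w) 1F ≡ k′ → T (corner k k′)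
        corner-of w = corner-intro (place w)

        module _ (τ : Tile) where
          open Tile τ using (y; vw; front; shape)

          kind-side : ∀ i → at (place vw) i ≡ lookup (Kinds.kinds shape) i
          kind-side i = cong (lookup (Kinds.kinds shape))
                          (trans (cong₂ (λ o k → rot o k i) (proj₂ front) (proj₁ front)) (rot-0 i))

          cross : ∀ {e} → e ∈ own shape → Vec ℕ L → Σ Tile λ τ′ → Tile.y τ′ ≡ C (A^ (toℕ (pos shape e)) y) × Child e (Tile.shape τ′)
          cross {e} e∈ hs′ =
            let (child , k≡ , o≡) = crossing e∈ fit
            in record { y = z ; vw = w ; front = k≡ , o≡ ; hs = hs′ } , refl , child
            where
            i = pos shape e
            u₀ = A^ (toℕ i) y
            z = C u₀
            w = view z
            before : View (C (A^ (toℕ (succ i)) y))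
            before = view _
            behind : View (C (A z))
            behind = view _
            around : C (A (C (A u₀))) ~ A^ 6 z
            around = A-inj (~trans (C-inj (~trans (AC³ u₀) (~sym (C² u₀)))) (~sym (A⁷ (C u₀))))
            fit : T (fits shape i (place w))
            fit = fits-intro shape i (place w) (trans (same-kind w vw 0F i (col-C u₀)) (kind-side i))
              (corner-of before
                (trans (same-kind before vw 0F (succ i) (col-C _)) (kind-side (succ i)))
                (same-kind before w 1F 6F
                  (trans (sym (col-C _)) (col-cong (~trans (C-cong (A-cong (C-cong (A^-succ i y)))) around)))))
              (corner-of behind
                (same-kind behind w 0F 1F (col-C _))
                (trans (same-kind behind vw 1F (prev i)
                         (trans (col-cong (~trans (turn u₀) (C-cong (~sym (A^-prev i y))))) (col-C _)))
                       (kind-side (prev i))))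

        edge-eq : ∀ τ τ′ i j {β z β′ z′} → col (A^ (toℕ i) (Tile.y τ)) ≡ col (A^ (toℕ j) (Tile.y τ′)) →
                  lookup (schemeOf (Tile.opr τ) (Tile.datum τ)) i ≡ (β , z) → lookup (schemeOf (Tile.opr τ′) (Tile.datum τ′)) j ≡ (β′ , z′) →
                  z ≡ z′ × lab (Tile.src τ) (Tile.tgt τ) β ≡ lab (Tile.src τ′) (Tile.tgt τ′) β′
        edge-eq τ τ′ i j {β} {z} {β′} {z′} e l l′ = paint-injective {Tile.src τ} {Tile.tgt τ} {β , z} {Tile.src τ′} {Tile.tgt τ′} {β′ , z′}
          (trans (cong (paint (Tile.src τ) (Tile.tgt τ)) (sym l)) (trans (sym (Tile.looks₀ τ i)) (trans e
            (trans (Tile.looks₀ τ′ j) (cong (paint (Tile.src τ′) (Tile.tgt τ′)) l′)))))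

        child-top : ∀ {e s} op σ x y → Child e s → ∃ λ z → lookup (scheme op s σ x y) 0F ≡ (true , z)
        child-top op σ x y fst = -, refl
        child-top op σ x y mid = -, refl
        child-top op σ x y lst = -, refl

        side-down : ∀ {e} s op σ x y → e ∈ own s → ∃ λ z → lookup (scheme op s σ x y) (pos s e) ≡ (false , z)
        side-down (wf p) op σ x y (here refl) = -, refl
        side-down (wf p) op σ x y (there (here refl)) = -, refl
        side-down (wf p) op σ x y (there (there (here refl))) = -, refl
        side-down (wm p) op σ x y (here refl) = -, refl
        side-down (wm p) op σ x y (there (here refl)) = -, refl
        side-down (wm p) op σ x y (there (there (here refl))) = -, refl
        side-down (wn p) op σ x y (here refl) = -, refl
        side-down (wn p) op σ x y (there (here refl)) = -, refl
        side-down (wn p) op σ x y (there (there (here refl))) = -, refl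
        side-down (b _ p) op σ x y (here refl) = -, refl
        side-down (b _ p) op σ x y (there (here refl)) = -, refl
        side-down v op σ x y (here refl) = -, refl
        side-down v op σ x y (there (here refl)) = -, refl
        side-down v op σ x y (there (there (here refl))) = -, refl

        module _ {e} (τ τ′ : Tile) (e∈ : e ∈ own (Tile.shape τ)) (below : Tile.y τ′ ≡ C (A^ (toℕ (pos (Tile.shape τ) e)) (Tile.y τ)))
                 (c : Child e (Tile.shape τ′)) where
          shared : col (A^ (toℕ (pos (Tile.shape τ) e)) (Tile.y τ)) ≡ col (Tile.y τ′)
          shared = sym (trans (cong col below) (col-C _))

          src-below : Tile.tgt τ ≡ Tile.src τ′
          src-below = proj₂ (edge-eq τ τ′ (pos (Tile.shape τ) e) 0F shared
            (proj₂ (side-down (Tile.shape τ) (Tile.opr τ) _ _ _ e∈)) (proj₂ (child-top (Tile.opr τ′) _ _ _ c)))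

        state-below : ∀ {e} (τ τ′ : Tile) → Child e (Tile.shape τ) → Tile.y τ′ ≡ C (A^ 4 (Tile.y τ)) → Child sf (Tile.shape τ′) →
                      Tile.state τ′ ≡ after (Tile.opr τ) (Tile.left τ) (Tile.right τ) (Tile.state τ)
        state-below τ τ′ c below c′ = sym (dst-inj (proj₁ (edge-eq τ τ′ 4F 0F (sym (trans (cong col below) (col-C _)))
            (proj₂ (side-f (Tile.opr τ) _ _ _ c)) (proj₂ (top-f (Tile.opr τ′) _ _ _ c′)))))
          where
          dst-inj : ∀ {p σ p′ σ′} → dst p σ ≡ dst p′ σ′ → σ ≡ σ′
          dst-inj refl = refl
          side-f : ∀ {e s} op σ x y → Child e s → ∃ λ p → lookup (scheme op s σ x y) 4F ≡ (false , dst p (after op x y σ))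
          side-f op σ x y fst = -, refl
          side-f op σ x y mid = -, refl
          side-f op σ x y lst = -, refl
          top-f : ∀ {s} op σ x y → Child sf s → ∃ λ p → lookup (scheme op s σ x y) 0F ≡ (true , dst p σ)
          top-f op σ x y fst = -, refl

        -- The shapes `wn` and `v` are left out: they never occur among first, middle and last
        -- children, and strips consist of such children only.
        El : Set
        El = Σ Tile λ τ → ∃ λ e → Child e (Tile.shape τ)

        rightPos : Side → Fin 7
        rightPos sl = 2F
        rightPos _ = 1F

        -- The right neighbour is entered through its side 6; one more turn gives its side 0, from
        -- which a `Tile` is seen.
        rt : El → X
        rt (τ , e , _) = A (C (A^ (toℕ (rightPos e)) (Tile.y τ)))

        Link : El → El → Set
        Link ε ε′ = Tile.y (proj₁ ε′) ~ rt ε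

        Labels : El → El → Set
        Labels (τ , _) (τ′ , _) = Tile.opr τ ≡ Tile.opr τ′ × Tile.tgt τ ≡ Tile.tgt τ′

        link-eq : ∀ ε ε′ → Link ε ε′ → Labels ε ε′ × Tile.right (proj₁ ε) ≡ Tile.left (proj₁ ε′)
        link-eq (τ , e , c) (τ′ , e′ , c′) link =
          let (s≡ , q≡) = edge-eq τ τ′ (rightPos e) 6F shared-side
                            (proj₂ (proj₂ (right-side (Tile.opr τ) _ _ _ c))) (proj₂ (proj₂ (left-side (Tile.opr τ′) _ _ _ c′)))
              (op≡ , x≡) = hor-inj s≡
          in (op≡ , q≡) , x≡
          where
          hor-inj : ∀ {k p o x k′ p′ o′ x′} → hor k p o x ≡ hor k′ p′ o′ x′ → o ≡ o′ × x ≡ x′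
          hor-inj refl = refl , refl
          right-side : ∀ {e s} op σ x y → Child e s → ∃₂ λ k p → lookup (scheme op s σ x y) (rightPos e) ≡ (false , hor k p op y)
          right-side op σ x y fst = -, -, refl
          right-side op σ x y mid = -, -, refl
          right-side op σ x y lst = -, -, refl
          left-side : ∀ {e s} op σ x y → Child e s → ∃₂ λ k p → lookup (scheme op s σ x y) 6F ≡ (false , hor k p op x)
          left-side op σ x y fst = -, -, refl
          left-side op σ x y mid = -, -, refl
          left-side op σ x y lst = -, -, refl
          shared-side : col (A^ (toℕ (rightPos e)) (Tile.y τ)) ≡ col (A^ 6 (Tile.y τ′))
          shared-side = trans (sym (col-C _)) (sym (col-cong (~trans (A^-cong 6 link) (A⁷ (C (A^ (toℕ (rightPos e)) (Tile.y τ)))))))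

        Linked : List El → Set
        Linked [] = ⊤
        Linked (_ ∷ []) = ⊤
        Linked (ε ∷ ε′ ∷ es) = Link ε ε′ × Linked (ε′ ∷ es)

        f∈ : ∀ {e s} → Child e s → sf ∈ own s
        f∈ fst = here refl
        f∈ mid = here refl
        f∈ lst = here refl

        l∈ : ∀ {e s} → Child e s → sl ∈ own s
        l∈ fst = there (there (here refl))
        l∈ mid = there (there (here refl))
        l∈ lst = there (here refl)

        height : Op L Sym → ℕ → Tile → ℕ
        height op H τ = proj₂ (next op H ((lookup (Tile.state τ) (layer op) , lookup (Tile.hs τ) (layer op)) , Tile.left τ , Tile.right τ))

        crossing-to : ∀ {e} (τ : Tile) → e ∈ own (Tile.shape τ) → Vec ℕ L → El
        crossing-to τ e∈ hs = let (τ′ , _ , c) = cross τ e∈ hs in τ′ , _ , c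

        module _ (H : ℕ) where
          fk lk : El → El
          fk (τ , e , c) = crossing-to τ (f∈ c) (Tile.hs τ [ layer (Tile.opr τ) ]≔ height (Tile.opr τ) H τ)
          lk (τ , e , c) = crossing-to τ (l∈ c) (replicate L 0)

          m∈ : ∀ {e s} → Child e s → e ≢ sl → sm ∈ own s
          m∈ fst _ = there (here refl)
          m∈ mid _ = there (here refl)
          m∈ lst ne with ne refl
          ... | ()

          kids : El → List El → List El
          kids ε@(τ , sl , c) es = fk ε ∷ lk ε ∷ es
          kids ε@(τ , sf , c) es = fk ε ∷ crossing-to τ (m∈ c (λ ())) (replicate L 0) ∷ lk ε ∷ es
          kids ε@(τ , sm , c) es = fk ε ∷ crossing-to τ (m∈ c (λ ())) (replicate L 0) ∷ lk ε ∷ es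

          all-kids : List El → List El
          all-kids [] = []
          all-kids (ε ∷ es) = kids ε (all-kids es)

          down-right : ∀ i y → A (C (A (C (A^ (suc i) y)))) ~ C (A^ i y)
          down-right i y = ~trans (turn (A^ (suc i) y)) (C-cong (subst (_~ A^ i y)
            (trans (cong (λ k → A^ k y) (trans (+-comm i 7) refl)) (sym (trans (A^-+ 6 (suc i) y) (cong (λ k → A^ k y) (+-suc 6 i))))) (A^-7 i y)))

          -- For `w` the right side of a tile, the left-hand side leaves its last child to the
          -- right. On the other side `C w` is side 6 of the right neighbour, and five turns further
          -- is side 4, leading to its first child.
          down-cousin : ∀ w → A (C (A (A (C (A w))))) ~ C (A^ 5 (C w))
          down-cousin w = ~trans (A-cong (C-cong (A-cong (~trans (A-cong (C-cong (A-cong (~sym (C² w))))) (turn (C w))))))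
            (~trans (turn (A^ 6 (C w))) (C-cong (A^-7 5 (C w))))

          link-inside : ∀ ε es → Linked (lk ε ∷ es) → Linked (kids ε es)
          link-inside ε@(τ , sf , fst) es k = ~sym (down-right 3 _) , ~sym (down-right 2 _) , k
          link-inside ε@(τ , sm , mid) es k = ~sym (down-right 3 _) , ~sym (down-right 2 _) , k
          link-inside ε@(τ , sl , lst) es k = ~sym (down-right 3 _) , k

          fk-at : ∀ ε → Tile.y (proj₁ (fk ε)) ≡ C (A^ 4 (Tile.y (proj₁ ε)))
          fk-at (τ , sf , fst) = refl
          fk-at (τ , sm , mid) = refl
          fk-at (τ , sl , lst) = refl

          link-across : ∀ ε ε′ → Link ε ε′ → Link (lk ε) (fk ε′)
          link-across ε@(τ , sf , fst) ε′ link = subst (_~ rt (lk ε)) (sym (fk-at ε′))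
            (~trans (C-cong (A^-cong 4 link)) (~sym (down-cousin (A^ 1 (Tile.y τ)))))
          link-across ε@(τ , sm , mid) ε′ link = subst (_~ rt (lk ε)) (sym (fk-at ε′))
            (~trans (C-cong (A^-cong 4 link)) (~sym (down-cousin (A^ 1 (Tile.y τ)))))
          link-across ε@(τ , sl , lst) ε′ link = subst (_~ rt (lk ε)) (sym (fk-at ε′))
            (~trans (C-cong (A^-cong 4 link)) (~sym (down-cousin (A^ 2 (Tile.y τ)))))

          link-head : ∀ x ε es → Link x (fk ε) → Linked (kids ε es) → Linked (x ∷ kids ε es)
          link-head x (_ , sf , _) es l k = l , k
          link-head x (_ , sm , _) es l k = l , k
          link-head x (_ , sl , _) es l k = l , k

          linked-kids : ∀ es → Linked es → Linked (all-kids es)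
          linked-kids [] _ = tt
          linked-kids (ε ∷ []) _ = link-inside ε [] tt
          linked-kids (ε ∷ ε′ ∷ es) (l , ls) =
            link-inside ε _ (link-head (lk ε) ε′ _ (link-across ε ε′ l) (linked-kids (ε′ ∷ es) ls))

          all-src : ∀ {q} es → All (λ ε → Tile.tgt (proj₁ ε) ≡ q) es → All (λ ε → Tile.src (proj₁ ε) ≡ q) (all-kids es)
          all-src [] [] = []
          all-src (ε@(τ , e , c) ∷ es) (refl ∷ qs) = go e c (all-src es qs)
            where
            from : ∀ {e} (i : e ∈ own (Tile.shape τ)) hs → Tile.src (proj₁ (crossing-to τ i hs)) ≡ Tile.tgt τ
            from i hs = let (τ′ , below , c′) = cross τ i hs in sym (src-below τ τ′ i below c′)
            hs′ = Tile.hs τ [ layer (Tile.opr τ) ]≔ height (Tile.opr τ) H τ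
            go : ∀ e c {l} → All (λ ε → Tile.src (proj₁ ε) ≡ Tile.tgt τ) l → All (λ ε → Tile.src (proj₁ ε) ≡ Tile.tgt τ) (kids (τ , e , c) l)
            go sf c k = from (f∈ c) hs′ ∷ from (m∈ c (λ ())) (replicate L 0) ∷ from (l∈ c) (replicate L 0) ∷ k
            go sm c k = from (f∈ c) hs′ ∷ from (m∈ c (λ ())) (replicate L 0) ∷ from (l∈ c) (replicate L 0) ∷ k
            go sl c k = from (f∈ c) hs′ ∷ from (l∈ c) (replicate L 0) ∷ k

        labels-trans : ∀ {x y z} → Labels x y → Labels y z → Labels x z
        labels-trans (e , f) (e′ , f′) = trans e e′ , trans f f′

        uniform : ∀ ε es → Linked (ε ∷ es) → All (Labels ε) (ε ∷ es)
        uniform ε [] _ = (refl , refl) ∷ []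
        uniform ε (ε′ ∷ es) (l , ls) = (refl , refl) ∷
          All.map (λ {z} → labels-trans {ε} {ε′} {z} (proj₁ (link-eq ε ε′ l))) (uniform ε′ es ls)

        cellAt : Fin L → El → Cell Sym × ℕ
        cellAt i (τ , _) = lookup (Tile.state τ) i , lookup (Tile.hs τ) i

        itemAt : Fin L → El → Item
        itemAt i ε@(τ , _) = cellAt i ε , Tile.left τ , Tile.right τ

        wired : ∀ i es → Linked es → Wired (map (itemAt i) es)
        wired i [] _ = tt
        wired i (_ ∷ []) _ = tt
        wired i (ε ∷ ε′ ∷ es) (l , ls) = proj₂ (link-eq ε ε′ l) , wired i (ε′ ∷ es) ls

        row-items : ∀ i es → row (map (itemAt i) es) ≡ map (cellAt i) es
        row-items i [] = refl
        row-items i (ε ∷ es) = cong (_ ∷_) (row-items i es)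

        ok-items : ∀ {op} es → All (λ ε → Tile.opr (proj₁ ε) ≡ op) es → All (OkItem op) (map (itemAt (layer op)) es)
        ok-items [] [] = []
        ok-items (ε@(τ , _) ∷ es) (refl ∷ os) = proj₁ (valid (Tile.vw τ)) ∷ ok-items es os

        quiet : ∀ {e op s σ x y} → Child e s → e ≢ sf → Valid op (s , σ , x , y) → σ ≡ frees
        quiet fst ne _ with ne refl
        ... | ()
        quiet mid _ (_ , eq) = eq
        quiet lst _ (_ , eq) = eq

        quiet-tile : ∀ {e} (τ : Tile) → Child e (Tile.shape τ) → e ≢ sf → Tile.state τ ≡ frees
        quiet-tile τ c ne = quiet {op = Tile.opr τ} {x = Tile.left τ} {y = Tile.right τ} c ne (valid (Tile.vw τ))

        next-post : ∀ (op : Op L Sym) H σ h x y → proj₁ (next op H ((σ , h) , x , y)) ≡ post op x y σ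
        next-post (push _ _) H free h x y = refl
        next-post (push _ _) H (top _ _) h x y = refl
        next-post (push _ _) H (cov _ _) h x y = refl
        next-post (pop _ _) H free h x y = refl
        next-post (pop _ _) H (top _ _) h x y = refl
        next-post (pop _ _) H (cov _ _) h x y = refl
        next-post (peek _ _) H free h x y = refl
        next-post (peek _ _) H (top _ _) h x y = refl
        next-post (peek _ _) H (cov _ _) h x y = refl

        module _ (H : ℕ) where
          fk-state : ∀ ε → Tile.state (proj₁ (fk H ε)) ≡ after (Tile.opr (proj₁ ε)) (Tile.left (proj₁ ε)) (Tile.right (proj₁ ε)) (Tile.state (proj₁ ε))
          fk-state ε@(τ , e , c) = state-below τ (proj₁ (fk H ε)) c (fk-at H ε) (proj₂ (proj₂ (fk H ε)))

          fk-cell-same : ∀ ε → cellAt (layer (Tile.opr (proj₁ ε))) (fk H ε) ≡ next (Tile.opr (proj₁ ε)) H (itemAt (layer (Tile.opr (proj₁ ε))) ε)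
          fk-cell-same ε@(τ , e , c) = cong₂ _,_
            (trans (cong (λ z → lookup z l) (fk-state ε)) (trans (lookup∘update l (Tile.state τ) _)
              (sym (next-post (Tile.opr τ) H (lookup (Tile.state τ) l) (lookup (Tile.hs τ) l) (Tile.left τ) (Tile.right τ)))))
            (lookup∘update l (Tile.hs τ) _)
            where l = layer (Tile.opr τ)

          fk-cell-other : ∀ i ε → i ≢ layer (Tile.opr (proj₁ ε)) → cellAt i (fk H ε) ≡ cellAt i ε
          fk-cell-other i ε@(τ , e , c) ne = cong₂ _,_
            (trans (cong (λ z → lookup z i) (fk-state ε)) (lookup∘update′ ne (Tile.state τ) _))
            (lookup∘update′ ne (Tile.hs τ) _)

          cross-free : ∀ i τ {e} (e∈ : e ∈ own (Tile.shape τ)) hs → e ≢ sf → proj₁ (cellAt i (crossing-to τ e∈ hs)) ≡ free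
          cross-free i τ e∈ hs ne = let (τ′ , _ , c) = cross τ e∈ hs in
            trans (cong (λ z → lookup z i) (quiet-tile τ′ c ne)) (lookup-replicate i free)

          put′ : ∀ {x x′ f fs L L′} → x ≡ x′ → proj₁ f ≡ free → All (λ z → proj₁ z ≡ free) fs → Expand {Sym} L L′ → Expand (x′ ∷ L) (x ∷ f ∷ fs ++ L′)
          put′ refl refl fs e = put fs e

          expand-kids : ∀ i (g : El → Cell Sym × ℕ) es → All (λ ε → cellAt i (fk H ε) ≡ g ε) es → Expand (map g es) (map (cellAt i) (all-kids H es))
          expand-kids i g [] [] = []
          expand-kids i g (ε@(τ , sl , c) ∷ es) (e ∷ eqs) =
            put′ e (cross-free i τ (l∈ c) (replicate L 0) (λ ())) [] (expand-kids i g es eqs)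
          expand-kids i g (ε@(τ , sf , c) ∷ es) (e ∷ eqs) =
            put′ e (cross-free i τ (m∈ H c (λ ())) (replicate L 0) (λ ())) (cross-free i τ (l∈ c) (replicate L 0) (λ ()) ∷ []) (expand-kids i g es eqs)
          expand-kids i g (ε@(τ , sm , c) ∷ es) (e ∷ eqs) =
            put′ e (cross-free i τ (m∈ H c (λ ())) (replicate L 0) (λ ())) (cross-free i τ (l∈ c) (replicate L 0) (λ ()) ∷ []) (expand-kids i g es eqs)

        -- A finite part of a row, all of whose tiles carry the same transition, together with the known stack contents.
        record Strip : Set where
          field
            ε₀   : El
            es   : List El
            link : Linked (ε₀ ∷ es)
            srcs : All (λ ε → Tile.src (proj₁ ε) ≡ Tile.src (proj₁ ε₀)) (ε₀ ∷ es)
            stk  : Stacks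
            keeps : ∀ i → Inv (lookup stk i) (map (cellAt i) (ε₀ ∷ es)) × Apart (map (cellAt i) (ε₀ ∷ es)) × HasFree (map (cellAt i) (ε₀ ∷ es))

        conf : Strip → Conf
        conf g = Tile.src (proj₁ (Strip.ε₀ g)) , Strip.stk g

        -- The stack operated on changes as in `inv-step`; on the other layers the row only gains
        -- free tiles. That the known stack admits the operation at all is `act-exists`.
        advance : ∀ g → ∃ λ g′ → Step (conf g) (conf g′)
        advance g = result (split-kids ε₀ (all-kids H es))
          where
          open Strip g
          τ₀ = proj₁ ε₀
          op₀ = Tile.opr τ₀
          l = layer op₀
          H = length (lookup stk l)
          all = ε₀ ∷ es
          labels = uniform ε₀ es link
          ops : All (λ ε → Tile.opr (proj₁ ε) ≡ op₀) all
          ops = All.map (λ e → sym (proj₁ e)) labels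
          tgts : All (λ ε → Tile.tgt (proj₁ ε) ≡ Tile.tgt τ₀) all
          tgts = All.map (λ e → sym (proj₂ e)) labels
          items = map (itemAt l) all
          inv-l : Inv (lookup stk l) (row items)
          inv-l = subst (Inv _) (sym (row-items l all)) (proj₁ (keeps l))
          acted = act-exists op₀ (lookup stk l) items (ok-items all ops) inv-l
          s′ = proj₁ acted
          stk′ = stk [ l ]≔ s′
          keeps′ : ∀ i → Inv (lookup stk′ i) (map (cellAt i) (all-kids H all)) × Apart (map (cellAt i) (all-kids H all)) × HasFree (map (cellAt i) (all-kids H all))
          keeps′ i with i Data.Fin.≟ l
          ... | yes refl = inv-expand ex (subst (λ z → Inv z (map g′ all)) (sym (lookup∘update l stk s′)) stepped) , apart-expand ex , free-expand ex
            where
            g′ : El → Cell Sym × ℕ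
            g′ ε = next op₀ H (itemAt l ε)
            ex : Expand (map g′ all) (map (cellAt l) (all-kids H all))
            ex = expand-kids H l g′ all (All.map (λ { {ε} refl → fk-cell-same H ε }) ops)
            stepped : Inv s′ (map g′ all)
            stepped = subst (Inv s′) (sym (map-∘ all))
              (inv-step op₀ items (proj₂ acted) (wired l all link) (ok-items all ops)
                (subst Apart (sym (row-items l all)) (proj₁ (proj₂ (keeps l)))) (subst HasFree (sym (row-items l all)) (proj₂ (proj₂ (keeps l)))) inv-l)
          ... | no ne = inv-expand ex (subst (λ z → Inv z (map (cellAt i) all)) (sym (lookup∘update′ ne stk s′)) (proj₁ (keeps i))) , apart-expand ex , free-expand ex
            where
            ex : Expand (map (cellAt i) all) (map (cellAt i) (all-kids H all))
            ex = expand-kids H i (cellAt i) all (All.map (λ { {ε} refl → fk-cell-other H i ε ne }) ops)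
          split-kids : ∀ ε r → ∃₂ λ r₀ rs → kids H ε r ≡ r₀ ∷ rs
          split-kids (_ , sf , _) r = -, -, refl
          split-kids (_ , sm , _) r = -, -, refl
          split-kids (_ , sl , _) r = -, -, refl
          result : (∃₂ λ r₀ rs → all-kids H all ≡ r₀ ∷ rs) → ∃ λ g′ → Step (conf g) (conf g′)
          result (r₀ , rs , eq) =
            record { ε₀ = r₀ ; es = rs ; link = subst Linked eq (linked-kids H all link)
                   ; srcs = All.map (λ e → trans e (sym r₀-src)) srcs′ ; stk = stk′
                   ; keeps = λ i → subst (λ z → Inv (lookup stk′ i) (map (cellAt i) z) × Apart (map (cellAt i) z) × HasFree (map (cellAt i) z)) eq (keeps′ i) }
            , step (tr (subst (λ z → (Tile.src τ₀ , op₀ , z) ∈ Δ) (sym r₀-src) (moves (Tile.vw τ₀)))) (proj₂ acted) refl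
            where
            srcs′ : All (λ ε → Tile.src (proj₁ ε) ≡ Tile.tgt τ₀) (r₀ ∷ rs)
            srcs′ = subst (All _) eq (all-src H all tgts)
            r₀-src : Tile.src (proj₁ r₀) ≡ Tile.tgt τ₀
            r₀-src = All.head srcs′

        iterate : Strip → ∃ Inf
        iterate g = conf g , (λ k → conf (at-time k)) , refl , λ k → proj₂ (advance (at-time k))
          where
          at-time : ℕ → Strip
          at-time zero = g
          at-time (suc k) = proj₁ (advance (at-time k))

        -- The strip starts at a last child because such a tile is free on all layers: with empty,
        -- that is entirely unknown, stacks the invariant then holds for it alone.
        start-at : Tile → Strip
        start-at τ = record { ε₀ = ε ; es = [] ; link = tt ; srcs = refl ∷ [] ; stk = replicate L [] ; keeps = keeps }
          where
          own-l : ∀ s → sl ∈ own s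
          own-l (wf _) = there (there (here refl))
          own-l (wm _) = there (there (here refl))
          own-l (wn _) = there (there (here refl))
          own-l (b _ _) = there (here refl)
          own-l v = there (there (here refl))
          ε : El
          ε = crossing-to τ (own-l (Tile.shape τ)) (replicate L 0)
          keeps : ∀ i → _
          keeps i = fresh (trans (cong (λ z → lookup z i) (quiet-tile (proj₁ ε) (proj₂ (proj₂ ε)) (λ ()))) (lookup-replicate i free))
            where
            fresh : ∀ {x} → proj₁ x ≡ free → Inv (lookup (replicate L []) i) (x ∷ []) × Apart (x ∷ []) × HasFree (x ∷ [])
            fresh refl = inv (free ∷ []) ((λ ()) , tt) (λ {h} {a} p → empty (subst (λ s → At s h a) (lookup-replicate i []) p)) , ((λ ()) , tt) , here refl
              where
              empty : ∀ {h a P} → At {Sym} [] h a → P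
              empty ()

      from : ∀ D {x} → On.View.o (On.view D x) ≡ true → ∃ Inf
      from D {x} e = On.iterate D (On.start-at D (On.straighten D (On.view D x) e))

      -- Reflecting the plane if necessary, we may assume that the tile we start from is not reflected.
      run : (D : Darts (tileset Δ)) → Darts.X D → ∃ Inf
      run D x with On.unreflected D (Darts.copy D x) in eq
      ... | true = from D (trans (proj₂ (On.view-copy D x (Darts.copy D x))) eq)
      ... | false = from (mirror D) (trans (proj₂ (On.view-copy (mirror D) x (Darts.copy (mirror D) x))) (cong not eq))

-- The quotient of the heptagrid on which tilings are built.

module RootedTiles where
  open import Data.Nat using (ℕ; zero; suc)
  open import Data.Fin using (Fin; zero; suc)
  open import Data.Fin.Patterns
  open import Data.Product using (Σ; _×_; _,_; proj₁; proj₂; -,_)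
  open import Relation.Binary.PropositionalEquality
  open Heptagons

  data Sh : Set where
    V W B : Sh

  data Wide : Sh → Set where
    V : Wide V
    W : Wide W

  -- The tiles of the k-th row below a single tile rt.  We use a quotient of the heptagrid by a rotation of
  -- order 3 about a vertex: rt is its own neighbour on both sides, and each row closes up.
  data T : Sh → ℕ → Set where
    rt  : T V 0
    fst : ∀ {s k} → T s k → T W (suc k)
    nid : ∀ {k} → T V k → T W (suc k)
    mid : ∀ {s k} → Wide s → T s k → T W (suc k)
    lst : ∀ {s k} → T s k → T B (suc k)

  Tl : ℕ → Set
  Tl k = Σ Sh λ s → T s k

  -- Rows close up without any condition at their ends: a last child asks its parent for the
  -- neighbour, and the question ends at the latest with `rt`, its own neighbour.
  right left : ∀ {s k} → T s k → Tl k
  right rt = -, rt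
  right (fst {V} t) = -, nid t
  right (fst {W} t) = -, mid W t
  right (fst {B} t) = -, lst t
  right (nid t) = -, mid V t
  right (mid _ t) = -, lst t
  right (lst t) = -, fst (proj₂ (right t))
  left rt = -, rt
  left (fst t) = -, lst (proj₂ (left t))
  left (nid t) = -, fst t
  left (mid V t) = -, nid t
  left (mid W t) = -, fst t
  left (lst {V} t) = -, mid V t
  left (lst {W} t) = -, mid W t
  left (lst {B} t) = -, fst t

  left-right : ∀ {s k} (t : T s k) → left (proj₂ (right t)) ≡ (s , t)
  left-right rt = refl
  left-right (fst {V} t) = refl
  left-right (fst {W} t) = refl
  left-right (fst {B} t) = refl
  left-right (nid t) = refl
  left-right (mid V t) = refl
  left-right (mid W t) = refl
  left-right (lst t) = cong (λ z → -, lst (proj₂ z)) (left-right t)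

  right-left : ∀ {s k} (t : T s k) → right (proj₂ (left t)) ≡ (s , t)
  right-left rt = refl
  right-left (fst t) = cong (λ z → -, fst (proj₂ z)) (right-left t)
  right-left (nid t) = refl
  right-left (mid V t) = refl
  right-left (mid W t) = refl
  right-left (lst {V} t) = refl
  right-left (lst {W} t) = refl
  right-left (lst {B} t) = refl

  Dart : Set
  Dart = Σ ℕ λ k → Tl k × Fin 7

  dart : ∀ {k} → Tl k → Fin 7 → Dart
  dart t i = -, t , i

  turn : Dart → Dart
  turn (k , t , i) = k , t , succ i

  rightSide lastSide midSide : Sh → Fin 7
  rightSide V = 0F
  rightSide W = 1F
  rightSide B = 2F
  lastSide V = 1F
  lastSide W = 2F
  lastSide B = 3F
  midSide V = 2F
  midSide _ = 3F

  above : ∀ {k} → T W (suc k) → Dart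
  above (fst t) = dart (-, t) 4F
  above (nid t) = dart (-, t) 3F
  above (mid {s} _ t) = dart (-, t) (midSide s)

  cross-W : ∀ {k} → T W (suc k) → Fin 7 → Dart
  cross-W t 0F = above t
  cross-W t 1F = dart (right t) 6F
  cross-W t 2F = dart (-, lst t) 0F
  cross-W t 3F = dart (-, mid W t) 0F
  cross-W t 4F = dart (-, fst t) 0F
  cross-W t 5F = dart (-, lst (proj₂ (left t))) 1F
  cross-W t 6F = dart (left t) (rightSide (proj₁ (left t)))

  parent : ∀ {k} → T B (suc k) → Tl k
  parent (lst t) = -, t

  cross-B : ∀ {k} → T B (suc k) → Fin 7 → Dart
  cross-B t 0F = dart (parent t) (lastSide (proj₁ (parent t)))
  cross-B t 1F = dart (right (proj₂ (parent t))) 5F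
  cross-B t 2F = dart (right t) 6F
  cross-B t 3F = dart (-, lst t) 0F
  cross-B t 4F = dart (-, fst t) 0F
  cross-B t 5F = dart (-, lst (proj₂ (left t))) 1F
  cross-B t 6F = dart (left t) (rightSide (proj₁ (left t)))

  cross-V : Fin 7 → Dart
  cross-V 0F = dart (-, rt) 6F
  cross-V 1F = dart (-, lst rt) 0F
  cross-V 2F = dart (-, mid V rt) 0F
  cross-V 3F = dart (-, nid rt) 0F
  cross-V 4F = dart (-, fst rt) 0F
  cross-V 5F = dart (-, lst rt) 1F
  cross-V 6F = dart (-, rt) 0F

  cross : Dart → Dart
  cross (zero , (_ , rt) , i) = cross-V i
  cross (suc k , (W , t) , i) = cross-W t i
  cross (suc k , (B , t) , i) = cross-B t i

  turn⁷ : ∀ d → turn (turn (turn (turn (turn (turn (turn d)))))) ≡ d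
  turn⁷ (k , t , 0F) = refl
  turn⁷ (k , t , 1F) = refl
  turn⁷ (k , t , 2F) = refl
  turn⁷ (k , t , 3F) = refl
  turn⁷ (k , t , 4F) = refl
  turn⁷ (k , t , 5F) = refl
  turn⁷ (k , t , 6F) = refl

  cross-right : ∀ {k} (t : Tl (suc k)) → cross (dart t (rightSide (proj₁ t))) ≡ dart (right (proj₂ t)) 6F
  cross-right (W , t) = refl
  cross-right (B , t) = refl

  cross-left : ∀ {k} (t : Tl (suc k)) → cross (dart t 6F) ≡ dart (left (proj₂ t)) (rightSide (proj₁ (left (proj₂ t))))
  cross-left (W , t) = refl
  cross-left (B , t) = refl

  cross-last : ∀ {k} (t : Tl k) → cross (dart t (lastSide (proj₁ t))) ≡ dart (-, lst (proj₂ t)) 0F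
  cross-last {zero} (V , rt) = refl
  cross-last {suc k} (W , t) = refl
  cross-last {suc k} (B , t) = refl

  cross-fifth : ∀ {k} (t : Tl k) → cross (dart t 5F) ≡ dart (-, lst (proj₂ (left (proj₂ t)))) 1F
  cross-fifth {zero} (V , rt) = refl
  cross-fifth {suc k} (W , t) = refl
  cross-fifth {suc k} (B , t) = refl

  cross-first : ∀ {k} (t : Tl k) → cross (dart t 4F) ≡ dart (-, fst (proj₂ t)) 0F
  cross-first {zero} (V , rt) = refl
  cross-first {suc k} (W , t) = refl
  cross-first {suc k} (B , t) = refl

  cross² : ∀ d → cross (cross d) ≡ d
  cross² (zero , (_ , rt) , 0F) = refl
  cross² (zero , (_ , rt) , 1F) = refl
  cross² (zero , (_ , rt) , 2F) = refl
  cross² (zero , (_ , rt) , 3F) = refl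
  cross² (zero , (_ , rt) , 4F) = refl
  cross² (zero , (_ , rt) , 5F) = refl
  cross² (zero , (_ , rt) , 6F) = refl
  cross² (suc k , (W , fst t) , 0F) = cross-first (-, t)
  cross² (suc k , (W , nid rt) , 0F) = refl
  cross² (suc k , (W , mid V rt) , 0F) = refl
  cross² (suc (suc k) , (W , mid W t) , 0F) = refl
  cross² (suc k , (W , t) , 1F) = trans (cross-left (right t)) (cong (λ z → dart z (rightSide (proj₁ z))) (left-right t))
  cross² (suc k , (W , t) , 2F) = refl
  cross² (suc k , (W , t) , 3F) = refl
  cross² (suc k , (W , t) , 4F) = refl
  cross² (suc k , (W , t) , 5F) = cong (λ z → dart z 5F) (right-left t)
  cross² (suc k , (W , t) , 6F) = trans (cross-right (left t)) (cong (λ z → dart z 6F) (right-left t))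
  cross² (suc k , (B , lst t) , 0F) = cross-last (-, t)
  cross² (suc k , (B , lst t) , 1F) = trans (cross-fifth (right t)) (cong (λ z → dart (-, lst (proj₂ z)) 1F) (left-right t))
  cross² (suc k , (B , t@(lst _)) , 2F) = trans (cross-left (right t)) (cong (λ z → dart z (rightSide (proj₁ z))) (left-right t))
  cross² (suc k , (B , lst _) , 3F) = refl
  cross² (suc k , (B , lst _) , 4F) = refl
  cross² (suc k , (B , t@(lst _)) , 5F) = cong (λ z → dart z 5F) (right-left t)
  cross² (suc k , (B , t@(lst _)) , 6F) = trans (cross-right (left t)) (cong (λ z → dart z 6F) (right-left t))

  tc : Dart → Dart
  tc d = cross (turn d)

  to-last : ∀ {k} (t : Tl k) → tc (dart t (rightSide (proj₁ t))) ≡ dart (-, lst (proj₂ t)) 0F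
  to-last t = trans (cong cross (cong (dart t) (next (proj₁ t)))) (cross-last t)
    where
    next : ∀ s → succ (rightSide s) ≡ lastSide s
    next V = refl
    next W = refl
    next B = refl

  tc-left : ∀ {k} (t : Tl k) → tc (dart t 5F) ≡ dart (left (proj₂ t)) (rightSide (proj₁ (left (proj₂ t))))
  tc-left {zero} (V , rt) = refl
  tc-left {suc k} t = cross-left t

  tc-fifth : ∀ {k} (t : Tl k) → tc (dart t 4F) ≡ dart (-, lst (proj₂ (left (proj₂ t)))) 1F
  tc-fifth = cross-fifth

  ac-right : ∀ {k} (t : Tl k) → tc (tc (tc (dart t (rightSide (proj₁ t))))) ≡ dart t (rightSide (proj₁ t))
  ac-right t = trans (cong (λ z → tc (tc z)) (to-last t))
    (trans (tc-left (right (proj₂ t))) (cong (λ z → dart z (rightSide (proj₁ z))) (left-right (proj₂ t))))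

  ac-first : ∀ {k} (t : Tl k) → tc (tc (tc (dart t 4F))) ≡ dart t 4F
  ac-first t = trans (cong (λ z → tc (tc z)) (tc-fifth t)) (cong (λ z → dart z 4F) (right-left (proj₂ t)))

  ac-fifth : ∀ {k} (t : Tl k) → tc (tc (tc (dart t 5F))) ≡ dart t 5F
  ac-fifth t = trans (cong (λ z → tc (tc z)) (tc-left t))
    (trans (cong tc (to-last (left (proj₂ t)))) (cong (λ z → dart z 5F) (right-left (proj₂ t))))

  -- Three tiles around each vertex. The vertex between the sides 6 and 0 of `rt` is the centre of
  -- the rotation: there the three tiles coincide and `tc` itself fixes the dart.
  ac-cube : ∀ d → tc (tc (tc d)) ≡ d
  ac-cube (zero , (_ , rt) , 0F) = refl
  ac-cube (zero , (_ , rt) , 1F) = refl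
  ac-cube (zero , (_ , rt) , 2F) = refl
  ac-cube (zero , (_ , rt) , 3F) = refl
  ac-cube (zero , (_ , rt) , 4F) = refl
  ac-cube (zero , (_ , rt) , 5F) = refl
  ac-cube (zero , (_ , rt) , 6F) = refl
  ac-cube (suc k , (W , fst {V} rt) , 0F) = refl
  ac-cube (suc _ , (W , fst {W} {suc k} t) , 0F) = refl
  ac-cube (suc _ , (W , fst {B} {suc k} t) , 0F) = refl
  ac-cube (suc k , (W , nid rt) , 0F) = refl
  ac-cube (suc k , (W , mid V rt) , 0F) = refl
  ac-cube (suc (suc k) , (W , mid W t) , 0F) = refl
  ac-cube (suc k , (W , t) , 1F) = ac-right (W , t)
  ac-cube (suc k , (W , t) , 2F) = refl
  ac-cube (suc k , (W , t) , 3F) = refl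
  ac-cube (suc k , (W , t) , 4F) = ac-first (W , t)
  ac-cube (suc k , (W , t) , 5F) = ac-fifth (W , t)
  ac-cube (suc k , (W , fst t) , 6F) = trans (cong (λ z → tc z) (tc-fifth (-, t))) (cong (λ z → dart (-, fst (proj₂ z)) 6F) (right-left t))
  ac-cube (suc k , (W , nid rt) , 6F) = refl
  ac-cube (suc k , (W , mid V rt) , 6F) = refl
  ac-cube (suc (suc k) , (W , mid W t) , 6F) = refl
  ac-cube (suc k , (B , lst t) , 0F) = trans (cong tc (tc-left (right t)))
    (trans (cong (λ z → tc (dart z (rightSide (proj₁ z)))) (left-right t)) (to-last (-, t)))
  ac-cube (suc k , (B , lst t) , 1F) = trans (cong tc (cross-up (right t)))
    (trans (tc-fifth (right t)) (cong (λ z → dart (-, lst (proj₂ z)) 1F) (left-right t)))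
    where
    cross-up : ∀ {k} (t : Tl k) → tc (dart (-, fst (proj₂ t)) 6F) ≡ dart t 4F
    cross-up t = refl
  ac-cube (suc k , (B , t@(lst _)) , 2F) = ac-right (B , t)
  ac-cube (suc k , (B , lst _) , 3F) = refl
  ac-cube (suc k , (B , t@(lst _)) , 4F) = ac-first (B , t)
  ac-cube (suc k , (B , t@(lst _)) , 5F) = ac-fifth (B , t)
  ac-cube (suc k , (B , lst {V} rt) , 6F) = refl
  ac-cube (suc _ , (B , lst {W} {suc k} t) , 6F) = refl
  ac-cube (suc _ , (B , lst {B} {suc k} t) , 6F) = refl

-- From an infinite run to a tiling.

module TilingFromRun where
  open import Defs hiding (a; c)
  open import Data.Nat using (ℕ; zero; suc; pred; _≤_; s≤s)
  open import Data.Nat.Properties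
  open import Data.Bool using (Bool; true; false; not)
  open import Data.Bool.Properties using (not-involutive)
  open import Data.Fin using (Fin; zero; suc; toℕ)
  open import Data.Fin.Patterns
  open import Data.Vec using (Vec; lookup; replicate; _[_]≔_)
  open import Data.Vec.Properties using (lookup-map; lookup∘update; lookup∘update′; lookup-replicate)
  open import Data.List using (List; []; _∷_; _++_; map; concatMap; length; foldl)
  import Data.List as L
  open import Data.List.Properties using (map-∘; foldl-++)
  open import Data.List.Membership.Propositional using (_∈_; lose)
  open import Data.List.Membership.Propositional.Properties using (∈-concatMap⁺; ∈-map⁺)
  open import Data.List.Relation.Unary.All using (All; []; _∷_)
  import Data.List.Relation.Unary.All as All
  open import Data.List.Relation.Unary.Any using (Any; here; there)
  open import Data.Product using (∃; ∃₂; _×_; _,_; proj₁; proj₂; -,_)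
  open import Data.Sum using (_⊎_; inj₁; inj₂)
  open import Data.Unit using (tt)
  open import Data.Empty using (⊥; ⊥-elim)
  open import Relation.Binary.Definitions using (DecidableEquality)
  open import Relation.Binary.PropositionalEquality
  open import Relation.Nullary using (yes; no)
  open StackMachines
  open RowInvariant
  open Heptagons
  open Tilesets
  open ForcedRuns
  open RootedTiles

  kids : ∀ {k} → Tl k → List (Tl (suc k))
  kids (V , t) = (-, fst t) ∷ (-, nid t) ∷ (-, mid V t) ∷ (-, lst t) ∷ []
  kids (W , t) = (-, fst t) ∷ (-, mid W t) ∷ (-, lst t) ∷ []
  kids (B , t) = (-, fst t) ∷ (-, lst t) ∷ []

  -- The tiles to the right of a given one, up to the place where the cyclic row is cut.
  aft : ∀ {s k} → T s k → List (Tl k)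
  aft rt = []
  aft (fst {V} t) = (-, nid t) ∷ (-, mid V t) ∷ (-, lst t) ∷ concatMap kids (aft t)
  aft (fst {W} t) = (-, mid W t) ∷ (-, lst t) ∷ concatMap kids (aft t)
  aft (fst {B} t) = (-, lst t) ∷ concatMap kids (aft t)
  aft (nid t) = (-, mid V t) ∷ (-, lst t) ∷ concatMap kids (aft t)
  aft (mid _ t) = (-, lst t) ∷ concatMap kids (aft t)
  aft (lst t) = concatMap kids (aft t)

  -- The cut runs along the chain of first children. To the left of it stands a last child, or `rt`
  -- in row 0, and both are always free.
  frst : ∀ k → Tl k
  frst zero = -, rt
  frst (suc k) = -, fst (proj₂ (frst k))

  tiles : ∀ k → List (Tl k)
  tiles k = frst k ∷ aft (proj₂ (frst k))

  kids-aft : ∀ {s k} (t : T s k) → (-, fst t) ∷ aft (fst t) ≡ kids (-, t) ++ concatMap kids (aft t)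
  kids-aft {V} t = refl
  kids-aft {W} t = refl
  kids-aft {B} t = refl

  tiles-suc : ∀ k → tiles (suc k) ≡ concatMap kids (tiles k)
  tiles-suc k = kids-aft (proj₂ (frst k))

  aft-right : ∀ {s k} (t : T s k) → aft t ≡ right t ∷ aft (proj₂ (right t)) ⊎ aft t ≡ [] × right t ≡ frst k
  aft-right rt = inj₂ (refl , refl)
  aft-right (fst {V} t) = inj₁ refl
  aft-right (fst {W} t) = inj₁ refl
  aft-right (fst {B} t) = inj₁ refl
  aft-right (nid t) = inj₁ refl
  aft-right (mid _ t) = inj₁ refl
  aft-right (lst t) with aft-right t
  ... | inj₁ e = inj₁ (trans (cong (concatMap kids) e) (sym (kids-aft (proj₂ (right t)))))
  ... | inj₂ (e , e′) = inj₂ (cong (concatMap kids) e , cong (λ z → -, fst (proj₂ z)) e′)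

  descend : ∀ {s k} {t : T s k} {u} → (s , t) ∈ tiles k → u ∈ kids (s , t) → u ∈ tiles (suc k)
  descend {k = k} {u = u} p q = subst (u ∈_) (sym (tiles-suc k)) (∈-concatMap⁺ kids (lose p q))

  ∈-tiles : ∀ {s k} (t : T s k) → (s , t) ∈ tiles k
  ∈-tiles rt = here refl
  ∈-tiles (fst {V} t) = descend (∈-tiles t) (here refl)
  ∈-tiles (fst {W} t) = descend (∈-tiles t) (here refl)
  ∈-tiles (fst {B} t) = descend (∈-tiles t) (here refl)
  ∈-tiles (nid t) = descend (∈-tiles t) (there (here refl))
  ∈-tiles (mid V t) = descend (∈-tiles t) (there (there (here refl)))
  ∈-tiles (mid W t) = descend (∈-tiles t) (there (here refl))
  ∈-tiles (lst {V} t) = descend (∈-tiles t) (there (there (there (here refl))))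
  ∈-tiles (lst {W} t) = descend (∈-tiles t) (there (there (here refl)))
  ∈-tiles (lst {B} t) = descend (∈-tiles t) (there (here refl))

  module _ {Sym : Set} where
    -- The signal of a pop as it leaves a stretch of tiles on the left, when `false` enters on the
    -- right.
    sigs : List (Cell Sym) → Bool
    sigs [] = false
    sigs (σ ∷ σs) = sig (sigs σs) σ

    -- There is nothing to the left of the row, so the leftmost cells cover nothing.
    Left0 : ℕ → Row {Sym} → Set
    Left0 H r = ∀ {K h b} → K ≤ H → First K r h b → b ≡ false

    -- This lets the cyclic row close up during a pop: what leaves on the left of the cut is the bit
    -- of the leftmost cell or `false`, and equals the `false` fed in on the right.
    sigs-false : ∀ {s} r → All (Rel s) r → Left0 (length s) r → sigs (map proj₁ r) ≡ false
    sigs-false [] _ _ = refl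
    sigs-false ((free , h) ∷ r) (_ ∷ rs) l0 = sigs-false r rs (λ le f → l0 le (skip f))
    sigs-false ((top a z , h) ∷ r) (top e p ∷ rs) l0 = l0 ≤-refl (hit top (at-bound p))
    sigs-false ((cov a z , h) ∷ r) _ _ = refl

    module _ {L} (l : Fin L) (a : Sym) where
      first-push⁻ : ∀ {K H h b} is → K ≤ H → First K (map (next (push l a) H) is) h b → First K (row is) h b
      first-push⁻ (((free , _) , _) ∷ is) le (hit _ p) = ⊥-elim (<⇒≱ p le)
      first-push⁻ (((top _ _ , _) , _) ∷ is) le (hit cov p) = hit top p
      first-push⁻ (((cov _ _ , _) , _) ∷ is) le (hit cov p) = hit cov p
      first-push⁻ (((free , _) , _) ∷ is) le (high p f) = skip (first-push⁻ is le f)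
      first-push⁻ (((top _ _ , _) , _) ∷ is) le (high p f) = high p (first-push⁻ is le f)
      first-push⁻ (((cov _ _ , _) , _) ∷ is) le (high p f) = high p (first-push⁻ is le f)

      -- After a push no tile is free, so for the new value of `K` the first cell is the leftmost
      -- tile itself: an old cell, or a new one whose bit is the `false` on its left side.
      left0-push : ∀ {s σh y} is → All (Rel s) (row ((σh , false , y) ∷ is)) → Left0 (length s) (row ((σh , false , y) ∷ is)) →
                   Left0 (suc (length s)) (map (next (push l a) (length s)) ((σh , false , y) ∷ is))
      left0-push {s} {σh} {y} is rs l0 le f with m≤n⇒m<n∨m≡n le
      ... | inj₁ (s≤s le′) = l0 le′ (first-push⁻ ((σh , false , y) ∷ is) le′ f)
      left0-push {σh = free , _} is rs l0 le (hit top _) | inj₂ refl = refl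
      left0-push {σh = free , _} is rs l0 le (high p _) | inj₂ refl = ⊥-elim (<-irrefl refl p)
      left0-push {σh = top _ _ , _} is (r ∷ _) l0 le (hit cov p) | inj₂ refl = l0 ≤-refl (hit top (rel-bound r top))
      left0-push {σh = top _ _ , _} is (r ∷ _) l0 le (high p _) | inj₂ refl = ⊥-elim (<⇒≱ p (m≤n⇒m≤1+n (rel-bound r top)))
      left0-push {σh = cov _ _ , _} is (r ∷ _) l0 le (hit cov p) | inj₂ refl = l0 ≤-refl (hit cov (rel-bound r cov))
      left0-push {σh = cov _ _ , _} is (r ∷ _) l0 le (high p _) | inj₂ refl = ⊥-elim (<⇒≱ p (m≤n⇒m≤1+n (rel-bound r cov)))

      first-pop⁻ : ∀ {K h b} H s is → All (Rel s) (row is) → K ≤ pred (length s) →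
                   First K (map (next (pop l a) H) is) h b → First K (row is) h b
      first-pop⁻ H s (((free , _) , _) ∷ is) (_ ∷ rs) le (high p f) = high p (first-pop⁻ H s is rs le f)
      first-pop⁻ H s (((free , _) , _) ∷ is) (_ ∷ rs) le (skip f) = skip (first-pop⁻ H s is rs le f)
      first-pop⁻ H s (((top _ _ , _) , _) ∷ is) (_ ∷ rs) le (high p f) = high p (first-pop⁻ H s is rs le f)
      first-pop⁻ H (c ∷ s) (((top _ _ , _) , _) ∷ is) (top refl _ ∷ rs) le (skip f) = high (s≤s le) (first-pop⁻ H (c ∷ s) is rs le f)
      first-pop⁻ H [] (((top _ _ , _) , _) ∷ is) (top _ () ∷ rs) le (skip f)
      first-pop⁻ H s (((cov _ _ , _) , _ , true) ∷ is) _ le (hit top p) = hit cov p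
      first-pop⁻ H s (((cov _ _ , _) , _ , false) ∷ is) _ le (hit cov p) = hit cov p
      first-pop⁻ H s (((cov _ _ , _) , _ , true) ∷ is) (_ ∷ rs) le (high p f) = high p (first-pop⁻ H s is rs le f)
      first-pop⁻ H s (((cov _ _ , _) , _ , false) ∷ is) (_ ∷ rs) le (high p f) = high p (first-pop⁻ H s is rs le f)

    left0-step : ∀ {L} (op : Op L Sym) {s s′ σh x y} is → Act op s s′ → (∀ {l a} → op ≡ push l a → x ≡ false) →
                 All (Rel s) (row ((σh , x , y) ∷ is)) → Left0 (length s) (row ((σh , x , y) ∷ is)) →
                 Left0 (length s′) (map (next op (length s)) ((σh , x , y) ∷ is))
    left0-step (push l a) is push x≡ rs l0 rewrite x≡ refl = left0-push l a is rs l0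
    left0-step (pop l a) {s} is pop _ rs l0 le f = l0 (m≤n⇒m≤1+n le) (first-pop⁻ l a (suc (length s)) s _ rs le f)
    left0-step (pop l a) is pop∅ _ rs l0 le f = l0 le (first-pop⁻ l a 0 [] _ rs le f)
    left0-step (peek l a) {s} {σh = σh} {x} {y} is peek _ rs l0 {K} {h} {z} le f =
      l0 le (subst (λ r → First K r h z) (peek-same l a (length s) ((σh , x , y) ∷ is)) f)
    left0-step (peek l a) {σh = σh} {x} {y} is peek∅ _ rs l0 {K} {h} {z} le f =
      l0 le (subst (λ r → First K r h z) (peek-same l a 0 ((σh , x , y) ∷ is)) f)

    first-frees⁻ : ∀ {K fs r h b} → All (λ (σ , _) → σ ≡ free) fs → First K (fs ++ r) h b → First {Sym} K r h b
    first-frees⁻ [] f = f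
    first-frees⁻ (refl ∷ ps) (high _ f) = first-frees⁻ ps f
    first-frees⁻ (refl ∷ ps) (skip f) = first-frees⁻ ps f

    first-expand⁻ : ∀ {K r r′ h b} → Expand r r′ → First K r′ h b → First {Sym} K r h b
    first-expand⁻ (put ps e) (hit c le) = hit c le
    first-expand⁻ (put ps e) (high lt (high _ f)) = high lt (first-expand⁻ e (first-frees⁻ ps f))
    first-expand⁻ (put ps e) (high lt (skip f)) = high lt (first-expand⁻ e (first-frees⁻ ps f))
    first-expand⁻ (put ps e) (skip (high _ f)) = skip (first-expand⁻ e (first-frees⁻ ps f))
    first-expand⁻ (put ps e) (skip (skip f)) = skip (first-expand⁻ e (first-frees⁻ ps f))

  module Existence {L : ℕ} {Sym : Set} (_≟ˢ_ : DecidableEquality Sym) (syms : List Sym) (syms-complete : ∀ a → a ∈ syms) {Lab : Set} where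
    open Tiles {L} _≟ˢ_ syms syms-complete
    open Forced {L} _≟ˢ_ syms syms-complete {Lab}

    module Build (colour : Slot → Lab → ℕ) (colour-injective : ∀ {s s′ l l′} → colour s l ≡ colour s′ l′ → s ≡ s′ × l ≡ l′)
                 (Δ : List (Lab × Op L Sym × Lab)) where
      open Paint colour colour-injective
      open Follow colour colour-injective Δ using (Tr; tr; Conf; Step; Inf; module Step)

      module Picture (ρ : ℕ → Conf) (steps : ∀ k → Step (ρ k) (ρ (suc k))) (start : proj₂ (ρ 0) ≡ replicate L []) where
        op : ℕ → Op L Sym
        op k = Step.op (steps k)

        stack : ℕ → Fin L → List Sym
        stack k l = lookup (proj₂ (ρ k)) l

        state   : ∀ k {s} → T s k → State
        heights : ∀ k {s} → T s k → Vec ℕ L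
        -- The bits of a row are computed from the states of that row, and the states from the bits
        -- of the row above, so the recursion descends along `k`. Push bits look across the cut, pop
        -- bits start at it.
        bits    : Op L Sym → ∀ k {s} → T s k → Bool × Bool

        bits (push l a) k t = isTop (lookup (state k (proj₂ (left t))) l) , isTop (lookup (state k t) l)
        bits (pop l a) k t =
          let y = sigs (map (λ u → lookup (state k (proj₂ u)) l) (aft t)) in sig y (lookup (state k t) l) , y
        bits (peek l a) k t = false , false

        state (suc k) (fst t) = after (op k) (proj₁ (bits (op k) k t)) (proj₂ (bits (op k) k t)) (state k t)
        state _ _ = frees

        heights (suc k) (fst t) = heights k t [ l ]≔
          proj₂ (next (op k) (length (stack k l)) ((lookup (state k t) l , lookup (heights k t) l) , bits (op k) k t))
          where l = layer (op k)
        heights _ _ = replicate L 0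

        lbit rbit : ∀ {k} → Tl k → Bool
        lbit {k} t = proj₁ (bits (op k) k (proj₂ t))
        rbit {k} t = proj₂ (bits (op k) k (proj₂ t))

        cell : Fin L → ∀ {k} → Tl k → Cell Sym × ℕ
        cell l {k} (_ , t) = lookup (state k t) l , lookup (heights k t) l

        item : ∀ {k} → Tl k → Item
        item {k} t = cell (layer (op k)) t , lbit t , rbit t

        cells-of : Fin L → ∀ k → Row
        cells-of l k = map (cell l) (tiles k)

        items : ∀ k → List Item
        items k = map item (tiles k)

        row-items : ∀ k → row (items k) ≡ cells-of (layer (op k)) k
        row-items k = sym (map-∘ (tiles k))

        record RowInv (k : ℕ) (l : Fin L) : Set where
          field
            inv′  : Inv (stack k l) (cells-of l k)
            apart : Apart (cells-of l k)
            hasFree : HasFree (cells-of l k)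
            left0 : Left0 (length (stack k l)) (cells-of l k)
        open RowInv

        next-cell : ∀ {k} (t : Tl k) → let l = layer (op k) in
                    cell l (-, fst (proj₂ t)) ≡ next (op k) (length (stack k l)) (item t)
        next-cell {k} (_ , t) = cong₂ _,_ (trans (lookup∘update l (state k t) _) (sym (next-post (op k) _ _ _ _ _)))
                                          (lookup∘update l (heights k t) _)
          where
          l = layer (op k)
          next-post : ∀ (op : Op L Sym) H σ h x y → proj₁ (next op H ((σ , h) , x , y)) ≡ post op x y σ
          next-post (push _ _) H free h x y = refl
          next-post (push _ _) H (top _ _) h x y = refl
          next-post (push _ _) H (cov _ _) h x y = refl
          next-post (pop _ _) H σ h x y = refl
          next-post (peek _ _) H σ h x y = refl

        same-cell : ∀ {k} l (t : Tl k) → l ≢ layer (op k) → cell l (-, fst (proj₂ t)) ≡ cell l t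
        same-cell {k} l (_ , t) ne = cong₂ _,_ (lookup∘update′ ne (state k t) _) (lookup∘update′ ne (heights k t) _)

        is-free : ∀ l → lookup frees l ≡ free
        is-free l = lookup-replicate l free

        put′ : ∀ {x x′ w : Cell Sym × ℕ} {fs r r′} → x′ ≡ x → proj₁ w ≡ free → All (λ (σ , _) → σ ≡ free) fs → Expand r r′ →
               Expand (x ∷ r) (x′ ∷ w ∷ fs ++ r′)
        put′ refl refl ps e = put ps e

        expand : ∀ {k} l (f : Tl k → Cell Sym × ℕ) → (∀ t → cell l (-, fst (proj₂ t)) ≡ f t) →
                 ∀ ts → Expand (map f ts) (map (cell l) (concatMap kids ts))
        expand l f e [] = []
        expand l f e (t@(V , _) ∷ ts) = put′ (e t) (is-free l) (is-free l ∷ is-free l ∷ []) (expand l f e ts)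
        expand l f e (t@(W , _) ∷ ts) = put′ (e t) (is-free l) (is-free l ∷ []) (expand l f e ts)
        expand l f e (t@(B , _) ∷ ts) = put′ (e t) (is-free l) [] (expand l f e ts)

        -- The bits of a row fit together only if its invariant holds, and the invariant of the next
        -- row needs fitting bits. Both are therefore carried through one induction on the rows.
        module AtRow (k : ℕ) (ri : ∀ l → RowInv k l) where
          l₀ : Fin L
          l₀ = layer (op k)

          act : Act (op k) (stack k l₀) (Step.top (steps k))
          act = Step.act (steps k)

          ok : ∀ {s} (t : T s k) → Ok (op k) (lbit (s , t)) (rbit (s , t)) (lookup (state k t) l₀)
          ok {s} t = go (op k) act (All.lookup (rel (inv′ (ri l₀))) (∈-map⁺ (cell l₀) (∈-tiles t)))
            where
            go : ∀ (op : Op L Sym) {s s′ h} → Act op s s′ → Rel s (lookup (state k t) (layer op) , h) →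
                 Ok op (proj₁ (bits op k t)) (proj₂ (bits op k t)) (lookup (state k t) (layer op))
            go (push l a) _ _ = refl
            go (pop l a) ac r = refl , reads-act (inj₁ ac) r
            go (peek l a) ac r = reads-act (inj₂ ac) r

          leftmost-pop : sigs (map (λ u → lookup (state k (proj₂ u)) l₀) (tiles k)) ≡ false
          leftmost-pop = trans (cong sigs (map-∘ {g = proj₁} {f = cell l₀} (tiles k))) (sigs-false (cells-of l₀ k) (rel (inv′ (ri l₀))) (left0 (ri l₀)))

          -- Agreement of bits across the cut. For a push both sides speak of the same tile; for a
          -- pop both bits are `false`, on the left by `leftmost-pop`.
          wrap : ∀ (t : Tl k) → aft (proj₂ t) ≡ [] → right (proj₂ t) ≡ frst k → rbit t ≡ lbit (frst k)
          wrap (_ , t) none r = go (op k) leftmost-pop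
            where
            go : ∀ (op : Op L Sym) → sigs (map (λ u → lookup (state k (proj₂ u)) (layer op)) (tiles k)) ≡ false →
                 proj₂ (bits op k t) ≡ proj₁ (bits op k (proj₂ (frst k)))
            go (push l a) _ = cong (λ z → isTop (lookup (state k (proj₂ z)) l)) (trans (sym (left-right t)) (cong (λ z → left (proj₂ z)) r))
            go (pop l a) e = trans (cong (λ z → sigs (map (λ u → lookup (state k (proj₂ u)) l) z)) none) (sym e)
            go (peek l a) _ = refl

          rbit≡lbit : ∀ (t : Tl k) → rbit t ≡ lbit (right (proj₂ t))
          rbit≡lbit (s , t) with aft-right t
          ... | inj₂ (none , r) = trans (wrap (s , t) none r) (cong lbit (sym r))
          ... | inj₁ e = go (op k)
            where
            go : ∀ (op : Op L Sym) → proj₂ (bits op k t) ≡ proj₁ (bits op k (proj₂ (right t)))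
            go (push l a) = cong (λ z → isTop (lookup (state k (proj₂ z)) l)) (sym (left-right t))
            go (pop l a) = cong (λ z → sigs (map (λ u → lookup (state k (proj₂ u)) l) z)) e
            go (peek l a) = refl

          wired : ∀ us (t : Tl k) → aft (proj₂ t) ≡ us → Wired (map item (t ∷ us))
          wired [] t e = tt
          wired (u ∷ us) (_ , t) e with aft-right t
          ... | inj₂ (none , _) with () ← trans (sym e) none
          ... | inj₁ e′ with refl ← trans (sym e) e′ = rbit≡lbit (-, t) , wired us u refl

          oks : All (OkItem (op k)) (items k)
          oks = go (tiles k)
            where
            go : ∀ ts → All (OkItem (op k)) (map item ts)
            go [] = []
            go ((_ , t) ∷ ts) = ok t ∷ go ts

          leftmost-bit : ∀ {l a} → op k ≡ push l a → lbit (frst k) ≡ false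
          leftmost-bit e = go (op k) e (λ l → leftmost-free k l)
            where
            leftmost-free : ∀ k l → isTop (lookup (state k (proj₂ (left (proj₂ (frst k))))) l) ≡ false
            leftmost-free zero l = cong isTop (is-free l)
            leftmost-free (suc k) l = cong isTop (is-free l)
            go : ∀ (op : Op L Sym) {l a} → op ≡ push l a → (∀ l → isTop (lookup (state k (proj₂ (left (proj₂ (frst k))))) l) ≡ false) →
                 proj₁ (bits op k (proj₂ (frst k))) ≡ false
            go (push l a) refl e = e l

          H : ℕ
          H = length (stack k l₀)

          invₙ : Inv (Step.top (steps k)) (map (next (op k) H) (items k))
          invₙ = inv-step (op k) (items k) act (wired _ (frst k) refl) oks
                   (subst Apart (sym (row-items k)) (apart (ri l₀))) (subst HasFree (sym (row-items k)) (hasFree (ri l₀)))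
                   (subst (Inv _) (sym (row-items k)) (inv′ (ri l₀)))

          left0ₙ : Left0 (length (Step.top (steps k))) (map (next (op k) H) (items k))
          left0ₙ = left0-step (op k) _ act leftmost-bit (subst (All (Rel _)) (sym (row-items k)) (rel (inv′ (ri l₀))))
                     (λ {K} {h} {z} le f → left0 (ri l₀) le (subst (λ r → First K r h z) (row-items k) f))

          grow : ∀ l s r → stack (suc k) l ≡ s → Inv s r → Left0 (length s) r → Expand r (cells-of l (suc k)) →
                 (∃₂ λ x r′ → r ≡ x ∷ r′) → RowInv (suc k) l
          grow l s r e i l0 ex (_ , _ , refl) rewrite sym e = record
            { inv′ = inv-expand ex i ; apart = apart-expand ex ; hasFree = free-expand ex
            ; left0 = λ le f → l0 le (first-expand⁻ ex f) }

          row-next : ∀ l → RowInv (suc k) l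
          row-next l with l Data.Fin.≟ l₀
          ... | yes refl = grow l (Step.top (steps k)) (map (next (op k) H) (items k))
                  (trans (cong (λ z → lookup z l) (Step.upd (steps k))) (lookup∘update l (proj₂ (ρ k)) _)) invₙ left0ₙ
                  (subst₂ Expand (map-∘ (tiles k)) (cong (map (cell l)) (sym (tiles-suc k)))
                    (expand l _ next-cell (tiles k)))
                  (-, -, refl)
          ... | no ne = grow l (stack k l) (cells-of l k)
                  (trans (cong (λ z → lookup z l) (Step.upd (steps k))) (lookup∘update′ ne (proj₂ (ρ k)) _)) (inv′ (ri l)) (left0 (ri l))
                  (subst (Expand _) (cong (map (cell l)) (sym (tiles-suc k)))
                    (expand l _ (λ t → same-cell l t ne) (tiles k)))
                  (-, -, refl)

        row-inv : ∀ k l → RowInv k l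
        row-inv (suc k) = AtRow.row-next k (row-inv k)
        row-inv zero l = record
          { inv′ = inv (subst (λ z → Rel (stack 0 l) (z , lookup (replicate L 0) l)) (sym f) free ∷ [])
                       ((λ c → ⊥-elim (no-cell c)) , tt) (λ {h} {x} p → ⊥-elim (empty (subst (λ z → At z h x) e p)))
          ; apart = (λ c → ⊥-elim (no-cell c)) , tt ; hasFree = here f
          ; left0 = λ _ → none f }
          where
          e : stack 0 l ≡ []
          e = trans (cong (λ z → lookup z l) start) (lookup-replicate l [])
          f : lookup frees l ≡ free
          f = is-free l
          no-cell : ∀ {z} → IsCell (lookup frees l) z → ⊥
          no-cell c with subst (λ σ → IsCell σ _) f c
          ... | ()
          empty : ∀ {h x} → At [] h x → ⊥
          empty ()
          none : ∀ {σ n K h z} → σ ≡ free → First {Sym} K ((σ , n) ∷ []) h z → z ≡ false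
          none refl (hit () _)
          none _ (high _ ())
          none _ (skip ())

        par : ℕ → Bool
        par zero = false
        par (suc k) = not (par k)

        parents : Sh → Sh → Parents
        parents B _ = BW
        parents _ B = WB
        parents _ _ = WW

        shapeOf : ∀ {s k} → T s k → Shape
        shapeOf rt = v
        shapeOf {k = k} (fst t) = wf (par k)
        shapeOf {k = k} (nid t) = wn (par k)
        shapeOf {k = k} (mid _ t) = wm (par k)
        shapeOf {k = k} (lst {s} t) = b (parents s (proj₁ (right t))) (par k)

        datum : ∀ {k} → Tl k → Datum
        datum {k} t = shapeOf (proj₂ t) , state k (proj₂ t) , lbit t , rbit t

        sides : ∀ {k} → Tl k → Vec (Bool × Slot) 7
        sides {k} t = schemeOf (op k) (datum t)

        label : ℕ → Lab
        label k = proj₁ (ρ k)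

        colD : Dart → ℕ
        colD (k , t , i) = paint (label k) (label (suc k)) (lookup (sides t) i)

        lastKind fifthKind : Sh → DownKind
        lastKind B = lB
        lastKind _ = lW
        fifthKind B = kB
        fifthKind _ = kW

        rightKind leftKind : ∀ {s k} → T s k → HorKind
        rightKind rt = h₀
        rightKind (fst _) = hi
        rightKind (nid _) = hi
        rightKind (mid _ _) = hj
        rightKind (lst _) = hb
        leftKind rt = h₀
        leftKind (fst _) = hb
        leftKind (nid _) = hi
        leftKind (mid _ _) = hi
        leftKind (lst {s} t) = Kinds.lastLeft (parents s (proj₁ (right t)))

        left≡right : ∀ {s k} (t : T s k) → leftKind (proj₂ (right t)) ≡ rightKind t
        left≡right rt = refl
        left≡right (fst {V} t) = refl
        left≡right (fst {W} t) = refl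
        left≡right (fst {B} t) = refl
        left≡right (nid t) = refl
        left≡right (mid V t) with proj₁ (right t)
        ... | V = refl
        ... | W = refl
        ... | B = refl
        left≡right (mid W t) with proj₁ (right t)
        ... | V = refl
        ... | W = refl
        ... | B = refl
        left≡right (lst t) = refl

        side-first : ∀ {k} (t : Tl k) → lookup (sides t) 4F ≡
                     (false , dst (par k) (after (op k) (lbit t) (rbit t) (state k (proj₂ t))))
        side-first (_ , rt) = refl
        side-first (_ , fst t) = refl
        side-first (_ , nid t) = refl
        side-first (_ , mid _ t) = refl
        side-first (_ , lst t) = refl

        side-last : ∀ {k} (t : Tl k) → lookup (sides t) (lastSide (proj₁ t)) ≡ (false , dn (lastKind (proj₁ t)) (par k))
        side-last (_ , rt) = refl
        side-last (_ , fst t) = refl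
        side-last (_ , nid t) = refl
        side-last (_ , mid _ t) = refl
        side-last (_ , lst t) = refl

        side-fifth : ∀ {k} (t : Tl k) → lookup (sides t) 5F ≡ (false , dn (fifthKind (proj₁ t)) (par k))
        side-fifth (_ , rt) = refl
        side-fifth (_ , fst t) = refl
        side-fifth (_ , nid t) = refl
        side-fifth (_ , mid _ t) = refl
        side-fifth (_ , lst t) = refl

        side-right : ∀ {k} (t : Tl k) → lookup (sides t) (rightSide (proj₁ t)) ≡ (false , hor (rightKind (proj₂ t)) (par k) (op k) (rbit t))
        side-right (_ , rt) = refl
        side-right (_ , fst t) = refl
        side-right (_ , nid t) = refl
        side-right (_ , mid _ t) = refl
        side-right (_ , lst t) = refl

        side-left : ∀ {k} (t : Tl k) → lookup (sides t) 6F ≡ (false , hor (leftKind (proj₂ t)) (par k) (op k) (lbit t))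
        side-left (_ , rt) = refl
        side-left (_ , fst t) = refl
        side-left (_ , nid t) = refl
        side-left (_ , mid _ t) = refl
        side-left (_ , lst t) = refl

        lKind≡ : ∀ {s k} (t : T s k) → Kinds.lKind (parents s (proj₁ (right t))) ≡ lastKind s
        lKind≡ {B} t = refl
        lKind≡ {V} t with proj₁ (right t)
        ... | V = refl
        ... | W = refl
        ... | B = refl
        lKind≡ {W} t with proj₁ (right t)
        ... | V = refl
        ... | W = refl
        ... | B = refl

        kKind≡ : ∀ {s k} (t : T s k) → Kinds.kKind (parents s (proj₁ (right t))) ≡ fifthKind (proj₁ (right t))
        kKind≡ {B} (lst t) = refl
        kKind≡ {V} t with proj₁ (right t)
        ... | V = refl
        ... | W = refl
        ... | B = refl
        kKind≡ {W} t with proj₁ (right t)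
        ... | V = refl
        ... | W = refl
        ... | B = refl

        Match : Dart → Set
        Match d = colD (cross d) ≡ colD d

        -- Since `cross` is an involution, each side needs to be checked from only one of its two
        -- darts.
        flip : ∀ d → Match (cross d) → Match d
        flip d e = trans (sym e) (cong colD (cross² d))

        flip′ : ∀ d {d′} → cross d ≡ d′ → Match d′ → Match d
        flip′ d refl = flip d

        match-right : ∀ {k} (t : Tl k) → cross (dart t (rightSide (proj₁ t))) ≡ dart (right (proj₂ t)) 6F → Match (dart t (rightSide (proj₁ t)))
        match-right {k} t e = trans (cong colD e) (cong (paint (label k) (label (suc k)))
          (trans (side-left (right (proj₂ t))) (trans (cong₂ (λ h y → false , hor h (par k) (op k) y)
            (left≡right (proj₂ t)) (sym (AtRow.rbit≡lbit k (row-inv k) t))) (sym (side-right t)))))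

        -- The side of a tile leading up is coloured with the label that the row above calls its target.
        upward : ∀ {k} {z z′ : Bool × Slot} {s} → z ≡ (false , s) → z′ ≡ (true , s) →
                 paint (label k) (label (suc k)) z ≡ paint (label (suc k)) (label (suc (suc k))) z′
        upward refl refl = refl

        match-W : ∀ {k} (t : T W (suc k)) → Match (dart (-, t) 0F)
        match-W {k} (fst t) = upward {k} (side-first (-, t)) (cong (λ z → true , dst z (state (suc k) (fst t))) (not-involutive (par k)))
        match-W {k} (nid rt) = upward {k} refl refl
        match-W {k} (mid V rt) = upward {k} refl refl
        match-W {suc k} (mid W (fst t)) = upward {suc k} refl (cong (λ z → true , dn m z) (not-involutive (par (suc k))))
        match-W {suc k} (mid W (nid t)) = upward {suc k} refl (cong (λ z → true , dn m z) (not-involutive (par (suc k))))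
        match-W {suc k} (mid W (mid _ t)) = upward {suc k} refl (cong (λ z → true , dn m z) (not-involutive (par (suc k))))

        match-B₀ : ∀ {k} (t : T B (suc k)) → Match (dart (-, t) 0F)
        match-B₀ {k} (lst t) = upward {k} (side-last (-, t)) (cong₂ (λ x z → true , dn x z) (lKind≡ t) (not-involutive (par k)))

        match-B₁ : ∀ {k} (t : T B (suc k)) → Match (dart (-, t) 1F)
        match-B₁ {k} (lst t) = upward {k} (side-fifth (right t)) (cong₂ (λ x z → true , dn x z) (kKind≡ t) (not-involutive (par k)))

        match : ∀ d → Match d
        match (zero , (_ , rt) , 0F) = match-right (-, rt) refl
        match d@(zero , (_ , rt) , 1F) = flip d (match-B₀ (lst rt))
        match d@(zero , (_ , rt) , 2F) = flip d (match-W (mid V rt))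
        match d@(zero , (_ , rt) , 3F) = flip d (match-W (nid rt))
        match d@(zero , (_ , rt) , 4F) = flip d (match-W (fst rt))
        match d@(zero , (_ , rt) , 5F) = flip d (match-B₁ (lst rt))
        match d@(zero , (_ , rt) , 6F) = flip d (match-right (-, rt) refl)
        match (suc k , (W , t) , 0F) = match-W t
        match (suc k , (W , t) , 1F) = match-right (-, t) refl
        match d@(suc k , (W , t) , 2F) = flip d (match-B₀ (lst t))
        match d@(suc k , (W , t) , 3F) = flip d (match-W (mid W t))
        match (suc k , (B , t) , 0F) = match-B₀ t
        match (suc k , (B , t) , 1F) = match-B₁ t
        match (suc k , (B , t) , 2F) = match-right (-, t) refl
        match d@(suc k , (B , t) , 3F) = flip d (match-B₀ (lst t))
        match d@(suc k , t , 4F) = flip′ d (cross-first t) (match-W (fst (proj₂ t)))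
        match d@(suc k , t , 5F) = flip′ d (cross-fifth t) (match-B₁ (lst (proj₂ (left (proj₂ t)))))
        match d@(suc k , t , 6F) = flip′ d (cross-left t) (match-right (left (proj₂ t)) (cross-right (left (proj₂ t))))

        valid : ∀ {k} (t : Tl k) → Valid (op k) (datum t)
        valid {k} t = AtRow.ok k (row-inv k) (proj₂ t) , fitting (proj₂ t)
          where
          fitting : ∀ {s k} (t : T s k) → Fits (shapeOf t) (state k t) (lbit (s , t)) (rbit (s , t))
          fitting rt = refl , sym (AtRow.rbit≡lbit 0 (row-inv 0) (-, rt))
          fitting (fst t) = tt
          fitting (nid t) = refl
          fitting (mid _ t) = refl
          fitting (lst t) = refl

        move : Dart → Defs.Gen → Dart
        move d Defs.a = turn d
        move d Defs.c = cross d

        -- Words act on the darts of the quotient. A colouring of the heptagrid need only be a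
        -- function of words invariant under the relators, so pulling back along this action gives
        -- one without constructing the covering plane.
        at-word : Word → Dart
        at-word = foldl move (0 , (-, rt) , 0F)

        relator : ∀ d r → r ∈ relators → foldl move d r ≡ d
        relator d _ (here refl) = turn⁷ d
        relator d _ (there (here refl)) = cross² d
        relator d _ (there (there (here refl))) = ac-cube d

        turns : ∀ {k} (t : Tl k) i j → foldl move (k , t , i) (L.replicate j Defs.a) ≡ (k , t , turned j i)
        turns t i zero = refl
        turns t i (suc j) = trans (turns t (succ i) j) (cong (λ z → -, t , z) (comm j))
          where
          comm : ∀ j → turned j (succ i) ≡ succ (turned j i)
          comm zero = refl
          comm (suc j) = cong succ (comm j)

        copy-of : ∀ g → Any (IsCopy (λ w → colD (at-word w)) g) (tileset Δ)
        copy-of g = go (at-word g) refl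
          where
          moves : ∀ k → (label k , op k , label (suc k)) ∈ Δ
          moves k with Step.tr (steps k)
          ... | tr p = p
          go : ∀ d → at-word g ≡ d → Any (IsCopy (λ w → colD (at-word w)) g) (tileset Δ)
          go (k , t , i) e = lose (∈-tileset⁺ (moves k) (valid t)) (toℕ i , inj₁ λ j →
            trans (cong colD (trans (foldl-++ move _ g _) (trans (cong (λ d → foldl move d (L.replicate (toℕ j) Defs.a)) e) (turns t i (toℕ j)))))
              (trans (cong (λ z → colD (k , t , z)) (rot-true i j)) (sym (lookup-map _ (paint (label k) (label (suc k))) (sides t)))))

        tileable : Tileable (tileset Δ)
        tileable = (λ w → colD (at-word w)) , well-defined , (λ g → trans (cong colD (foldl-++ move _ g _)) (match (at-word g))) , copy-of
          where
          well-defined : WellDefined (λ w → colD (at-word w))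
          well-defined u w r r∈ = cong colD (trans (foldl-++ move _ u (r ++ w)) (trans (foldl-++ move _ r w)
            (trans (cong (λ d → foldl move d w) (relator (at-word u) r r∈)) (sym (foldl-++ move _ u w)))))

      module _ {Tr′ : Lab → Op L Sym → Lab → Set} where
        module R = Run {L} {Sym} {Lab} Tr′

        tileable⇒run : (∀ {p op q} → (p , op , q) ∈ Δ → Tr′ p op q) → Tileable (tileset Δ) → ∃ R.Inf
        tileable⇒run sound t with Follow.run colour colour-injective Δ (word-darts (tileset Δ) t) []
        ... | c , ρ , e , steps = c , ρ , e , λ k → convert (steps k)
          where
          convert : ∀ {c c′} → Step c c′ → R.Step c c′
          convert (Run.step (tr r∈) act upd) = Run.step (sound r∈) act upd

        run⇒tileable : (∀ {p op q} → Tr′ p op q → (p , op , q) ∈ Δ) → ∀ {p} → R.Inf (p , replicate L []) → Tileable (tileset Δ)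
        run⇒tileable complete (ρ , e , steps) = Picture.tileable ρ (λ k → convert (steps k)) (cong proj₂ e)
          where
          convert : ∀ {c c′} → R.Step c c′ → Step c c′
          convert (Run.step t act upd) = Run.step (tr (complete t)) act upd

-- Numbering the colours, and the diagonal argument.

module Diagonal where
  open import Defs hiding (a; c)
  open import Data.Nat using (ℕ; zero; suc; _+_; _≤_; _<_; s≤s)
  open import Data.Nat.Properties using (+-identityʳ; m≤n⇒m<n∨m≡n; ≤-refl; <⇒≤) renaming (_≟_ to _≟ℕ_)
  open import Data.Bool using (Bool; true; false; not)
  open import Data.Fin using (Fin; zero; suc; toℕ)
  open import Data.Fin.Patterns
  open import Data.Fin.Properties using (toℕ-injective)
  open import Data.Vec using ([]; _∷_; lookup; replicate)
  import Data.Vec as V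
  import Data.Vec.Properties as V
  open import Data.List using (List; []; _∷_; _++_; map; concatMap; length; cartesianProduct; cartesianProductWith; allFin)
  import Data.List as L
  open import Data.List.Properties using (map-∘; map-cong; map-++; concatMap-++)
  open import Data.List.Membership.Propositional using (_∈_)
  open import Data.List.Membership.Propositional.Properties using (∈-++⁺ˡ; ∈-++⁺ʳ; ∈-++⁻; ∈-map⁺; ∈-map⁻; ∈-allFin; ∈-cartesianProductWith⁺)
  open import Data.List.Relation.Unary.Any using (here; there; index)
  open import Data.List.Relation.Unary.Any.Properties using (lookup-index)
  open import Data.Maybe using (Maybe; just; nothing)
  open import Data.Maybe.Properties using (just-injective)
  import Data.Maybe as Maybe
  open import Data.Product using (∃; _×_; _,_; proj₁; proj₂)
  open import Data.Sum using (_⊎_; inj₁; inj₂)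
  open import Data.Empty using (⊥)
  open import Relation.Binary.Definitions using (DecidableEquality)
  open import Relation.Binary.PropositionalEquality
  open import Relation.Nullary using (¬_)
  open import Relation.Nullary.Decidable using (map′)
  open TileCodes
  open CounterMachines using (Edge; src; tgt; Decider; decider)
  open StackMachines
  open NestedFrames
  open Heptagons hiding (m; n; b; v)
  open Tilesets
  open RootedTiles using ()
  open TilingFromRun hiding (tiles)

  module Numbering {A : Set} {xs : List A} (complete : ∀ x → x ∈ xs) where
    number : A → ℕ
    number x = toℕ (index (complete x))

    number-injective : ∀ {x y} → number x ≡ number y → x ≡ y
    number-injective {x} {y} e = trans (lookup-index (complete x)) (trans (cong (L.lookup xs) (toℕ-injective e)) (sym (lookup-index (complete y))))

    equal? : DecidableEquality A
    equal? x y = map′ number-injective (cong number) (number x ≟ℕ number y)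

  bit : Bool → ℕ
  bit false = 0
  bit true = 1

  bit-injective : ∀ {x y} → bit x ≡ bit y → x ≡ y
  bit-injective {false} {false} _ = refl
  bit-injective {true} {true} _ = refl

  find-fin : ∀ {E} → ℕ → Maybe (Fin E)
  find-fin {zero} _ = nothing
  find-fin {suc E} zero = just zero
  find-fin {suc E} (suc i) = Maybe.map suc (find-fin i)

  find-toℕ : ∀ {E} (e : Fin E) → find-fin (toℕ e) ≡ just e
  find-toℕ zero = refl
  find-toℕ (suc e) = cong (Maybe.map suc) (find-toℕ e)

  module _ {E : ℕ} where
    symbols : List (Sym E)
    symbols = o ∷ u ∷ bot ∷ st ∷ map mk bools ++ map ed (allFin E)

    symbols-complete : ∀ x → x ∈ symbols
    symbols-complete o = here refl
    symbols-complete u = there (here refl)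
    symbols-complete bot = there (there (here refl))
    symbols-complete st = there (there (there (here refl)))
    symbols-complete (mk x) = there (there (there (there (∈-++⁺ˡ (∈-map⁺ mk (bools-complete x))))))
    symbols-complete (ed e) = there (there (there (there (∈-++⁺ʳ _ (∈-map⁺ ed (∈-allFin e))))))

    key : St E → ℕ × Bool × Bool × ℕ
    key (A d) = 0 , d , false , 0
    key (B d) = 1 , d , false , 0
    key (O d) = 2 , d , false , 0
    key (V d) = 3 , d , false , 0
    key (CA d) = 4 , d , false , 0
    key (CB d) = 5 , d , false , 0
    key (A′ d x) = 6 , d , x , 0
    key (R d x) = 7 , d , x , 0
    key (I d i) = 8 , d , false , i
    key (N d i) = 9 , d , false , i
    key (S d i) = 10 , d , false , i
    key (P d e) = 11 , d , false , toℕ e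
    key (U d e) = 12 , d , false , toℕ e
    key (Nf d x i) = 13 , d , x , i
    key (Fr d x i) = 14 , d , x , i

    -- A partial left inverse gives injectivity of `key` from 15 cases; comparing the constructors
    -- in pairs would take 225.
    unkey : ℕ × Bool × Bool × ℕ → Maybe (St E)
    unkey (0 , d , x , i) = just (A d)
    unkey (1 , d , x , i) = just (B d)
    unkey (2 , d , x , i) = just (O d)
    unkey (3 , d , x , i) = just (V d)
    unkey (4 , d , x , i) = just (CA d)
    unkey (5 , d , x , i) = just (CB d)
    unkey (6 , d , x , i) = just (A′ d x)
    unkey (7 , d , x , i) = just (R d x)
    unkey (8 , d , x , i) = just (I d i)
    unkey (9 , d , x , i) = just (N d i)
    unkey (10 , d , x , i) = just (S d i)
    unkey (11 , d , x , i) = Maybe.map (P d) (find-fin i)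
    unkey (12 , d , x , i) = Maybe.map (U d) (find-fin i)
    unkey (13 , d , x , i) = just (Nf d x i)
    unkey (14 , d , x , i) = just (Fr d x i)
    unkey _ = nothing

    unkey-key : ∀ s → unkey (key s) ≡ just s
    unkey-key (A d) = refl
    unkey-key (B d) = refl
    unkey-key (O d) = refl
    unkey-key (V d) = refl
    unkey-key (CA d) = refl
    unkey-key (CB d) = refl
    unkey-key (A′ d x) = refl
    unkey-key (R d x) = refl
    unkey-key (I d i) = refl
    unkey-key (N d i) = refl
    unkey-key (S d i) = refl
    unkey-key (P d e) = cong (Maybe.map (P d)) (find-toℕ e)
    unkey-key (U d e) = cong (Maybe.map (U d)) (find-toℕ e)
    unkey-key (Nf d x i) = refl
    unkey-key (Fr d x i) = refl

    key-injective : ∀ {s s′} → key s ≡ key s′ → s ≡ s′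
    key-injective {s} {s′} e = just-injective (trans (sym (unkey-key s)) (trans (cong unkey e) (unkey-key s′)))

    -- The one number that may vary with the input is kept apart from the rest of the state, so that
    -- the colour of a counting state has a fixed first component and an affine second one.
    tag arg : St E → ℕ
    tag s = let (c , d , x , _) = key s in pair c (pair (bit d) (bit x))
    arg s = proj₂ (proj₂ (proj₂ (key s)))

    tag-arg-injective : ∀ {s s′} → tag s ≡ tag s′ → arg s ≡ arg s′ → s ≡ s′
    tag-arg-injective {s} {s′} e e′ with key s in k | key s′ in k′
    ... | c , d , x , i | c′ , d′ , x′ , i′ with pair-injective {c} {pair (bit d) (bit x)} {c′} e
    ... | refl , e″ with pair-injective {bit d} {bit x} {bit d′} e″
    ... | b≡ , b≡′ with bit-injective {d} {d′} b≡ | bit-injective {x} {x′} b≡′ | e′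
    ... | refl | refl | refl = key-injective (trans k (sym k′))

    -- States relative to a parameter: in `num` and `nf` the number is an offset, added to the
    -- parameter by `at-param`.
    data Label : Set where
      fixed : St E → Label
      num   : Bool → ℕ → Label
      nf    : Bool → Bool → ℕ → Label

    at-param : ℕ → Label → St E
    at-param i (fixed s) = s
    at-param i (num d j) = N d (j + i)
    at-param i (nf d x j) = Nf d x (j + i)

  module Reduction {K} (es : List (Edge K)) (inp : Fin K) where
    E Ly : ℕ
    E = length es
    Ly = 3 + K

    Oper : Set
    Oper = Op Ly (Sym E)

    module Symbols = Numbering (symbols-complete {E})
    open Tiles {Ly} Symbols.equal? symbols symbols-complete

    opers : List Oper
    opers = cartesianProductWith push (allFin Ly) symbols ++ cartesianProductWith pop (allFin Ly) symbols ++
            cartesianProductWith peek (allFin Ly) symbols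

    opers-complete : ∀ x → x ∈ opers
    opers-complete (push l x) = ∈-++⁺ˡ (∈-cartesianProductWith⁺ push (∈-allFin l) (symbols-complete x))
    opers-complete (pop l x) = ∈-++⁺ʳ (cartesianProductWith push (allFin Ly) symbols)
      (∈-++⁺ˡ (∈-cartesianProductWith⁺ pop (∈-allFin l) (symbols-complete x)))
    opers-complete (peek l x) = ∈-++⁺ʳ (cartesianProductWith push (allFin Ly) symbols)
      (∈-++⁺ʳ (cartesianProductWith pop (allFin Ly) symbols) (∈-cartesianProductWith⁺ peek (∈-allFin l) (symbols-complete x)))

    downKinds : List DownKind
    downKinds = DownKind.m ∷ DownKind.n ∷ lW ∷ lB ∷ kW ∷ kB ∷ []

    downKinds-complete : ∀ x → x ∈ downKinds
    downKinds-complete DownKind.m = here refl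
    downKinds-complete DownKind.n = there (here refl)
    downKinds-complete lW = there (there (here refl))
    downKinds-complete lB = there (there (there (here refl)))
    downKinds-complete kW = there (there (there (there (here refl))))
    downKinds-complete kB = there (there (there (there (there (here refl)))))

    horKinds : List HorKind
    horKinds = hi ∷ hj ∷ hb ∷ h₀ ∷ []

    horKinds-complete : ∀ x → x ∈ horKinds
    horKinds-complete hi = here refl
    horKinds-complete hj = there (here refl)
    horKinds-complete hb = there (there (here refl))
    horKinds-complete h₀ = there (there (there (here refl)))

    downs stateds hors slots : List Slot
    downs = cartesianProductWith dn downKinds bools
    stateds = cartesianProductWith dst bools (allVecs cells Ly)
    hors = cartesianProductWith (λ (k , p) (op , x) → hor k p op x) (cartesianProduct horKinds bools) (cartesianProduct opers bools)
    slots = downs ++ stateds ++ hors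

    slots-complete : ∀ x → x ∈ slots
    slots-complete (dn k p) = ∈-++⁺ˡ (∈-cartesianProductWith⁺ dn (downKinds-complete k) (bools-complete p))
    slots-complete (dst p σ) = ∈-++⁺ʳ downs (∈-++⁺ˡ (∈-cartesianProductWith⁺ dst (bools-complete p) (allVecs-complete cells-complete σ)))
    slots-complete (hor k p op x) = ∈-++⁺ʳ downs (∈-++⁺ʳ stateds (∈-cartesianProductWith⁺ (λ (k , p) (op , x) → hor k p op x)
      (∈-cartesianProductWith⁺ _,_ (horKinds-complete k) (bools-complete p))
      (∈-cartesianProductWith⁺ _,_ (opers-complete op) (bools-complete x))))

    module Slots = Numbering slots-complete

    colour : Slot → St E → ℕ
    colour z s = pair (pair (Slots.number z) (tag s)) (arg s)

    colour-injective : ∀ {z z′ s s′} → colour z s ≡ colour z′ s′ → z ≡ z′ × s ≡ s′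
    colour-injective {z} {z′} {s} {s′} e =
      let (e₁ , e₂) = pair-injective {pair (Slots.number z) (tag s)} {arg s} e
          (e₃ , e₄) = pair-injective {Slots.number z} {tag s} e₁
      in Slots.number-injective e₃ , tag-arg-injective e₄ e₂

    open Paint colour colour-injective
    open Existence {Ly} Symbols.equal? symbols symbols-complete using (module Build)

    entry : Slot → Label {E} → Entry
    entry z (fixed s) = pair (Slots.number z) (tag s) , arg s , 0
    entry z (num d j) = pair (Slots.number z) (tag (N {E} d 0)) , j , 1
    entry z (nf d x j) = pair (Slots.number z) (tag (Nf {E} d x 0)) , j , 1

    entry-colour : ∀ i z ℓ → ⟪ entry z ℓ ⟫ i ≡ colour z (at-param i ℓ)
    entry-colour i z (fixed s) = cong (pair (pair (Slots.number z) (tag s))) (+-identityʳ (arg s))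
    entry-colour i z (num d j) = cong (λ y → pair (pair (Slots.number z) (tag (N {E} d 0))) (j + y)) (+-identityʳ i)
    entry-colour i z (nf d x j) = cong (λ y → pair (pair (Slots.number z) (tag (Nf {E} d x 0))) (j + y)) (+-identityʳ i)

    Rule : Set
    Rule = Label {E} × Oper × Label {E}

    ruleAt : ℕ → Rule → St E × Oper × St E
    ruleAt i (p , op , q) = at-param i p , op , at-param i q

    paintᵉ : Label → Label → Bool × Slot → Entry
    paintᵉ p q (true , z) = entry z p
    paintᵉ p q (false , z) = entry z q

    paintᵉ-paint : ∀ i p q z → ⟪ paintᵉ p q z ⟫ i ≡ paint (at-param i p) (at-param i q) z
    paintᵉ-paint i p q (true , z) = entry-colour i z p
    paintᵉ-paint i p q (false , z) = entry-colour i z q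

    rulePattern : Rule → Pattern
    rulePattern (p , op , q) = map (V.map (paintᵉ p q)) (schemes op)

    pattern-of : List Rule → Pattern
    pattern-of = concatMap rulePattern

    inst-rule : ∀ i r → inst i (rulePattern r) ≡ tilesOf (ruleAt i r)
    inst-rule i (p , op , q) = trans (sym (map-∘ (schemes op))) (map-cong
      (λ w → trans (sym (V.map-∘ _ _ w)) (V.map-cong (paintᵉ-paint i p q) w)) (schemes op))

    inst-pattern : ∀ i rs → inst i (pattern-of rs) ≡ tileset (map (ruleAt i) rs)
    inst-pattern i [] = refl
    inst-pattern i (r ∷ rs) = trans (map-++ _ (rulePattern r) (pattern-of rs)) (cong₂ _++_ (inst-rule i r) (inst-pattern i rs))

    private module Machine n = Frames es inp n
    open Layout es using (F; hL; rL; the; opOf; undoOf)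

    -- Rules that do not depend on the input, or only in the label num d 0 or nf d x 0 taken at the input.
    record BaseRule : Set where
      constructor _∣_
      field
        rule  : Rule
        sound : ∀ n → let (p , op , q) = ruleAt n rule in Machine.Tr n p op q
    open BaseRule

    flags : List (Bool × Bool)
    flags = cartesianProduct bools bools

    flags-complete : ∀ x → x ∈ flags
    flags-complete (d , x) = ∈-cartesianProductWith⁺ _,_ (bools-complete d) (bools-complete x)

    flagged : Fin 9 → Bool → BaseRule
    flagged 0F d = (fixed (A d) , pop (F d) o , fixed (CA d)) ∣ λ n → Machine.a-o
    flagged 1F d = (fixed (CA d) , push (F d) (mk false) , fixed (I (not d) 0)) ∣ λ n → Machine.call-a
    flagged 2F d = (fixed (CB d) , push (F d) (mk true) , fixed (I (not d) 0)) ∣ λ n → Machine.call-b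
    flagged 3F d = (fixed (I d K) , peek (rL inp) bot , fixed (N d 0)) ∣ λ n → Machine.init-end refl
    flagged 4F d = (num d 0 , push hL st , fixed (A d)) ∣ λ n → Machine.num-end refl
    flagged 5F d = (fixed (R d false) , peek hL st , fixed (S d 0)) ∣ λ n → Machine.r-st
    flagged 6F d = (fixed (O d) , push (F (not d)) o , fixed (A d)) ∣ λ n → Machine.o-push
    flagged 7F d = (fixed (V d) , push (F d) o , fixed (B d)) ∣ λ n → Machine.v-push
    flagged 8F d = (fixed (B d) , pop (F (not d)) o , fixed (CB d)) ∣ λ n → Machine.b-o

    flagged₂ : Fin 5 → Bool × Bool → BaseRule
    flagged₂ 0F (d , x) = (fixed (A d) , pop (F d) (mk x) , fixed (A′ d x)) ∣ λ n → Machine.a-m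
    flagged₂ 1F (d , x) = (fixed (A′ d x) , push (F d) (mk x) , fixed (B d)) ∣ λ n → Machine.a-back
    flagged₂ 2F (d , x) = (fixed (B d) , pop (F (not d)) (mk x) , fixed (Nf d x 0)) ∣ λ n → Machine.b-m
    flagged₂ 3F (d , x) = (nf d x 0 , peek (rL inp) bot , fixed (Fr d x 0)) ∣ λ n → Machine.nf-end refl
    flagged₂ 4F (d , x) = (fixed (Fr d x K) , pop hL st , fixed (R (not d) x)) ∣ λ n → Machine.fr-end refl

    edged : Fin 5 → Bool × Fin E → BaseRule
    edged 0F (d , e) = (fixed (R d false) , peek hL (ed e) , fixed (S d (tgt (the e)))) ∣ λ n → Machine.r-ed e
    edged 1F (d , e) = (fixed (S d (src (the e))) , opOf (the e) , fixed (P d e)) ∣ λ n → Machine.s-op e refl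
    edged 2F (d , e) = (fixed (P d e) , push hL (ed e) , fixed (O d)) ∣ λ n → Machine.p-push
    edged 3F (d , e) = (fixed (R d true) , pop hL (ed e) , fixed (U d e)) ∣ λ n → Machine.r-pop e
    edged 4F (d , e) = (fixed (U d e) , undoOf (the e) , fixed (V d)) ∣ λ n → Machine.u-op

    initRule : Bool → Fin K → BaseRule
    initRule d j = (fixed (I d (toℕ j)) , push (rL j) bot , fixed (I d (suc (toℕ j)))) ∣ λ n → Machine.init j refl

    frRule : Bool × Bool → Fin K → BaseRule
    frRule (d , x) j = (fixed (Fr d x (toℕ j)) , pop (rL j) bot , fixed (Fr d x (suc (toℕ j)))) ∣ λ n → Machine.fr j refl

    abstract
      baseRules : List BaseRule
      baseRules = cartesianProductWith flagged (allFin 9) bools ++ cartesianProductWith flagged₂ (allFin 5) flags ++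
        cartesianProductWith edged (allFin 5) (cartesianProduct bools (allFin E)) ++
        cartesianProductWith initRule bools (allFin K) ++ cartesianProductWith frRule flags (allFin K)

      flagged-in : ∀ k d → flagged k d ∈ baseRules
      flagged-in k d = ∈-++⁺ˡ (∈-cartesianProductWith⁺ flagged (∈-allFin k) (bools-complete d))

      flagged₂-in : ∀ k d x → flagged₂ k (d , x) ∈ baseRules
      flagged₂-in k d x = ∈-++⁺ʳ (cartesianProductWith flagged (allFin 9) bools)
        (∈-++⁺ˡ (∈-cartesianProductWith⁺ flagged₂ (∈-allFin k) (flags-complete (d , x))))

      edged-in : ∀ k d e → edged k (d , e) ∈ baseRules
      edged-in k d e = ∈-++⁺ʳ (cartesianProductWith flagged (allFin 9) bools)
        (∈-++⁺ʳ (cartesianProductWith flagged₂ (allFin 5) flags)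
          (∈-++⁺ˡ (∈-cartesianProductWith⁺ edged (∈-allFin k) (∈-cartesianProductWith⁺ _,_ (bools-complete d) (∈-allFin e)))))

      init-in : ∀ d j → initRule d j ∈ baseRules
      init-in d j = ∈-++⁺ʳ (cartesianProductWith flagged (allFin 9) bools)
        (∈-++⁺ʳ (cartesianProductWith flagged₂ (allFin 5) flags)
          (∈-++⁺ʳ (cartesianProductWith edged (allFin 5) (cartesianProduct bools (allFin E)))
            (∈-++⁺ˡ (∈-cartesianProductWith⁺ initRule (bools-complete d) (∈-allFin j)))))

      fr-in : ∀ d x j → frRule (d , x) j ∈ baseRules
      fr-in d x j = ∈-++⁺ʳ (cartesianProductWith flagged (allFin 9) bools)
        (∈-++⁺ʳ (cartesianProductWith flagged₂ (allFin 5) flags)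
          (∈-++⁺ʳ (cartesianProductWith edged (allFin 5) (cartesianProduct bools (allFin E)))
            (∈-++⁺ʳ (cartesianProductWith initRule bools (allFin K))
              (∈-cartesianProductWith⁺ frRule (flags-complete (d , x)) (∈-allFin j)))))

    numRule : Bool → Rule
    numRule d = num d 0 , push (rL inp) u , num d 1

    nfRule : Bool × Bool → Rule
    nfRule (d , x) = nf d x 0 , pop (rL inp) u , nf d x 1

    abstract
      stepRules : List Rule
      stepRules = map numRule bools ++ map nfRule flags

      num-in : ∀ d → numRule d ∈ stepRules
      num-in d = ∈-++⁺ˡ (∈-map⁺ numRule (bools-complete d))

      nf-in : ∀ d x → nfRule (d , x) ∈ stepRules
      nf-in d x = ∈-++⁺ʳ (map numRule bools) (∈-map⁺ nfRule (flags-complete (d , x)))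

      step-cases : ∀ {r} → r ∈ stepRules → (∃ λ d → r ≡ numRule d) ⊎ (∃ λ d → r ≡ nfRule d)
      step-cases r∈ with ∈-++⁻ (map numRule bools) r∈
      ... | inj₁ r∈′ = let (d , _ , e) = ∈-map⁻ numRule r∈′ in inj₁ (d , e)
      ... | inj₂ r∈′ = let (d , _ , e) = ∈-map⁻ nfRule r∈′ in inj₂ (d , e)

    Δ-steps : ℕ → List (St E × Oper × St E)
    Δ-steps zero = []
    Δ-steps (suc i) = map (ruleAt i) stepRules ++ Δ-steps i

    -- At parameter `n` the label `num d 0` is the state `N d n`, where counting stops; a step rule
    -- at `i` leads from count `i` to `suc i`. So counting up, and likewise down, makes exactly `n`
    -- steps.
    Δ : ℕ → List (St E × Oper × St E)
    Δ n = map (ruleAt n) (map rule baseRules) ++ Δ-steps n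

    abstract
      baseP stepP : Pattern
      baseP = pattern-of (map rule baseRules)
      stepP = pattern-of stepRules

      blocks-steps : ∀ n → blocks stepP n ≡ tileset (Δ-steps n)
      blocks-steps zero = refl
      blocks-steps (suc i) = trans (cong₂ _++_ (inst-pattern i stepRules) (blocks-steps i)) (sym (concatMap-++ tilesOf (map (ruleAt i) stepRules) (Δ-steps i)))

      family-tileset : ∀ n → family baseP stepP n ≡ tileset (Δ n)
      family-tileset n = trans (cong₂ _++_ (inst-pattern n (map rule baseRules)) (blocks-steps n)) (sym (concatMap-++ tilesOf (map (ruleAt n) (map rule baseRules)) (Δ-steps n)))

    module _ (n : ℕ) where
      open Machine n using (Tr; a-o; a-m; a-back; call-a; call-b; init; init-end; num; num-end; r-st; r-ed; s-op; p-push; o-push; r-pop;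
                            u-op; v-push; b-o; b-m; nf; nf-end; fr; fr-end)

      sound-step : ∀ {i r} → i < n → r ∈ stepRules → let (p , op , q) = ruleAt i r in Tr p op q
      sound-step i<n r∈ with step-cases r∈
      ... | inj₁ (_ , refl) = num i<n
      ... | inj₂ (_ , refl) = nf i<n

      sound-Δ : ∀ {p op q} → (p , op , q) ∈ Δ n → Tr p op q
      sound-Δ r∈ with ∈-++⁻ (map (ruleAt n) (map rule baseRules)) r∈
      sound-Δ r∈ | inj₁ r∈′ with ∈-map⁻ (ruleAt n) r∈′
      ... | _ , r∈″ , refl with ∈-map⁻ rule r∈″
      ... | br , _ , refl = sound br n
      sound-Δ r∈ | inj₂ r∈′ = steps n ≤-refl r∈′
        where
        steps : ∀ i → i ≤ n → ∀ {p op q} → (p , op , q) ∈ Δ-steps i → Tr p op q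
        steps (suc i) i≤n r∈ with ∈-++⁻ (map (ruleAt i) stepRules) r∈
        ... | inj₂ r∈′ = steps i (<⇒≤ i≤n) r∈′
        ... | inj₁ r∈′ with ∈-map⁻ (ruleAt i) r∈′
        ... | _ , r∈″ , refl = sound-step i≤n r∈″

      base : ∀ br → br ∈ baseRules → ruleAt n (rule br) ∈ Δ n
      base br br∈ = ∈-++⁺ˡ (∈-map⁺ (ruleAt n) (∈-map⁺ rule br∈))

      counted : ∀ {i r} → i < n → r ∈ stepRules → ruleAt i r ∈ Δ n
      counted {i} {r} i<n r∈ = ∈-++⁺ʳ (map (ruleAt n) (map rule baseRules)) (go n i<n)
        where
        go : ∀ k → i < k → ruleAt i r ∈ Δ-steps k
        go (suc k) (s≤s i≤k) with m≤n⇒m<n∨m≡n i≤k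
        ... | inj₁ i<k = ∈-++⁺ʳ (map (ruleAt k) stepRules) (go k i<k)
        ... | inj₂ refl = ∈-++⁺ˡ (∈-map⁺ (ruleAt i) r∈)

      complete-Δ : ∀ {p op q} → Tr p op q → (p , op , q) ∈ Δ n
      complete-Δ (a-o {d}) = base (flagged 0F d) (flagged-in 0F d)
      complete-Δ (call-a {d}) = base (flagged 1F d) (flagged-in 1F d)
      complete-Δ (call-b {d}) = base (flagged 2F d) (flagged-in 2F d)
      complete-Δ (init-end {d} refl) = base (flagged 3F d) (flagged-in 3F d)
      complete-Δ (num-end {d} refl) = base (flagged 4F d) (flagged-in 4F d)
      complete-Δ (r-st {d}) = base (flagged 5F d) (flagged-in 5F d)
      complete-Δ (o-push {d}) = base (flagged 6F d) (flagged-in 6F d)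
      complete-Δ (v-push {d}) = base (flagged 7F d) (flagged-in 7F d)
      complete-Δ (b-o {d}) = base (flagged 8F d) (flagged-in 8F d)
      complete-Δ (a-m {d} {x}) = base (flagged₂ 0F (d , x)) (flagged₂-in 0F d x)
      complete-Δ (a-back {d} {x}) = base (flagged₂ 1F (d , x)) (flagged₂-in 1F d x)
      complete-Δ (b-m {d} {x}) = base (flagged₂ 2F (d , x)) (flagged₂-in 2F d x)
      complete-Δ (nf-end {d} {x} refl) = base (flagged₂ 3F (d , x)) (flagged₂-in 3F d x)
      complete-Δ (fr-end {d} {x} refl) = base (flagged₂ 4F (d , x)) (flagged₂-in 4F d x)
      complete-Δ (init {d} j refl) = base (initRule d j) (init-in d j)
      complete-Δ (fr {d} {x} j refl) = base (frRule (d , x) j) (fr-in d x j)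
      complete-Δ (r-ed {d} e) = base (edged 0F (d , e)) (edged-in 0F d e)
      complete-Δ (s-op {d} e refl) = base (edged 1F (d , e)) (edged-in 1F d e)
      complete-Δ (p-push {d} {e}) = base (edged 2F (d , e)) (edged-in 2F d e)
      complete-Δ (r-pop {d} e) = base (edged 3F (d , e)) (edged-in 3F d e)
      complete-Δ (u-op {d} {e}) = base (edged 4F (d , e)) (edged-in 4F d e)
      complete-Δ (num {d} i<n) = counted i<n (num-in d)
      complete-Δ (nf {d} {x} i<n) = counted i<n (nf-in d x)

      tiling⇒run : Tileable (family baseP stepP n) → ∃ (Machine.Inf n)
      tiling⇒run t = Build.tileable⇒run colour colour-injective (Δ n) sound-Δ (subst Tileable (family-tileset n) t)

      run⇒tiling : ∀ {p} → Machine.Inf n (p , replicate Ly []) → Tileable (family baseP stepP n)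
      run⇒tiling r = subst Tileable (sym (family-tileset n)) (Build.run⇒tileable colour colour-injective (Δ n) complete-Δ r)

  -- The input is used twice, as the description of a family of tile sets and as its parameter. The
  -- machine for this code is fixed before any input is chosen, so feeding it its own family is not
  -- circular.
  diagonalise : Code 1 → Code 1
  diagonalise f = comp f (comp familyC (proj zero ∷ proj zero ∷ []) ∷ [])

  module Contradiction {f} (decides : DecidesDomino f) (D : Decider (diagonalise f)) where
    open Decider D
    open Reduction es inp

    answer : ∀ {y} n → n ≡ encFamily baseP stepP → f ⟦ encTiles (family baseP stepP n) ∷ [] ⟧⇓ y → diagonalise f ⟦ n ∷ [] ⟧⇓ y
    answer n refl e = app₁ (app₂ ev-proj ev-proj (familyC⇓ baseP stepP n)) e

    -- No case distinction on tileability is made. A tiling would yield answer 1, hence a halting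
    -- machine without infinite runs, against the run in the tiling; so there is none. But then the
    -- answer is 0, the machine runs forever, and its run is a tiling.
    absurd : ∀ n → n ≡ encFamily baseP stepP → ⊥
    absurd n n≡ = not-tileable (run⇒tiling n (FrameRuns.Runs.Forever.forever es inp n det (loops n (answer n n≡ (proj₂ (decides (family baseP stepP n)) not-tileable)))))
      where
      not-tileable : ¬ Tileable (family baseP stepP n)
      not-tileable t =
        let (p , v , (i , h , trace) , stuck) = halts n (answer n n≡ (proj₁ (decides (family baseP stepP n)) t))
            (c , run) = tiling⇒run n t
        in FrameRuns.Runs.Halting.no-run es inp n det trace stuck c run

  undecidable : ¬ (∃ DecidesDomino)
  undecidable (f , decides) = Contradiction.absurd decides (decider (diagonalise f)) _ refl

open import Defs
open import Relation.Nullary using (¬_)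
open import Data.Product using (∃-syntax)

theorem1 : ¬ (∃[ f ] DecidesDomino f)
theorem1 = Diagonal.undecidable
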